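{- Let $T=(V,E)$ be a finite tree with at least one edge, and consider a solution of the inverse-weight Ricci flow (unnormalized or normalized) with positive initial metric. Let $c=(c_e)_{e\in E}$, $c_e=\lim_{t\to\infty}\kappa_e(t)$, be its limiting curvature vector, $c_*=\min_e c_e$, $E_*=\{e:c_e=c_*\}$. Then the set function $\beta$ is submodular, and $c$ is the unique solution of $$\min_{z\in B(\beta)}\frac12\sum_{e\in E}z_e^2 .$$ Let $\alpha_1<\cdots<\alpha_r$ be the distinct entries of $c$, and put $A_0=\varnothing$, $A_j=\{e\in E:c_e\le\alpha_j\}$ for $1\le j\le r$. Then $A_r=E$ and $$\beta(A_j)=\sum_{e\in A_j}c_e .$$ Moreover, for $0\le j<r$, $$\alpha_{j+1}=\min_{A_j\subsetneq A\subseteq E}\frac{\beta(A)-\beta(A_j)}{|A|-|A_j|},$$ and $A_{j+1}$ is the unique largest set attaining this minimum (so that this recursion determines $c$ from the tree alone, without reference to the initial metric). In particular, $$c_*=\min_{\varnothing\ne A\subseteq E}\lambda(A),$$ and $E_*$ is the unique largest set attaining this minimum; equivalently, $$E_*=\bigcup\{A\subseteq E:A\ne\varnothing,\ \beta(A)=c_*|A|\}.$$ In particular $\beta(E_*)=c_*|E_*|$. The sets attaining the minimum of $\lambda$ are closed under unions and under nonempty intersections.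
   Context: $T=(V,E)$ is a finite tree with at least one edge; $d_x$ is the combinatorial degree of $x\in V$ and $E(x)$ the set of edges incident to $x$. A positive metric is $w=(w_e)_{e\in E}$ with all $w_e>0$; it induces the path metric $d_w$ on $V$. Put $D_x(w)=\sum_{e\ni x}1/w_e$. For $\alpha\in[0,1)$ let $m_x^\alpha(x)=\alpha$ and $m_x^\alpha(z)=(1-\alpha)\,w_{xz}^{ -1}/D_x(w)$ for $z\sim x$. The (inverse-weight) Lin--Lu--Yau curvature of $e=xy$ is $\kappa_e(w)=\lim_{\alpha\uparrow1}\frac{1-W_1(m_x^\alpha,m_y^\alpha)/w_e}{1-\alpha}$, with $W_1$ the $1$-Wasserstein distance for $d_w$. Known formula on trees: $\kappa_{xy}(w)=\frac{2-d_x}{w_{xy}D_x(w)}+\frac{2-d_y}{w_{xy}D_y(w)}$. The unnormalized flow is $\dot{\widetilde w}_e=-\kappa_e(\widetilde w)\widetilde w_e$; the normalized flow is $\dot w_e=-w_e(\kappa_e(w)-K(w))$, $K(w)=\sum_f w_f\kappa_f(w)$, $\sum_e w_e(0)=1$, and is obtained from the unnormalized one by dividing by the total edge length; both have the same curvatures $\kappa_e(t)$. For every positive initial metric the limits $c_e=\lim_{t\to\infty}\kappa_e(t)$ exist. For $A\subseteq E$ set $\beta(A)=\sum_{x\in V,\,E(x)\subseteq A}(2-d_x)$ and, if $A\neq\varnothing$, $\lambda(A)=\beta(A)/|A|$. For $z\in\mathbb R^E$ write $z(A)=\sum_{e\in A}z_e$, and let $B(\beta)=\{z\in\mathbb R^E: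 z(A)\le\beta(A)\text{ for every }A\subseteq E,\ z(E)=\beta(E)\}$. Submodular means $\beta(A\cup B)+\beta(A\cap B)\le\beta(A)+\beta(B)$ for all $A,B\subseteq E$. "Unique largest" means that it attains the minimum and contains every set attaining the minimum. -}

module Defs where

open import Algebra.Bundles using (CommutativeRing)
open import Axiom.ExcludedMiddle using (ExcludedMiddle)
open import Data.Bool.Base using (if_then_else_)
open import Data.Fin.Base as Fin using (Fin; zero; suc; inject₁)
open import Data.Fin.Properties using (_≟_)
open import Data.Fin.Subset using (Subset; _⊆_; _⊂_; ⊥; ⊤; ∣_∣)
open import Data.Fin.Subset.Properties using (_∈?_; _⊆?_)
open import Data.List.Base using (List; []; _∷_)
open import Data.List.Relation.Unary.Unique.Propositional using (Unique)
open import Data.Nat.Base as ℕ using (ℕ; zero; suc)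
open import Data.Product.Base using (Σ; ∃; _×_; _,_; proj₁; proj₂)
open import Data.Product.Properties using (≡-dec)
open import Data.Sum.Base using (_⊎_; inj₁; inj₂)
open import Data.Vec.Base using (tabulate)
open import Level using (0ℓ) renaming (suc to lsuc)
open import Relation.Binary.Construct.Closure.ReflexiveTransitive
  using (Star; ε; _◅_)
open import Relation.Binary.PropositionalEquality.Core using (_≡_; _≢_)
open import Relation.Binary.Structures using (IsTotalOrder)
open import Relation.Nullary.Decidable using (Dec; does; _⊎-dec_)
open import Relation.Nullary.Negation using (¬_)

-- The real numbers, given by their characterisation as the Dedekind-complete
-- ordered field, which is unique up to isomorphism.  Equality is a setoid
-- equality so that, granted excluded middle, the usual constructions of the
-- reals (e.g. Cauchy sequences of rationals) are instances.  The value of the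
-- total function _⁻¹ at 0# is unspecified.
record CompleteOrderedField : Set (lsuc 0ℓ) where
  infix  4 _≤_ _<_
  infixl 7 _/_
  infix  8 _⁻¹
  field
    commutativeRing : CommutativeRing 0ℓ 0ℓ
  open CommutativeRing commutativeRing public
    hiding (_-_; zero) renaming (Carrier to ℝ)
  field
    _≤_          : ℝ → ℝ → Set
    _⁻¹          : ℝ → ℝ
    isTotalOrder : IsTotalOrder _≈_ _≤_
    0≉1          : ¬ 0# ≈ 1#
    inverseʳ     : ∀ x → ¬ x ≈ 0# → x * x ⁻¹ ≈ 1#
    +-monoʳ-≤    : ∀ z {x y} → x ≤ y → z + x ≤ z + y
    *-nonneg     : ∀ {x y} → 0# ≤ x → 0# ≤ y → 0# ≤ x * y

  IsUpperBound : (ℝ → Set) → ℝ → Set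
  IsUpperBound P u = ∀ x → P x → x ≤ u

  IsSupremum : (ℝ → Set) → ℝ → Set
  IsSupremum P s = IsUpperBound P s × (∀ u → IsUpperBound P u → s ≤ u)

  field
    complete : (P : ℝ → Set) → ∃ P → ∃ (IsUpperBound P) → ∃ (IsSupremum P)

  open IsTotalOrder isTotalOrder public using (total)

  _<_ : ℝ → ℝ → Set
  x < y = x ≤ y × ¬ x ≈ y

  infixl 6 _-_
  _-_ : ℝ → ℝ → ℝ
  x - y = x + (- y)

  _/_ : ℝ → ℝ → ℝ
  x / y = x * y ⁻¹

  abs : ℝ → ℝ
  abs x with total 0# x
  ... | inj₁ _ = x
  ... | inj₂ _ = - x

-- A finite simple graph with labelled edges; the order in which an edge lists
-- its two ends is irrelevant.
record Graph : Set where
  field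
    order size : ℕ

  Vertex : Set
  Vertex = Fin order

  Edge : Set
  Edge = Fin size

  field
    ends : Edge → Vertex × Vertex

  Joins : Edge → Vertex → Vertex → Set
  Joins e x y = ends e ≡ (x , y) ⊎ ends e ≡ (y , x)

  field
    loopless : ∀ e x → ¬ Joins e x x
    simple   : ∀ e f x y → Joins e x y → Joins f x y → e ≡ f

  joins? : ∀ e x y → Dec (Joins e x y)
  joins? e x y =
    ≡-dec _≟_ _≟_ (ends e) (x , y) ⊎-dec ≡-dec _≟_ _≟_ (ends e) (y , x)

  incident? : ∀ x e → Dec (x ≡ proj₁ (ends e) ⊎ x ≡ proj₂ (ends e))
  incident? x e = (x ≟ proj₁ (ends e)) ⊎-dec (x ≟ proj₂ (ends e))

  -- The set E(x) of edges incident to x.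
  star : Vertex → Subset size
  star x = tabulate (λ e → does (incident? x e))

  degree : Vertex → ℕ
  degree x = ∣ star x ∣

  Adjacent : Vertex → Vertex → Set
  Adjacent x y = ∃ λ e → Joins e x y

  Walk : Vertex → Vertex → Set
  Walk = Star Adjacent

  vertices : ∀ {x y} → Walk x y → List Vertex
  vertices {x} ε       = x ∷ []
  vertices {x} (_ ◅ p) = x ∷ vertices p

  length : ∀ {x y} → Walk x y → ℕ
  length ε       = 0
  length (_ ◅ p) = suc (length p)

-- A cycle is a path of length at least two whose last vertex is adjacent to
-- its first.
record IsTree (T : Graph) : Set where
  open Graph T
  field
    connected : ∀ x y → Walk x y
    acyclic   : ∀ {x y} (p : Walk x y) →
                Unique (vertices p) → 2 ℕ.≤ length p → ¬ Adjacent y x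

module RicciFlow (em : ExcludedMiddle 0ℓ) (R : CompleteOrderedField) (T : Graph) where

  open CompleteOrderedField R public
  open Graph T public
  open import Algebra.Definitions.RawMonoid +-rawMonoid public using (sum)
    renaming (_×_ to _·_)

  fromℕ : ℕ → ℝ
  fromℕ n = n · 1#

  IsInfimum : (ℝ → Set) → ℝ → Set
  IsInfimum P i =
    (∀ x → P x → i ≤ x) × (∀ l → (∀ x → P x → l ≤ x) → l ≤ i)

  IsMinimum : {X : Set} → (X → Set) → (X → ℝ) → ℝ → Set
  IsMinimum P f v = (∃ λ x → P x × f x ≈ v) × (∀ x → P x → v ≤ f x)

  IsMinimizer : {X : Set} → (X → Set) → (X → ℝ) → X → Set
  IsMinimizer P f x = P x × (∀ y → P y → f x ≤ f y)

  IsLargestMinimizer : (Subset size → Set) → (Subset size → ℝ) → Subset size → Set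
  IsLargestMinimizer P f A =
    IsMinimizer P f A × (∀ B → IsMinimizer P f B → B ⊆ A)

  -- f(α) → L as α ↑ a.
  LeftLimit : (ℝ → ℝ) → ℝ → ℝ → Set
  LeftLimit f a L = ∀ ϵ → 0# < ϵ → ∃ λ δ → 0# < δ ×
    (∀ α → a - δ < α → α < a → abs (f α - L) ≤ ϵ)

  -- f(t) → L as t → ∞.
  LimitAtInfinity : (ℝ → ℝ) → ℝ → Set
  LimitAtInfinity f L = ∀ ϵ → 0# < ϵ → ∃ λ t₀ →
    (∀ t → t₀ ≤ t → abs (f t - L) ≤ ϵ)

  -- f, as a function on [0,∞), has derivative v at t (one-sided when t = 0).
  -- Values of f at negative times play no role.
  HasDerivative : (ℝ → ℝ) → ℝ → ℝ → Set
  HasDerivative f t v = ∀ ϵ → 0# < ϵ → ∃ λ δ → 0# < δ ×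
    (∀ s → 0# ≤ s → abs (s - t) < δ →
      abs ((f s - f t) - v * (s - t)) ≤ ϵ * abs (s - t))

  Metric : Set
  Metric = Edge → ℝ

  IsPositive : Metric → Set
  IsPositive w = ∀ e → 0# < w e

  walkLength : Metric → ∀ {x y} → Walk x y → ℝ
  walkLength w ε             = 0#
  walkLength w ((e , _) ◅ p) = w e + walkLength w p

  IsPathMetric : Metric → (Vertex → Vertex → ℝ) → Set
  IsPathMetric w d =
    ∀ x y → IsInfimum (λ l → ∃ λ (p : Walk x y) → walkLength w p ≈ l) (d x y)

  -- D_x(w).
  D : Metric → Vertex → ℝ
  D w x = sum (λ e → if does (incident? x e) then w e ⁻¹ else 0#)

  -- m_x^α.  As the graph is simple, at most one term of the sum over edges is
  -- nonzero, and for z = x none is.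
  measure : Metric → ℝ → Vertex → Vertex → ℝ
  measure w α x z =
    (if does (z ≟ x) then α else 0#) +
    sum (λ e → if does (joins? e x z) then (1# - α) * (w e ⁻¹ / D w x) else 0#)

  IsCoupling : (μ ν : Vertex → ℝ) → (Vertex → Vertex → ℝ) → Set
  IsCoupling μ ν π =
    (∀ u v → 0# ≤ π u v) ×
    (∀ u → sum (λ v → π u v) ≈ μ u) ×
    (∀ v → sum (λ u → π u v) ≈ ν v)

  IsWasserstein₁ : (d : Vertex → Vertex → ℝ) (μ ν : Vertex → ℝ) → ℝ → Set
  IsWasserstein₁ d μ ν = IsInfimum (λ cost → ∃ λ π →
    IsCoupling μ ν π × sum (λ u → sum (λ v → π u v * d u v)) ≈ cost)

  -- k is the inverse-weight Lin–Lu–Yau curvature of e.  The path metric and the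
  -- Wasserstein distances are infima, hence determined up to _≈_ by the
  -- conditions imposed on dist and W₁.
  record IsCurvature (w : Metric) (e : Edge) (k : ℝ) : Set where
    x : Vertex
    x = proj₁ (ends e)

    y : Vertex
    y = proj₂ (ends e)

    field
      dist      : Vertex → Vertex → ℝ
      isDist    : IsPathMetric w dist
      W₁        : ℝ → ℝ
      isW₁      : ∀ α → 0# ≤ α → α < 1# →
                  IsWasserstein₁ dist (measure w α x) (measure w α y) (W₁ α)
      curvature : LeftLimit (λ α → (1# - W₁ α / w e) / (1# - α)) 1# k

  -- A solution on [0,∞), through positive metrics, of the equation whose right
  -- hand side is a function of the metric and its curvatures; κ records the
  -- curvatures along the solution.
  record IsFlow (velocity : Metric → (Edge → ℝ) → Edge → ℝ)
                (w : ℝ → Metric) (κ : ℝ → Edge → ℝ) : Set where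
    field
      positive    : ∀ t → 0# ≤ t → IsPositive (w t)
      isCurvature : ∀ t → 0# ≤ t → ∀ e → IsCurvature (w t) e (κ t e)
      evolution   : ∀ t → 0# ≤ t → ∀ e →
                    HasDerivative (λ s → w s e) t (velocity (w t) (κ t) e)

  UnnormalizedFlow : (ℝ → Metric) → (ℝ → Edge → ℝ) → Set
  UnnormalizedFlow = IsFlow (λ w k e → - (k e * w e))

  NormalizedFlow : (ℝ → Metric) → (ℝ → Edge → ℝ) → Set
  NormalizedFlow w κ =
    IsFlow (λ w k e → - (w e * (k e - sum (λ f → w f * k f)))) w κ ×
    sum (w 0#) ≈ 1#

  β : Subset size → ℝ
  β A = sum (λ x →
    if does (star x ⊆? A) then fromℕ 2 - fromℕ (degree x) else 0#)

  -- The function written λ(A); meaningful for nonempty A.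
  density : Subset size → ℝ
  density A = β A / fromℕ ∣ A ∣

  total-over : (Edge → ℝ) → Subset size → ℝ
  total-over z A = sum (λ e → if does (e ∈? A) then z e else 0#)

  InBase : (Edge → ℝ) → Set
  InBase z = (∀ A → total-over z A ≤ β A) × total-over z ⊤ ≈ β ⊤

  energy : (Edge → ℝ) → ℝ
  energy z = 1# / fromℕ 2 * sum (λ e → z e * z e)

  -- { e | P e }.
  subset : (Edge → Set) → Subset size
  subset P = tabulate (λ e → does (em {P e}))

  -- α₁ < ⋯ < α_r are the distinct entries of c (indexed from zero).
  AreDistinctEntries : ∀ {r} → (Edge → ℝ) → (Fin r → ℝ) → Set
  AreDistinctEntries c α =
    (∀ i j → i Fin.< j → α i < α j) ×
    (∀ j → ∃ λ e → c e ≈ α j) ×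
    (∀ e → ∃ λ j → c e ≈ α j)

  levelSet : ∀ {r} → (Edge → ℝ) → (Fin r → ℝ) → Fin (suc r) → Subset size
  levelSet c α zero    = ⊥
  levelSet c α (suc j) = subset (λ e → c e ≤ α j)

  slope : Subset size → Subset size → ℝ
  slope B A = (β A - β B) / (fromℕ (∣ A ∣) - fromℕ (∣ B ∣))

  -- Since α is indexed from zero, α j here is the number α_{j+1}.
  SatisfiesRecursion : ∀ {r} → (Fin r → ℝ) → (Fin (suc r) → Subset size) → Set
  SatisfiesRecursion α A = ∀ j →
    IsMinimum (A (inject₁ j) ⊂_) (slope (A (inject₁ j))) (α j) ×
    IsLargestMinimizer (A (inject₁ j) ⊂_) (slope (A (inject₁ j))) (A (suc j))

{-# OPTIONS --safe #-}

-- On a tree Kantorovich duality is solved explicitly: the potential measuring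
-- the signed distance from the edge e = xy is 1-Lipschitz, and for α ≥ 1/2 a
-- coupling exists that moves mass only along it.  This gives the curvature
-- formula, hence κ(A) = Σₓ (2 - dₓ) θₓ(A), where θₓ(A) is the fraction of the
-- inverse weights at x lying on edges of A.  Comparing with β vertex by vertex,
-- κ(t) lies in B(β), and so does its limit c.  If c_e < c_f then w_f / w_e tends
-- to 0 along the flow; so if all entries of c on A are smaller than those
-- outside, then θₓ(A) → 0 unless A contains the star of x, and β(A) = c(A).
-- Everything else follows from c ∈ B(β) and the tightness of these lower sets.

module Submission where

open import Defs
open import Axiom.ExcludedMiddle using (ExcludedMiddle)
open import Data.Fin.Base using (Fin; zero; suc; inject₁) renaming (fromℕ to last)
open import Data.Fin.Subset using (Subset; _∈_; _∉_; _∪_; _∩_; ⊥; ⊤; ∣_∣; Nonempty)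
open import Data.Nat.Base using (ℕ; suc)
open import Data.Product.Base using (_×_; ∃)
open import Data.Sum.Base using (_⊎_)
open import Function.Bundles using (_⇔_)
open import Level using (0ℓ)
open import Relation.Binary.PropositionalEquality.Core using (_≡_)
open import Relation.Unary using (U)

import Algebra.Properties.AbelianGroup
import Algebra.Properties.Ring
import Algebra.Properties.Semiring.Mult.TCOptimised
import Algebra.Properties.Semiring.Sum
import Algebra.Solver.CommutativeMonoid
import Algebra.Solver.Ring
open import Algebra.Bundles using (RawRing)
open import Algebra.Solver.Ring.AlmostCommutativeRing
  using (fromCommutativeRing; _-Raw-AlmostCommutative⟶_)
open import Data.Bool.Base using (Bool; true; false; if_then_else_)
import Data.Fin.Base as Fin
import Data.Fin.Properties as Fin
open import Data.Fin.Induction using (<-weakInduction)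
open import Data.Fin.Properties using (_≟_; suc-injective)
open import Data.Fin.Subset using (_⊆_; _⊂_; inside; outside) renaming (_-_ to _∖_)
open import Data.Fin.Subset.Properties
  using (_∈?_; _⊆?_; ∉⊥; ∈⊤; x∈p⇒∣p-x∣<∣p∣; x∈p∧x≢y⇒x∈p-y; p⊆p∪q; q⊆p∪q; p∩q⊆p; p∩q⊆q;
         x∈p∩q⁺; x∈p∪q⁻; ⊆-antisym; ⊆-max; ∣⊥∣≡0; p⊂q⇒∣p∣<∣q∣)
import Data.Integer.Base as ℤ
import Data.Integer.Properties as ℤ
import Data.List.Membership.DecPropositional as DecMembership
import Data.List.Membership.Propositional as List
open import Data.List.Relation.Unary.All using ([]; _∷_)
open import Data.List.Relation.Unary.All.Properties using (¬Any⇒All¬)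
open import Data.List.Relation.Unary.AllPairs using ([]; _∷_)
open import Data.List.Relation.Unary.Any using (here; there)
open import Data.List.Relation.Unary.Unique.Propositional using (Unique)
open import Data.Maybe.Base using (Maybe; just; nothing)
import Data.Nat.Base as ℕ
import Data.Nat.Properties as ℕ
open import Data.Nat.Base using (z≤n; s≤s)
open import Data.Product.Base using (_,_; proj₁; proj₂)
import Data.Sign.Base as Sign
open import Data.Sum.Base using (inj₁; inj₂)
import Data.Unit.Base as Unit
open import Data.Vec.Base using (tabulate; []; _∷_)
open import Data.Vec.Properties using (lookup∘tabulate; []=⇒lookup; lookup⇒[]=)
open import Function.Base using (_∘_)
open import Function.Bundles using (mk⇔)
open import Relation.Binary.Bundles using (Poset)
open import Relation.Binary.Construct.Closure.ReflexiveTransitive using (ε; _◅_; _◅◅_)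
open import Relation.Binary.Definitions using (tri<; tri≈; tri>)
open import Relation.Binary.PropositionalEquality.Core as ≡ using (_≢_)
import Relation.Binary.Reasoning.PartialOrder
import Relation.Binary.Reasoning.Setoid
open import Relation.Binary.Structures using (IsTotalOrder)
open import Relation.Nullary.Decidable using (Dec; yes; no; does; dec-true)
open import Relation.Nullary.Negation using (¬_; contradiction)

-- The signs carry the combinatorics: `2 - d` is 1 at a leaf and at most 0 at any other vertex,
-- while a share strictly between 0 and 1 occurs only at a vertex of the second kind. Replacing such
-- a share by 0 never lowers the sum, whence κ(A) ≤ β(A); submodularity of β has the same cause.
--
-- The ratio w_f / w_e decays because its logarithmic derivative is κ_e - κ_f in either flow, and
-- this is eventually at most half of c_e - c_f < 0. No logarithm or exponential enters: on short
-- steps the ratio shrinks by a factor 1 + η(t - s), such factors compose, and completeness joins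
-- the steps. The resulting decay of order 1/t is weaker than the true exponential one, but a limit
-- 0 asks for no more.
--
-- For the energy, tightness on the level sets makes the linear functional Σ c_e z_e minimal at c
-- over B(β), as in the greedy algorithm for polymatroids. Expanding Σ z_e² about c then leaves Σ
-- (z_e - c_e)², which gives the minimum and its uniqueness together.

-- Ring identities with integer coefficients.

module RingSolver (R : CompleteOrderedField) where
  open CompleteOrderedField R
  open Algebra.Properties.Ring ring
  open Algebra.Properties.AbelianGroup +-abelianGroup using (⁻¹-∙-comm)
  open Algebra.Properties.Semiring.Mult.TCOptimised semiring
    renaming (_×_ to _×ᵣ_)
  open Relation.Binary.Reasoning.Setoid setoid

  ℤ-rawRing : RawRing 0ℓ 0ℓ
  ℤ-rawRing = record
    { Carrier = ℤ.ℤ ; _≈_ = _≡_ ; _+_ = ℤ._+_ ; _*_ = ℤ._*_ ; -_ = ℤ.-_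
    ; 0# = ℤ.0ℤ ; 1# = ℤ.1ℤ }

  -- With the optimised multiple, the image of 1 reduces to `1#` itself, so that `con ℤ.1ℤ` in a
  -- solver equation stands for `1#` by computation.
  fromℤ : ℤ.ℤ → ℝ
  fromℤ (ℤ.+ n)      = n ×ᵣ 1#
  fromℤ (ℤ.-[1+ n ]) = - (suc n ×ᵣ 1#)

  fromℤ-neg : ∀ i → fromℤ (ℤ.- i) ≈ - fromℤ i
  fromℤ-neg (ℤ.+ ℕ.zero)  = sym -0#≈0#
  fromℤ-neg (ℤ.+ suc n)   = refl
  fromℤ-neg ℤ.-[1+ n ]    = sym (-‿involutive _)

  fromℤ-⊖ : ∀ m n → fromℤ (m ℤ.⊖ n) ≈ m ×ᵣ 1# - n ×ᵣ 1#
  fromℤ-⊖ m ℕ.zero = sym (trans (+-congˡ -0#≈0#) (+-identityʳ _))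
  fromℤ-⊖ ℕ.zero (suc n) = sym (+-identityˡ _)
  fromℤ-⊖ (suc m) (suc n) = begin
    fromℤ (suc m ℤ.⊖ suc n)                   ≡⟨ ≡.cong fromℤ (ℤ.[1+m]⊖[1+n]≡m⊖n m n) ⟩
    fromℤ (m ℤ.⊖ n)                           ≈⟨ fromℤ-⊖ m n ⟩
    m ×ᵣ 1# - n ×ᵣ 1#                          ≈⟨ +-congʳ (+-identityˡ _) ⟨
    (0# + m ×ᵣ 1#) - n ×ᵣ 1#                   ≈⟨ +-congʳ (+-congʳ (-‿inverseʳ 1#)) ⟨
    ((1# - 1#) + m ×ᵣ 1#) - n ×ᵣ 1#            ≈⟨ +-congʳ (trans (+-assoc _ _ _) (trans (+-congˡ (+-comm _ _)) (sym (+-assoc _ _ _)))) ⟩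
    ((1# + m ×ᵣ 1#) - 1#) - n ×ᵣ 1#            ≈⟨ +-assoc _ _ _ ⟩
    (1# + m ×ᵣ 1#) + (- 1# - n ×ᵣ 1#)          ≈⟨ +-congˡ (⁻¹-∙-comm 1# (n ×ᵣ 1#)) ⟩
    (1# + m ×ᵣ 1#) - (1# + n ×ᵣ 1#)            ≈⟨ +-cong (1+× m 1#) (-‿cong (1+× n 1#)) ⟨
    suc m ×ᵣ 1# - suc n ×ᵣ 1#                  ∎

  fromℤ-+ : ∀ i j → fromℤ (i ℤ.+ j) ≈ fromℤ i + fromℤ j
  fromℤ-+ (ℤ.+ m) (ℤ.+ n) = ×-homo-+ 1# m n
  fromℤ-+ (ℤ.+ m) ℤ.-[1+ n ] = fromℤ-⊖ m (suc n)
  fromℤ-+ ℤ.-[1+ m ] (ℤ.+ n) = trans (fromℤ-⊖ n (suc m)) (+-comm _ _)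
  fromℤ-+ ℤ.-[1+ m ] ℤ.-[1+ n ] = begin
    - (suc (suc (m ℕ.+ n)) ×ᵣ 1#)       ≡⟨ ≡.cong (λ k → - (suc k ×ᵣ 1#)) (≡.sym (ℕ.+-suc m n)) ⟩
    - ((suc m ℕ.+ suc n) ×ᵣ 1#)         ≈⟨ -‿cong (×-homo-+ 1# (suc m) (suc n)) ⟩
    - (suc m ×ᵣ 1# + suc n ×ᵣ 1#)       ≈⟨ ⁻¹-∙-comm _ _ ⟨
    - (suc m ×ᵣ 1#) - suc n ×ᵣ 1#       ∎

  fromℤ-+◃ : ∀ n → fromℤ (Sign.+ ℤ.◃ n) ≈ n ×ᵣ 1#
  fromℤ-+◃ ℕ.zero  = refl
  fromℤ-+◃ (suc n) = refl

  fromℤ--◃ : ∀ n → fromℤ (Sign.- ℤ.◃ n) ≈ - (n ×ᵣ 1#)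
  fromℤ--◃ ℕ.zero  = sym -0#≈0#
  fromℤ--◃ (suc n) = refl

  fromℤ-* : ∀ i j → fromℤ (i ℤ.* j) ≈ fromℤ i * fromℤ j
  fromℤ-* (ℤ.+ m) (ℤ.+ n) = trans (fromℤ-+◃ (m ℕ.* n)) (×1-homo-* m n)
  fromℤ-* (ℤ.+ m) ℤ.-[1+ n ] = trans (fromℤ--◃ (m ℕ.* suc n))
    (trans (-‿cong (×1-homo-* m (suc n))) (-‿distribʳ-* _ _))
  fromℤ-* ℤ.-[1+ m ] (ℤ.+ n) = trans (fromℤ--◃ (suc m ℕ.* n))
    (trans (-‿cong (×1-homo-* (suc m) n)) (-‿distribˡ-* _ _))
  fromℤ-* ℤ.-[1+ m ] ℤ.-[1+ n ] = begin
    (suc m ℕ.* suc n) ×ᵣ 1#               ≈⟨ ×1-homo-* (suc m) (suc n) ⟩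
    suc m ×ᵣ 1# * suc n ×ᵣ 1#             ≈⟨ -‿involutive _ ⟨
    - - (suc m ×ᵣ 1# * suc n ×ᵣ 1#)       ≈⟨ -‿cong (-‿distribʳ-* _ _) ⟩
    - (suc m ×ᵣ 1# * - (suc n ×ᵣ 1#))     ≈⟨ -‿distribˡ-* _ _ ⟩
    - (suc m ×ᵣ 1#) * - (suc n ×ᵣ 1#)     ∎

  fromℤ-morphism : ℤ-rawRing -Raw-AlmostCommutative⟶ fromCommutativeRing commutativeRing
  fromℤ-morphism = record
    { ⟦_⟧ = fromℤ ; +-homo = fromℤ-+ ; *-homo = fromℤ-* ; -‿homo = fromℤ-neg
    ; 0-homo = refl ; 1-homo = refl }

  fromℤ-≟ : ∀ i j → Maybe (fromℤ i ≈ fromℤ j)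
  fromℤ-≟ i j with i ℤ.≟ j
  ... | yes i≡j = just (reflexive (≡.cong fromℤ i≡j))
  ... | no  _   = nothing

  open Algebra.Solver.Ring ℤ-rawRing (fromCommutativeRing commutativeRing)
    fromℤ-morphism fromℤ-≟ public
    using (solve; _:+_; _:*_; _:-_; :-_; _:=_; con)

-- Order, absolute value and finite sums in an ordered field.

module OrderedField (em : ExcludedMiddle 0ℓ) (R : CompleteOrderedField) where
  open CompleteOrderedField R
  open Algebra.Properties.Ring ring using (-0#≈0#; -‿distribˡ-*; -‿distribʳ-*)
  open RingSolver R using (solve; _:+_; _:*_; _:-_; :-_; _:=_; con)
  open IsTotalOrder isTotalOrder using (isPartialOrder)
    renaming (refl to ≤-refl; reflexive to ≤-reflexive; trans to ≤-trans; antisym to ≤-antisym;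
              ≤-respˡ-≈ to ≤-respˡ; ≤-respʳ-≈ to ≤-respʳ) public

  poset : Poset 0ℓ 0ℓ 0ℓ
  poset = record { isPartialOrder = isPartialOrder }

  module ≤-Reasoning = Relation.Binary.Reasoning.PartialOrder poset
  open ≤-Reasoning

  +-mono-≤ : ∀ {a b c d} → a ≤ b → c ≤ d → a + c ≤ b + d
  +-mono-≤ {a} {b} {c} {d} a≤b c≤d = begin
    a + c ≤⟨ +-monoʳ-≤ a c≤d ⟩
    a + d ≈⟨ +-comm a d ⟩
    d + a ≤⟨ +-monoʳ-≤ d a≤b ⟩
    d + b ≈⟨ +-comm d b ⟩
    b + d ∎

  +-monoˡ-≤ : ∀ z {x y} → x ≤ y → x + z ≤ y + z
  +-monoˡ-≤ z x≤y = +-mono-≤ x≤y ≤-refl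

  -- Reduces an inequality to a ring identity: once the nonnegative slack `p` is named, the solver
  -- does the rest. Many estimates below are put in this form.
  ≤-by : ∀ {a b p} → 0# ≤ p → a + p ≈ b → a ≤ b
  ≤-by {a} {b} {p} 0≤p eq = begin
    a      ≈⟨ +-identityʳ a ⟨
    a + 0# ≤⟨ +-monoʳ-≤ a 0≤p ⟩
    a + p  ≈⟨ eq ⟩
    b      ∎

  0≤b-a : ∀ {a b} → a ≤ b → 0# ≤ b - a
  0≤b-a {a} {b} a≤b = begin
    0#    ≈⟨ -‿inverseʳ a ⟨
    a - a ≤⟨ +-monoˡ-≤ (- a) a≤b ⟩
    b - a ∎

  -‿anti-≤ : ∀ {a b} → a ≤ b → - b ≤ - a
  -‿anti-≤ {a} {b} a≤b = ≤-by (0≤b-a a≤b) (solve 2 (λ a b → :- b :+ (b :- a) := :- a) refl a b)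

  0≤-x : ∀ {x} → x ≤ 0# → 0# ≤ - x
  0≤-x {x} x≤0 = ≤-respˡ -0#≈0# (-‿anti-≤ x≤0)

  +-nonneg : ∀ {a b} → 0# ≤ a → 0# ≤ b → 0# ≤ a + b
  +-nonneg {a} {b} 0≤a 0≤b = ≤-respˡ (+-identityˡ 0#) (+-mono-≤ 0≤a 0≤b)

  ≰⇒≥ : ∀ {a b} → ¬ a ≤ b → b ≤ a
  ≰⇒≥ {a} {b} a≰b with total a b
  ... | inj₁ a≤b = contradiction a≤b a≰b
  ... | inj₂ b≤a = b≤a

  ≰⇒> : ∀ {a b} → ¬ a ≤ b → b < a
  ≰⇒> a≰b = ≰⇒≥ a≰b , λ b≈a → a≰b (≤-reflexive (sym b≈a))

  <⇒≱ : ∀ {a b} → a < b → ¬ b ≤ a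
  <⇒≱ (a≤b , a≉b) b≤a = a≉b (≤-antisym a≤b b≤a)

  <-≤-trans : ∀ {a b c} → a < b → b ≤ c → a < c
  <-≤-trans a<b b≤c = ≤-trans (proj₁ a<b) b≤c , λ a≈c → <⇒≱ a<b (≤-trans b≤c (≤-reflexive (sym a≈c)))

  ≤-<-trans : ∀ {a b c} → a ≤ b → b < c → a < c
  ≤-<-trans a≤b b<c = ≤-trans a≤b (proj₁ b<c) , λ a≈c → <⇒≱ b<c (≤-trans (≤-reflexive (sym a≈c)) a≤b)

  <-respʳ : ∀ {a b c} → b ≈ c → a < b → a < c
  <-respʳ b≈c a<b = <-≤-trans a<b (≤-reflexive b≈c)

  0<b-a : ∀ {a b} → a < b → 0# < b - a
  0<b-a {a} {b} (a≤b , a≉b) = 0≤b-a a≤b , λ 0≈ → a≉b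
    (trans (sym (+-identityʳ a)) (trans (+-congˡ 0≈) (solve 2 (λ a b → a :+ (b :- a) := b) refl a b)))

  <-by : ∀ {a b p} → 0# < p → a + p ≈ b → a < b
  <-by {a} {b} {p} (0≤p , 0≉p) eq = ≤-by 0≤p eq , λ a≈b → 0≉p (begin-equality
    0#          ≈⟨ -‿inverseˡ a ⟨
    - a + a     ≈⟨ +-congˡ (trans a≈b (sym eq)) ⟩
    - a + (a + p) ≈⟨ solve 2 (λ a p → :- a :+ (a :+ p) := p) refl a p ⟩
    p ∎)

  *-mono-nonneg : ∀ {a b c} → 0# ≤ c → a ≤ b → c * a ≤ c * b
  *-mono-nonneg {a} {b} {c} 0≤c a≤b = ≤-by (*-nonneg 0≤c (0≤b-a a≤b))
    (solve 3 (λ a b c → c :* a :+ c :* (b :- a) := c :* b) refl a b c)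

  *-mono-nonnegʳ : ∀ {a b c} → 0# ≤ c → a ≤ b → a * c ≤ b * c
  *-mono-nonnegʳ 0≤c a≤b = ≤-respˡ (*-comm _ _) (≤-respʳ (*-comm _ _) (*-mono-nonneg 0≤c a≤b))

  *-cancel-0 : ∀ {x y} → ¬ x ≈ 0# → x * y ≈ 0# → y ≈ 0#
  *-cancel-0 {x} {y} x≉0 xy≈0 = begin-equality
    y                ≈⟨ *-identityʳ y ⟨
    y * 1#           ≈⟨ *-congˡ (inverseʳ x x≉0) ⟨
    y * (x * x ⁻¹)   ≈⟨ solve 3 (λ x y i → y :* (x :* i) := (x :* y) :* i) refl x y (x ⁻¹) ⟩
    (x * y) * x ⁻¹   ≈⟨ *-congʳ xy≈0 ⟩
    0# * x ⁻¹        ≈⟨ zeroˡ _ ⟩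
    0# ∎

  pos⇒≉0 : ∀ {x} → 0# < x → ¬ x ≈ 0#
  pos⇒≉0 (_ , 0≉x) x≈0 = 0≉x (sym x≈0)

  *-pos : ∀ {x y} → 0# < x → 0# < y → 0# < x * y
  *-pos 0<x 0<y = *-nonneg (proj₁ 0<x) (proj₁ 0<y) ,
    λ 0≈xy → proj₂ 0<y (sym (*-cancel-0 (pos⇒≉0 0<x) (sym 0≈xy)))

  +-pos : ∀ {x y} → 0# < x → 0# ≤ y → 0# < x + y
  +-pos {x} {y} 0<x 0≤y = <-≤-trans 0<x (≤-by 0≤y refl)

  square-nonneg : ∀ x → 0# ≤ x * x
  square-nonneg x with total 0# x
  ... | inj₁ 0≤x = *-nonneg 0≤x 0≤x
  ... | inj₂ x≤0 = ≤-respʳ (solve 1 (λ x → :- x :* :- x := x :* x) refl x) (*-nonneg (0≤-x x≤0) (0≤-x x≤0))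

  square≈0 : ∀ {x} → x * x ≈ 0# → x ≈ 0#
  square≈0 {x} xx≈0 with em {x ≈ 0#}
  ... | yes x≈0 = x≈0
  ... | no  x≉0 = *-cancel-0 x≉0 xx≈0

  0<1 : 0# < 1#
  0<1 = ≤-respʳ (*-identityˡ 1#) (square-nonneg 1#) , 0≉1

  ⁻¹-pos : ∀ {x} → 0# < x → 0# < x ⁻¹
  ⁻¹-pos {x} 0<x = ≰⇒> λ x⁻¹≤0 → <⇒≱ 0<1 (begin
    1#             ≈⟨ inverseʳ x (pos⇒≉0 0<x) ⟨
    x * x ⁻¹       ≤⟨ *-mono-nonneg (proj₁ 0<x) x⁻¹≤0 ⟩
    x * 0#         ≈⟨ zeroʳ x ⟩
    0# ∎)

  inverseˡ : ∀ {x} → 0# < x → x ⁻¹ * x ≈ 1#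
  inverseˡ 0<x = trans (*-comm _ _) (inverseʳ _ (pos⇒≉0 0<x))

  *-cancelʳ-≈ : ∀ {a b c} → 0# < c → a * c ≈ b * c → a ≈ b
  *-cancelʳ-≈ {a} {b} {c} 0<c eq = begin-equality
    a               ≈⟨ lem a ⟨
    (a * c) * c ⁻¹  ≈⟨ *-congʳ eq ⟩
    (b * c) * c ⁻¹  ≈⟨ lem b ⟩
    b ∎
    where
    lem : ∀ a → (a * c) * c ⁻¹ ≈ a
    lem a = trans (*-assoc _ _ _) (trans (*-congˡ (inverseʳ c (pos⇒≉0 0<c))) (*-identityʳ a))

  *-cancelʳ-≤ : ∀ {a b c} → 0# < c → a * c ≤ b * c → a ≤ b
  *-cancelʳ-≤ {a} {b} {c} 0<c le with total a b
  ... | inj₁ a≤b = a≤b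
  ... | inj₂ b≤a = ≤-reflexive (*-cancelʳ-≈ 0<c (≤-antisym le (*-mono-nonnegʳ (proj₁ 0<c) b≤a)))

  /-*-cancel : ∀ {x y} → 0# < y → x / y * y ≈ x
  /-*-cancel {x} {y} 0<y = trans (*-assoc _ _ _) (trans (*-congˡ (inverseˡ 0<y)) (*-identityʳ x))

  /-intro : ∀ {x y z} → 0# < y → x ≈ z * y → x / y ≈ z
  /-intro 0<y eq = *-cancelʳ-≈ 0<y (trans (/-*-cancel 0<y) eq)

  /-elim : ∀ {x y z} → 0# < y → x / y ≈ z → x ≈ z * y
  /-elim 0<y eq = trans (sym (/-*-cancel 0<y)) (*-congʳ eq)

  ≤-/ : ∀ {x y z} → 0# < y → z * y ≤ x → z ≤ x / y
  ≤-/ 0<y le = *-cancelʳ-≤ 0<y (≤-respʳ (sym (/-*-cancel 0<y)) le)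

  /-≤ : ∀ {x y z} → 0# < y → x ≤ z * y → x / y ≤ z
  /-≤ 0<y le = *-cancelʳ-≤ 0<y (≤-respˡ (sym (/-*-cancel 0<y)) le)

  0<2 : 0# < 1# + 1#
  0<2 = +-pos 0<1 (proj₁ 0<1)

  half : ℝ → ℝ
  half x = x / (1# + 1#)

  half+half : ∀ x → half x + half x ≈ x
  half+half x = trans (solve 1 (λ h → h :+ h := h :* (con ℤ.1ℤ :+ con ℤ.1ℤ)) refl (half x)) (/-*-cancel 0<2)

  half-pos : ∀ {x} → 0# < x → 0# < half x
  half-pos 0<x = *-pos 0<x (⁻¹-pos 0<2)

  ≤-or-> : ∀ a b → a ≤ b ⊎ b < a
  ≤-or-> a b with em {a ≤ b}
  ... | yes a≤b = inj₁ a≤b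
  ... | no  a≰b = inj₂ (≰⇒> a≰b)

  ≤-+ϵ : ∀ {a b} → (∀ ϵ → 0# < ϵ → a ≤ b + ϵ) → a ≤ b
  ≤-+ϵ {a} {b} h with ≤-or-> a b
  ... | inj₁ a≤b = a≤b
  ... | inj₂ b<a = contradiction (h d 0<d) (<⇒≱ (<-by 0<d (begin-equality
      (b + d) + d  ≈⟨ +-assoc b d d ⟩
      b + (d + d)  ≈⟨ +-congˡ (half+half (a - b)) ⟩
      b + (a - b)  ≈⟨ solve 2 (λ a b → b :+ (a :- b) := a) refl a b ⟩
      a            ∎)))
    where
    d = half (a - b)
    0<d = half-pos (0<b-a b<a)

  min₂ : ∀ a b → ∃ λ m → m ≤ a × m ≤ b × (0# < a → 0# < b → 0# < m)
  min₂ a b with total a b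
  ... | inj₁ a≤b = a , ≤-refl , a≤b , λ p _ → p
  ... | inj₂ b≤a = b , b≤a , ≤-refl , λ _ q → q

  max₂ : ∀ a b → ∃ λ m → a ≤ m × b ≤ m
  max₂ a b with total a b
  ... | inj₁ a≤b = b , a≤b , ≤-refl
  ... | inj₂ b≤a = a , ≤-refl , b≤a

  x≤abs : ∀ x → x ≤ abs x
  x≤abs x with total 0# x
  ... | inj₁ _   = ≤-refl
  ... | inj₂ x≤0 = ≤-trans x≤0 (0≤-x x≤0)

  -x≤abs : ∀ x → - x ≤ abs x
  -x≤abs x with total 0# x
  ... | inj₁ 0≤x = ≤-trans (≤-respʳ -0#≈0# (-‿anti-≤ 0≤x)) 0≤x
  ... | inj₂ _   = ≤-refl

  abs≤ : ∀ {x y} → x ≤ y → - x ≤ y → abs x ≤ y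
  abs≤ {x} x≤y -x≤y with total 0# x
  ... | inj₁ _ = x≤y
  ... | inj₂ _ = -x≤y

  abs-nonneg : ∀ x → 0# ≤ abs x
  abs-nonneg x with total 0# x
  ... | inj₁ 0≤x = 0≤x
  ... | inj₂ x≤0 = 0≤-x x≤0

  abs≤⇒≤ : ∀ {x y e} → abs (x - y) ≤ e → x ≤ y + e
  abs≤⇒≤ {x} {y} h = ≤-respˡ (solve 2 (λ x y → y :+ (x :- y) := x) refl x y)
    (+-monoʳ-≤ y (≤-trans (x≤abs _) h))

  abs≤⇒≥ : ∀ {x y e} → abs (x - y) ≤ e → y ≤ x + e
  abs≤⇒≥ {x} {y} h = ≤-respˡ (solve 2 (λ x y → x :- (x :- y) := y) refl x y)
    (+-monoʳ-≤ x (≤-trans (-x≤abs _) h))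

  ≤⇒abs≤ : ∀ {x y e} → x ≤ y + e → y ≤ x + e → abs (x - y) ≤ e
  ≤⇒abs≤ {x} {y} {e} h k = abs≤
    (≤-by (0≤b-a h) (solve 3 (λ x y e → x :- y :+ (y :+ e :- x) := e) refl x y e))
    (≤-by (0≤b-a k) (solve 3 (λ x y e → :- (x :- y) :+ (x :+ e :- y) := e) refl x y e))

  abs-of-nonneg : ∀ {x} → 0# ≤ x → abs x ≤ x
  abs-of-nonneg {x} 0≤x = abs≤ ≤-refl (≤-trans (≤-respʳ -0#≈0# (-‿anti-≤ 0≤x)) 0≤x)

  *≤abs* : ∀ x {y e} → y ≤ e → - y ≤ e → x * y ≤ abs x * e
  *≤abs* x {y} y≤e -y≤e with total 0# x
  ... | inj₁ 0≤x = *-mono-nonneg 0≤x y≤e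
  ... | inj₂ x≤0 = ≤-respˡ (solve 2 (λ x y → :- x :* :- y := x :* y) refl x y) (*-mono-nonneg (0≤-x x≤0) -y≤e)

  open Algebra.Properties.Semiring.Sum semiring public
    using (sum; sum-cong-≋; ∑-distrib-+; ∑-comm; *-distribˡ-sum; *-distribʳ-sum; sum-replicate-zero)

  if-elim : ∀ {P : Set} (Q : ℝ → Set) (d : Dec P) {x y : ℝ} →
            (P → Q x) → (¬ P → Q y) → Q (if does d then x else y)
  if-elim Q (yes p) f g = f p
  if-elim Q (no ¬p) f g = g ¬p

  if-≈ : ∀ {P : Set} (d : Dec P) {x y z : ℝ} →
         (P → x ≈ z) → (¬ P → y ≈ z) → (if does d then x else y) ≈ z
  if-≈ d = if-elim (_≈ _) d

  if-congᵈ : ∀ {P : Set} (d : Dec P) {x x′ y : ℝ} → (P → x ≈ x′) →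
             (if does d then x else y) ≈ (if does d then x′ else y)
  if-congᵈ (yes p) h = h p
  if-congᵈ (no _)  h = refl

  if-const : ∀ (b : Bool) {x : ℝ} → (if b then x else x) ≈ x
  if-const true  = refl
  if-const false = refl

  if-yes : ∀ {P : Set} (d : Dec P) {x y : ℝ} → P → (if does d then x else y) ≈ x
  if-yes (yes _) p = refl
  if-yes (no ¬p) p = contradiction p ¬p

  if-no : ∀ {P : Set} (d : Dec P) {x y : ℝ} → ¬ P → (if does d then x else y) ≈ y
  if-no (yes p) ¬p = contradiction p ¬p
  if-no (no _)  ¬p = refl

  if-cong : ∀ (b : Bool) {x x′ y y′ : ℝ} → x ≈ x′ → y ≈ y′ →
            (if b then x else y) ≈ (if b then x′ else y′)
  if-cong true  p q = p
  if-cong false p q = q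

  if-*ˡ : ∀ (b : Bool) x y → x * (if b then y else 0#) ≈ (if b then x * y else 0#)
  if-*ˡ true  x y = refl
  if-*ˡ false x y = zeroʳ x

  if-*ʳ : ∀ (b : Bool) x y → (if b then y else 0#) * x ≈ (if b then y * x else 0#)
  if-*ʳ true  x y = refl
  if-*ʳ false x y = zeroˡ x

  if-+ : ∀ (b : Bool) x y →
         (if b then x + y else 0#) ≈ (if b then x else 0#) + (if b then y else 0#)
  if-+ true  x y = refl
  if-+ false x y = sym (+-identityˡ 0#)

  if-sum : ∀ (b : Bool) {n} (f : Fin n → ℝ) →
           (if b then sum f else 0#) ≈ sum (λ i → if b then f i else 0#)
  if-sum true  f = refl
  if-sum false {n} f = sym (sum-replicate-zero n)

  sum-0 : ∀ {n} {f : Fin n → ℝ} → (∀ i → f i ≈ 0#) → sum f ≈ 0#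
  sum-0 {n} f≈0 = trans (sum-cong-≋ f≈0) (sum-replicate-zero n)

  sum-mono : ∀ {n} {f g : Fin n → ℝ} → (∀ i → f i ≤ g i) → sum f ≤ sum g
  sum-mono {ℕ.zero} f≤g = ≤-refl
  sum-mono {suc n}  f≤g = +-mono-≤ (f≤g zero) (sum-mono (λ i → f≤g (suc i)))

  sum-nonneg : ∀ {n} {f : Fin n → ℝ} → (∀ i → 0# ≤ f i) → 0# ≤ sum f
  sum-nonneg {n} 0≤f = ≤-respˡ (sum-0 {n} (λ _ → refl)) (sum-mono 0≤f)

  sum-neg : ∀ {n} (f : Fin n → ℝ) → sum (λ i → - f i) ≈ - sum f
  sum-neg {ℕ.zero} f = sym -0#≈0#
  sum-neg {suc n}  f = trans (+-congˡ (sum-neg (λ i → f (suc i))))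
    (solve 2 (λ a b → :- a :- b := :- (a :+ b)) refl (f zero) (sum (λ i → f (suc i))))

  sum-sub : ∀ {n} (f g : Fin n → ℝ) → sum (λ i → f i - g i) ≈ sum f - sum g
  sum-sub f g = trans (∑-distrib-+ f (λ i → - g i)) (+-congˡ (sum-neg g))

  term≤sum : ∀ {n} {f : Fin n → ℝ} → (∀ i → 0# ≤ f i) → ∀ i → f i ≤ sum f
  term≤sum {suc n} 0≤f zero    = ≤-by (sum-nonneg (λ i → 0≤f (suc i))) refl
  term≤sum {suc n} 0≤f (suc i) = ≤-trans (term≤sum (λ j → 0≤f (suc j)) i)
    (≤-by (0≤f zero) (+-comm _ _))

  sum≤0⇒≈0 : ∀ {n} {f : Fin n → ℝ} → (∀ i → 0# ≤ f i) → sum f ≤ 0# → ∀ i → f i ≈ 0#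
  sum≤0⇒≈0 0≤f s≤0 i = ≤-antisym (≤-trans (term≤sum 0≤f i) s≤0) (0≤f i)

  sum-single : ∀ {n} {f : Fin n → ℝ} k → (∀ i → ¬ i ≡ k → f i ≈ 0#) → sum f ≈ f k
  sum-single {suc n} zero    h = trans (+-congˡ (sum-0 (λ i → h (suc i) (λ ())))) (+-identityʳ _)
  sum-single {suc n} (suc k) h = trans (+-cong (h zero (λ ()))
    (sum-single k (λ i i≢k → h (suc i) (i≢k ∘ suc-injective)))) (+-identityˡ _)

  sum-pair : ∀ {n} {f : Fin n → ℝ} k l → ¬ k ≡ l → (∀ i → ¬ i ≡ k → ¬ i ≡ l → f i ≈ 0#) → sum f ≈ f k + f l
  sum-pair {suc n} zero    zero    k≢l h = contradiction ≡.refl k≢l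
  sum-pair {suc n} zero    (suc l) k≢l h = +-congˡ (sum-single l (λ i i≢l → h (suc i) (λ ()) (i≢l ∘ suc-injective)))
  sum-pair {suc n} (suc k) zero    k≢l h = trans (+-comm _ _)
    (+-congʳ (sum-single k (λ i i≢k → h (suc i) (i≢k ∘ suc-injective) (λ ()))))
  sum-pair {suc n} (suc k) (suc l) k≢l h = trans (+-cong (h zero (λ ()) (λ ()))
    (sum-pair k l (λ k≡l → k≢l (≡.cong suc k≡l))
      (λ i i≢k i≢l → h (suc i) (i≢k ∘ suc-injective) (i≢l ∘ suc-injective)))) (+-identityˡ _)

  sum-if-≟ : ∀ {n} (f : Fin n → ℝ) k → sum (λ i → if does (i ≟ k) then f i else 0#) ≈ f k
  sum-if-≟ f k = trans (sum-single k (λ i i≢k → if-no (i ≟ k) i≢k)) (if-yes (k ≟ k) ≡.refl)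

-- Walks, loop erasure and bridges.

module Walks (T : Graph) where
  open Graph T
  open DecMembership (_≟_ {n = order}) using () renaming (_∈?_ to _∈ₗ?_)

  AllEdges : (Edge → Set) → ∀ {x y} → Walk x y → Set
  AllEdges P ε             = Unit.⊤
  AllEdges P ((e , _) ◅ p) = P e × AllEdges P p

  SimpleWalk : (Edge → Set) → Vertex → Vertex → Set
  SimpleWalk P x y = ∃ λ (p : Walk x y) → Unique (vertices p) × AllEdges P p

  joins-swap : ∀ {e x y} → Joins e x y → Joins e y x
  joins-swap (inj₁ eq) = inj₂ eq
  joins-swap (inj₂ eq) = inj₁ eq

  joins-ends : ∀ e → Joins e (proj₁ (ends e)) (proj₂ (ends e))
  joins-ends e = inj₁ ≡.refl

  suffix : ∀ {P x y z} (p : Walk y z) → Unique (vertices p) → AllEdges P p →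
           x List.∈ vertices p → SimpleWalk P x z
  suffix ε         u       a        (here ≡.refl) = ε , u , a
  suffix (s ◅ p)   u       a        (here ≡.refl) = s ◅ p , u , a
  suffix (s ◅ p)   (_ ∷ u) (_ , a)  (there x∈p)   = suffix p u a x∈p

  -- If the new first vertex already lies on the erased tail, the walk is cut there. Erasure is
  -- needed because `acyclic` speaks only of walks without repeated vertices; the property `P` must
  -- survive it.
  loop-erase : ∀ {P x y} (p : Walk x y) → AllEdges P p → SimpleWalk P x y
  loop-erase ε a = ε , [] ∷ [] , a
  loop-erase {x = x} (s ◅ p) (Ps , a) with loop-erase p a
  ... | q , u , b with x ∈ₗ? vertices q
  ...   | yes x∈q = suffix q u b x∈q
  ...   | no  x∉q = s ◅ q , ¬Any⇒All¬ (vertices q) x∉q ∷ u , Ps , b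

  module _ (isTree : IsTree T) where
    open IsTree isTree

    -- A simple walk that avoids `e` is empty, a single edge, or longer. These cases would make `e`
    -- a loop, give it a parallel edge, or close up with it to a cycle.
    bridge : ∀ {e x y} → Joins e x y → (p : Walk x y) → ¬ AllEdges (_≢ e) p
    bridge {e} j p a with loop-erase p a
    ... | ε , _ = loopless e _ j
    ... | (f , k) ◅ ε , _ , f≢e , _ = f≢e (simple f e _ _ k j)
    ... | q@(_ ◅ _ ◅ _) , u , _ = acyclic q u (s≤s (s≤s z≤n)) (e , joins-swap j)

    -- The walk from `x` to an end of `e` starts with an edge at `x`; if it is empty, `e` itself
    -- will do. Hence no vertex is isolated.
    incident-edge : Edge → ∀ x → ∃ λ e → x ≡ proj₁ (ends e) ⊎ x ≡ proj₂ (ends e)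
    incident-edge e x with connected x (proj₁ (ends e))
    ... | ε = e , inj₁ ≡.refl
    ... | (f , inj₁ eq) ◅ _ = f , inj₁ (≡.sym (≡.cong proj₁ eq))
    ... | (f , inj₂ eq) ◅ _ = f , inj₂ (≡.sym (≡.cong proj₂ eq))

  -- At a vertex off the edge the value is a default; the sums below evaluate it at incident edges
  -- only.
  other : Vertex → Edge → Vertex
  other x e with x ≟ proj₁ (ends e)
  ... | yes _ = proj₂ (ends e)
  ... | no  _ = proj₁ (ends e)

  Incident : Vertex → Edge → Set
  Incident x e = x ≡ proj₁ (ends e) ⊎ x ≡ proj₂ (ends e)

  joins-other : ∀ {x e} → Incident x e → Joins e x (other x e)
  joins-other {x} {e} i with x ≟ proj₁ (ends e) | i
  ... | yes ≡.refl | _           = inj₁ ≡.refl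
  ... | no  x≢     | inj₁ x≡     = contradiction x≡ x≢
  ... | no  _      | inj₂ ≡.refl = inj₂ ≡.refl

  joins⇒incident : ∀ {e x y} → Joins e x y → Incident x e
  joins⇒incident (inj₁ eq) = inj₁ (≡.sym (≡.cong proj₁ eq))
  joins⇒incident (inj₂ eq) = inj₂ (≡.sym (≡.cong proj₂ eq))

  joins-unique : ∀ {e x y z} → Joins e x y → Joins e x z → y ≡ z
  joins-unique (inj₁ p) (inj₁ q) = ≡.cong proj₂ (≡.trans (≡.sym p) q)
  joins-unique (inj₂ p) (inj₂ q) = ≡.cong proj₁ (≡.trans (≡.sym p) q)
  joins-unique {e} {x} (inj₁ p) (inj₂ q) with ≡.trans (≡.sym p) q
  ... | ≡.refl = contradiction (inj₁ p) (loopless e x)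
  joins-unique {e} {x} (inj₂ p) (inj₁ q) with ≡.trans (≡.sym p) q
  ... | ≡.refl = contradiction (inj₁ q) (loopless e x)

  joins⇔other : ∀ {x e y} → Joins e x y → y ≡ other x e
  joins⇔other {x} {e} j = joins-unique j (joins-other (joins⇒incident {e} j))

-- The path metric of a weighted tree and the optimal potential of an edge.

module TreeMetric (em : ExcludedMiddle 0ℓ) (R : CompleteOrderedField) (T : Graph) (isTree : IsTree T) where
  open RicciFlow em R T hiding (sum)
  open OrderedField em R
  open RingSolver R using (solve; _:+_; _:*_; _:-_; :-_; _:=_; con)
  open ≤-Reasoning
  open Walks T

  walkLength-nonneg : ∀ {w} → IsPositive w → ∀ {x y} (p : Walk x y) → 0# ≤ walkLength w p
  walkLength-nonneg w>0 ε             = ≤-refl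
  walkLength-nonneg w>0 ((e , _) ◅ p) = +-nonneg (proj₁ (w>0 e)) (walkLength-nonneg w>0 p)

  avoids-or-long : ∀ {w} → IsPositive w → ∀ e {x y} (p : Walk x y) →
                   AllEdges (_≢ e) p ⊎ w e ≤ walkLength w p
  avoids-or-long w>0 e ε = inj₁ Unit.tt
  avoids-or-long w>0 e ((f , _) ◅ p) with f ≟ e
  ... | yes ≡.refl = inj₂ (≤-by (walkLength-nonneg w>0 p) refl)
  ... | no  f≢e with avoids-or-long w>0 e p
  ...   | inj₁ a = inj₁ (f≢e , a)
  ...   | inj₂ l = inj₂ (≤-trans l (≤-by (proj₁ (w>0 f)) (+-comm _ _)))

  -- Every walk between the ends of a bridge crosses it. So an edge realises the distance of its
  -- ends, whatever the positive weights are.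
  edge≤walk : ∀ {w} → IsPositive w → ∀ {e x y} → Joins e x y → (p : Walk x y) → w e ≤ walkLength w p
  edge≤walk w>0 {e} j p with avoids-or-long w>0 e p
  ... | inj₁ a = contradiction a (bridge isTree {e} j p)
  ... | inj₂ l = l

  module PathMetric {w : Metric} (w>0 : IsPositive w)
                    {d : Vertex → Vertex → ℝ} (isDist : IsPathMetric w d) where

    d≤walk : ∀ {x y} (p : Walk x y) → d x y ≤ walkLength w p
    d≤walk {x} {y} p = proj₁ (isDist x y) _ (p , refl)

    d-glb : ∀ {x y l} → (∀ (p : Walk x y) → l ≤ walkLength w p) → l ≤ d x y
    d-glb {x} {y} {l} h = proj₂ (isDist x y) l λ { _ (p , eq) → ≤-respʳ eq (h p) }

    d-nonneg : ∀ x y → 0# ≤ d x y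
    d-nonneg x y = d-glb (walkLength-nonneg w>0)

    d-self : ∀ x → d x x ≈ 0#
    d-self x = ≤-antisym (d≤walk ε) (d-nonneg x x)

    d-edge : ∀ {e x y} → Joins e x y → d x y ≈ w e
    d-edge {e} j = ≤-antisym
      (≤-respʳ (+-identityʳ _) (d≤walk ((e , j) ◅ ε)))
      (d-glb (edge≤walk w>0 {e} j))

    walkLength-◅◅ : ∀ {x y z} (p : Walk x y) (q : Walk y z) →
                    walkLength w (p ◅◅ q) ≈ walkLength w p + walkLength w q
    walkLength-◅◅ ε q = sym (+-identityˡ _)
    walkLength-◅◅ ((e , _) ◅ p) q = trans (+-congˡ (walkLength-◅◅ p q)) (sym (+-assoc _ _ _))

    d-step : ∀ {e u v} x → Joins e u v → d x v ≤ d x u + w e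
    d-step {e} {u} {v} x j = ≤-respˡ (solve 2 (λ a b → a :- b :+ b := a) refl (d x v) (w e))
      (+-monoˡ-≤ (w e) (d-glb λ p → ≤-by
        (0≤b-a (≤-respʳ (trans (walkLength-◅◅ p ((e , j) ◅ ε)) (+-congˡ (+-identityʳ _)))
          (d≤walk (p ◅◅ ((e , j) ◅ ε)))))
        (solve 3 (λ a b l → a :- b :+ (l :+ b :- a) := l) refl (d x v) (w e) (walkLength w p))))

    d-two-edges : ∀ {e f x y z} → Joins e x y → Joins f y z → d x z ≤ w e + w f
    d-two-edges {e} {f} j k = ≤-respʳ (+-congˡ (+-identityʳ _)) (d≤walk ((e , j) ◅ (f , k) ◅ ε))

    -- Bounds on single edges add up along a walk, and `d` is the infimum of the walk lengths.
    lipschitz : ∀ (φ : Vertex → ℝ) →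
                (∀ {e u v} → Joins e u v → φ u ≤ φ v + w e) → ∀ u v → φ u ≤ φ v + d u v
    lipschitz φ φ-edge u v = ≤-by (0≤b-a (d-glb bound))
      (solve 3 (λ a b l → a :+ (l :- (a :- b)) := b :+ l) refl (φ u) (φ v) (d u v))
      where
      along : ∀ {u v} (p : Walk u v) → φ u ≤ φ v + walkLength w p
      along ε = ≤-reflexive (sym (+-identityʳ _))
      along {u} {v} (_◅_ {j = m} (e , j) p) = begin
        φ u                             ≤⟨ φ-edge {e} j ⟩
        φ m + w e                       ≤⟨ +-monoˡ-≤ (w e) (along p) ⟩
        (φ v + walkLength w p) + w e    ≈⟨ solve 3 (λ a b c → (a :+ b) :+ c := a :+ (c :+ b)) refl _ _ _ ⟩
        φ v + (w e + walkLength w p)    ∎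
      bound : ∀ (p : Walk u v) → φ u - φ v ≤ walkLength w p
      bound p = ≤-by (0≤b-a (along p)) (solve 3 (λ a b l → a :- b :+ (b :+ l :- a) := l) refl (φ u) (φ v) (walkLength w p))

    -- The Kantorovich potential of the edge e: the two sides of e are pulled
    -- apart as far as 1-Lipschitz functions permit.
    module Potential (e : Edge) where
      x y : Vertex
      x = proj₁ (ends e)
      y = proj₂ (ends e)

      -- The component of `x` after deletion of `e`.
      OnSide : Vertex → Set
      OnSide v = ∃ λ (p : Walk v x) → AllEdges (_≢ e) p

      -- On the side of `x` the number `w e + d x v` is the distance from `y` to `v`, so `φ` is the
      -- signed distance from `y`, positive towards `x`.
      φ : Vertex → ℝ
      φ v = if does (em {OnSide v}) then w e + d x v else - d y v

      φ-on : ∀ {v} → OnSide v → φ v ≈ w e + d x v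
      φ-on = if-yes em

      φ-off : ∀ {v} → ¬ OnSide v → φ v ≈ - d y v
      φ-off = if-no em

      x-on : OnSide x
      x-on = ε , Unit.tt

      y-off : ¬ OnSide y
      y-off (p , a) = bridge isTree {e} (joins-swap {e} (joins-ends e)) p a

      cross : ∀ {f u v} → f ≢ e → Joins f u v → OnSide v → OnSide u
      cross {f} f≢e j (p , a) = (f , j) ◅ p , f≢e , a

      φx : φ x ≈ w e
      φx = trans (φ-on x-on) (trans (+-congˡ (d-self x)) (+-identityʳ _))

      φy : φ y ≈ 0#
      φy = trans (φ-off y-off) (trans (-‿cong (d-self y)) (solve 0 (:- con ℤ.0ℤ := con ℤ.0ℤ) refl))

      -- An edge other than `e` stays on one side, where `φ` is a distance up to sign and a
      -- constant. Only `e` changes sides, and there `φ` drops from `w e` to 0.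
      φ-edge : ∀ {f u v} → Joins f u v → φ u ≤ φ v + w f
      φ-edge {f} {u} {v} j with f ≟ e
      φ-edge (inj₁ ≡.refl) | yes ≡.refl = ≤-reflexive (trans φx (sym (trans (+-congʳ φy) (+-identityˡ _))))
      φ-edge (inj₂ ≡.refl) | yes ≡.refl = ≤-trans (≤-reflexive φy) (+-nonneg (≤-respʳ (sym φx) (proj₁ (w>0 e))) (proj₁ (w>0 e)))
      φ-edge {f} {u} {v} j | no f≢e with em {OnSide v}
      ... | yes on = begin
        φ u                    ≈⟨ φ-on (cross {f} f≢e j on) ⟩
        w e + d x u            ≤⟨ +-monoʳ-≤ (w e) (d-step {f} x (joins-swap {f} j)) ⟩
        w e + (d x v + w f)    ≈⟨ +-assoc _ _ _ ⟨
        w e + d x v + w f      ∎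
      ... | no off = begin
        φ u                    ≈⟨ φ-off (off ∘ cross {f} f≢e (joins-swap {f} j)) ⟩
        - d y u                ≤⟨ ≤-by (0≤b-a (d-step {f} y j)) (solve 3 (λ a b c → :- a :+ (a :+ c :- b) := :- b :+ c) refl (d y u) (d y v) (w f)) ⟩
        - d y v + w f          ∎

      φ-lipschitz : ∀ u v → φ u ≤ φ v + d u v
      φ-lipschitz = lipschitz φ (λ {f} → φ-edge {f})

      φ-near-x : ∀ {f z} → f ≢ e → Joins f x z → φ z ≈ w e + w f
      φ-near-x {f} f≢e j = trans (φ-on (cross {f} f≢e (joins-swap {f} j) x-on)) (+-congˡ (d-edge {f} j))

      φ-near-y : ∀ {f z} → f ≢ e → Joins f y z → φ z ≈ - w f
      φ-near-y {f} f≢e j = trans (φ-off (y-off ∘ cross {f} f≢e j)) (-‿cong (d-edge {f} j))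

      -- Mass sent from a neighbour of x to y, or from x to a neighbour of y,
      -- travels along φ without loss.
      tight-to-y : ∀ {f z} → Joins f x z → d z y ≤ φ z - φ y
      tight-to-y {f} {z} j with f ≟ e
      ... | yes ≡.refl with joins-unique {f} j (joins-ends f)
      ...   | ≡.refl = ≤-trans (≤-reflexive (d-self y)) (0≤b-a ≤-refl)
      tight-to-y {f} {z} j | no f≢e = begin
        d z y          ≤⟨ d-two-edges {f} {e} (joins-swap {f} j) (joins-ends e) ⟩
        w f + w e      ≈⟨ solve 2 (λ a b → a :+ b := b :+ a :- con ℤ.0ℤ) refl (w f) (w e) ⟩
        w e + w f - 0# ≈⟨ +-cong (φ-near-x {f} f≢e j) (-‿cong φy) ⟨
        φ z - φ y      ∎

      tight-from-x : ∀ {f z} → Joins f y z → d x z ≤ φ x - φ z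
      tight-from-x {f} {z} j with f ≟ e
      ... | yes ≡.refl with joins-unique {f} j (joins-swap {f} (joins-ends f))
      ...   | ≡.refl = ≤-trans (≤-reflexive (d-self x)) (0≤b-a ≤-refl)
      tight-from-x {f} {z} j | no f≢e = begin
        d x z          ≤⟨ d-two-edges {e} {f} (joins-ends e) j ⟩
        w e + w f      ≈⟨ solve 2 (λ a b → a :+ b := a :- :- b) refl (w e) (w f) ⟩
        w e - - w f    ≈⟨ +-cong φx (-‿cong (φ-near-y {f} f≢e j)) ⟨
        φ x - φ z      ∎

      tight-xy : d x y ≤ φ x - φ y
      tight-xy = ≤-reflexive (trans (d-edge {e} (joins-ends e))
        (sym (trans (+-cong φx (-‿cong φy)) (solve 1 (λ a → a :- con ℤ.0ℤ := a) refl (w e)))))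

-- The measures at a vertex and integration against them.

module NeighbourMeasure (em : ExcludedMiddle 0ℓ) (R : CompleteOrderedField) (T : Graph) (isTree : IsTree T) where
  open RicciFlow em R T hiding (sum)
  open OrderedField em R
  open RingSolver R using (solve; _:+_; _:*_; _:-_; :-_; _:=_; con)
  open ≤-Reasoning
  open Walks T

  fromℕ2 : fromℕ 2 ≈ 1# + 1#
  fromℕ2 = +-congˡ (+-identityʳ 1#)

  ∣tabulate∣ : ∀ {n} (f : Fin n → Bool) → fromℕ ∣ tabulate f ∣ ≈ sum (λ i → if f i then 1# else 0#)
  ∣tabulate∣ {ℕ.zero} f = refl
  ∣tabulate∣ {suc n}  f with f zero
  ... | true  = +-congˡ (∣tabulate∣ (λ i → f (suc i)))
  ... | false = trans (∣tabulate∣ (λ i → f (suc i))) (sym (+-identityˡ _))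

  Σ⋆ : Vertex → (Edge → ℝ) → ℝ
  Σ⋆ x f = sum (λ e → if does (incident? x e) then f e else 0#)

  Σ⋆-const : ∀ x c → Σ⋆ x (λ _ → c) ≈ fromℕ (degree x) * c
  Σ⋆-const x c = begin-equality
    Σ⋆ x (λ _ → c)                 ≈⟨ sum-cong-≋ (λ e → sym (trans (if-*ʳ (does (incident? x e)) c 1#) (if-cong (does (incident? x e)) (*-identityˡ c) refl))) ⟩
    sum (λ e → (if does (incident? x e) then 1# else 0#) * c) ≈⟨ *-distribʳ-sum c (λ e → if does (incident? x e) then 1# else 0#) ⟨
    Σ⋆ x (λ _ → 1#) * c            ≈⟨ *-congʳ (∣tabulate∣ (λ e → does (incident? x e))) ⟨
    fromℕ (degree x) * c           ∎

  Σ⋆-*ˡ : ∀ x c f → Σ⋆ x (λ e → c * f e) ≈ c * Σ⋆ x f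
  Σ⋆-*ˡ x c f = trans (sum-cong-≋ (λ e → sym (if-*ˡ (does (incident? x e)) c (f e))))
    (sym (*-distribˡ-sum c (λ e → if does (incident? x e) then f e else 0#)))

  Σ⋆-cong : ∀ x {f g} → (∀ e → Incident x e → f e ≈ g e) → Σ⋆ x f ≈ Σ⋆ x g
  Σ⋆-cong x {f} {g} f≈g = sum-cong-≋ (λ e → if-congᵈ (incident? x e) (f≈g e))

  Σ⋆-+ : ∀ x f g → Σ⋆ x (λ e → f e + g e) ≈ Σ⋆ x f + Σ⋆ x g
  Σ⋆-+ x f g = trans (sum-cong-≋ (λ e → if-+ (does (incident? x e)) (f e) (g e)))
    (∑-distrib-+ (λ e → if does (incident? x e) then f e else 0#) (λ e → if does (incident? x e) then g e else 0#))

  Σ⋆-single : ∀ {x e} → Incident x e → ∀ (c : Edge → ℝ) →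
              Σ⋆ x (λ f → if does (f ≟ e) then c f else 0#) ≈ c e
  Σ⋆-single {x} {e} i c = begin-equality
    Σ⋆ x (λ f → if does (f ≟ e) then c f else 0#)
      ≈⟨ sum-single e (λ f f≢e → trans (if-congᵈ (incident? x f) (λ _ → if-no (f ≟ e) f≢e)) (if-const (does (incident? x f)))) ⟩
    (if does (incident? x e) then (if does (e ≟ e) then c e else 0#) else 0#)
      ≈⟨ trans (if-yes (incident? x e) i) (if-yes (e ≟ e) ≡.refl) ⟩
    c e ∎

  θ : Metric → Vertex → Edge → ℝ
  θ w x e = w e ⁻¹ / D w x

  module _ {w : Metric} (w>0 : IsPositive w) where

    weight-pos : ∀ e → 0# < w e ⁻¹
    weight-pos e = ⁻¹-pos (w>0 e)

    weight≤D : ∀ {x e} → Incident x e → w e ⁻¹ ≤ D w x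
    weight≤D {x} {e} i = ≤-respˡ (if-yes (incident? x e) i) (term≤sum (λ f →
      if-elim (0# ≤_) (incident? x f) (λ _ → proj₁ (weight-pos f)) (λ _ → ≤-refl)) e)

    D-pos : ∀ {x e} → Incident x e → 0# < D w x
    D-pos {x} {e} i = <-≤-trans (weight-pos e) (weight≤D {x} {e} i)

    θ-nonneg : ∀ {x e} → Incident x e → 0# ≤ θ w x e
    θ-nonneg {x} {e} i = proj₁ (*-pos (weight-pos e) (⁻¹-pos (D-pos {x} {e} i)))

    -- The product does not depend on `e`. For this reason all edges at `x` contribute equally to a
    -- mean distance, and only the degree of `x` survives in the curvature.
    θ*w : ∀ x e → θ w x e * w e ≈ D w x ⁻¹
    θ*w x e = begin-equality
      (w e ⁻¹ * D w x ⁻¹) * w e ≈⟨ solve 3 (λ a b c → (a :* b) :* c := b :* (a :* c)) refl _ _ _ ⟩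
      D w x ⁻¹ * (w e ⁻¹ * w e) ≈⟨ *-congˡ (inverseˡ (w>0 e)) ⟩
      D w x ⁻¹ * 1#             ≈⟨ *-identityʳ _ ⟩
      D w x ⁻¹                  ∎

    Σθ : ∀ {x e} → Incident x e → Σ⋆ x (θ w x) ≈ 1#
    Σθ {x} {e} i = begin-equality
      Σ⋆ x (θ w x)                            ≈⟨ Σ⋆-cong x (λ f _ → *-comm (w f ⁻¹) (D w x ⁻¹)) ⟩
      Σ⋆ x (λ f → D w x ⁻¹ * w f ⁻¹)        ≈⟨ Σ⋆-*ˡ x (D w x ⁻¹) (λ f → w f ⁻¹) ⟩
      D w x ⁻¹ * D w x                      ≈⟨ inverseˡ (D-pos {x} {e} i) ⟩
      1#                                    ∎

    ∫ : Vertex → ℝ → (Vertex → ℝ) → ℝ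
    ∫ x α F = sum (λ z → measure w α x z * F z)

    -- After the sums over vertices and edges are exchanged, an edge at `x` meets exactly one vertex
    -- `z` with a nonzero term, its far end.
    ∫-formula : ∀ x α F → ∫ x α F ≈ α * F x + (1# - α) * Σ⋆ x (λ e → θ w x e * F (other x e))
    ∫-formula x α F = begin-equality
      sum (λ z → measure w α x z * F z)
        ≈⟨ sum-cong-≋ (λ z → trans (distribʳ (F z) _ _) (+-cong (if-*ʳ (does (z ≟ x)) (F z) α)
             (trans (*-distribʳ-sum (F z) (λ e → if does (joins? e x z) then g e else 0#))
               (sum-cong-≋ (λ e → if-*ʳ (does (joins? e x z)) (F z) (g e)))))) ⟩
      sum (λ z → (if does (z ≟ x) then α * F z else 0#) + sum (λ e → h z e))
        ≈⟨ ∑-distrib-+ (λ z → if does (z ≟ x) then α * F z else 0#) (λ z → sum (h z)) ⟩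
      sum (λ z → if does (z ≟ x) then α * F z else 0#) + sum (λ z → sum (h z))
        ≈⟨ +-cong (sum-if-≟ (λ z → α * F z) x) (trans (∑-comm h) (sum-cong-≋ per-edge)) ⟩
      α * F x + Σ⋆ x (λ e → (1# - α) * (θ w x e * F (other x e)))
        ≈⟨ +-congˡ (Σ⋆-*ˡ x (1# - α) (λ e → θ w x e * F (other x e))) ⟩
      α * F x + (1# - α) * Σ⋆ x (λ e → θ w x e * F (other x e)) ∎
      where
      g : Edge → ℝ
      g e = (1# - α) * θ w x e
      h : Vertex → Edge → ℝ
      h z e = if does (joins? e x z) then g e * F z else 0#
      per-edge : ∀ e → sum (λ z → h z e) ≈
                 (if does (incident? x e) then (1# - α) * (θ w x e * F (other x e)) else 0#)
      per-edge e = sym (if-≈ (incident? x e)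
        (λ i → begin-equality
          (1# - α) * (θ w x e * F (other x e)) ≈⟨ *-assoc _ _ _ ⟨
          g e * F (other x e)     ≈⟨ if-yes (joins? e x (other x e)) (joins-other {x} {e} i) ⟨
          h (other x e) e         ≈⟨ sum-single (other x e) (λ z z≢ → if-no (joins? e x z) (z≢ ∘ joins⇔other {x} {e})) ⟨
          sum (λ z → h z e)       ∎)
        (λ ¬i → sym (sum-0 (λ z → if-no (joins? e x z) (¬i ∘ joins⇒incident {e})))))

    -- Separates the atom at `x` from the jump distribution, which does not involve α. The transport
    -- plan is assembled from these two pieces.
    measure-split : ∀ α x z → measure w α x z ≈
                    α * (if does (z ≟ x) then 1# else 0#) + (1# - α) * measure w 0# x z
    measure-split α x z = +-cong
      (sym (trans (if-*ˡ (does (z ≟ x)) α 1#) (if-cong (does (z ≟ x)) (*-identityʳ α) refl)))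
      (begin-equality
        sum (λ e → if does (joins? e x z) then (1# - α) * θ w x e else 0#)
          ≈⟨ sum-cong-≋ (λ e → sym (if-*ˡ (does (joins? e x z)) (1# - α) (θ w x e))) ⟩
        sum (λ e → (1# - α) * (if does (joins? e x z) then θ w x e else 0#))
          ≈⟨ *-distribˡ-sum (1# - α) (λ e → if does (joins? e x z) then θ w x e else 0#) ⟨
        (1# - α) * sum (λ e → if does (joins? e x z) then θ w x e else 0#)
          ≈⟨ *-congˡ (trans (sum-cong-≋ (λ e → if-cong (does (joins? e x z))
               (solve 1 (λ t → t := (con ℤ.1ℤ :- con ℤ.0ℤ) :* t) refl (θ w x e)) refl)) (sym zero-atom)) ⟩
        (1# - α) * measure w 0# x z ∎)
      where
      zero-atom : measure w 0# x z ≈ sum (λ e → if does (joins? e x z) then (1# - 0#) * θ w x e else 0#)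
      zero-atom = trans (+-congʳ (if-const (does (z ≟ x)))) (+-identityˡ _)

    measure₀-off : ∀ {x z} → ¬ Adjacent x z → measure w 0# x z ≈ 0#
    measure₀-off {x} {z} ¬adj = trans (+-cong (if-const (does (z ≟ x)))
        (sum-0 (λ e → if-no (joins? e x z) (λ j → ¬adj (e , j))))) (+-identityˡ 0#)

    measure₀-nonneg : ∀ x z → 0# ≤ measure w 0# x z
    measure₀-nonneg x z = +-nonneg (≤-reflexive (sym (if-const (does (z ≟ x)))))
      (sum-nonneg λ e → if-elim (0# ≤_) (joins? e x z)
        (λ j → ≤-respʳ (solve 1 (λ t → t := (con ℤ.1ℤ :- con ℤ.0ℤ) :* t) refl (θ w x e))
                 (θ-nonneg {x} {e} (joins⇒incident {e} j)))
        (λ _ → ≤-refl))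

    measure-total : ∀ {x e} → Incident x e → ∀ α → sum (measure w α x) ≈ 1#
    measure-total {x} {e} i α = begin-equality
      sum (measure w α x)                         ≈⟨ sum-cong-≋ (λ z → sym (*-identityʳ (measure w α x z))) ⟩
      ∫ x α (λ _ → 1#)                            ≈⟨ ∫-formula x α (λ _ → 1#) ⟩
      α * 1# + (1# - α) * Σ⋆ x (λ e → θ w x e * 1#) ≈⟨ +-congˡ (*-congˡ (trans (Σ⋆-cong x (λ f _ → *-identityʳ (θ w x f))) (Σθ {x} {e} i))) ⟩
      α * 1# + (1# - α) * 1#                      ≈⟨ solve 1 (λ a → a :* con ℤ.1ℤ :+ (con ℤ.1ℤ :- a) :* con ℤ.1ℤ := con ℤ.1ℤ) refl α ⟩
      1#                                          ∎

-- Explicit optimal transport along an edge and the curvature formula.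

module CurvatureFormula (em : ExcludedMiddle 0ℓ) (R : CompleteOrderedField) (T : Graph) (isTree : IsTree T) where
  open RicciFlow em R T hiding (sum)
  open OrderedField em R
  open RingSolver R using (solve; _:+_; _:*_; _:-_; :-_; _:=_; con)
  open ≤-Reasoning
  open Walks T
  open TreeMetric em R T isTree
  open NeighbourMeasure em R T isTree

  -- A cost that is a difference of potentials sees only the marginals. Both bounds of the duality
  -- compare the true cost with this one.
  coupling-dual : ∀ {μ ν : Vertex → ℝ} {π} → IsCoupling μ ν π → ∀ (φ : Vertex → ℝ) →
    sum (λ u → sum (λ v → π u v * (φ u - φ v))) ≈ sum (λ u → μ u * φ u) - sum (λ v → ν v * φ v)
  coupling-dual {μ} {ν} {π} (_ , rows , cols) φ = begin-equality
    sum (λ u → sum (λ v → π u v * (φ u - φ v)))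
      ≈⟨ sum-cong-≋ (λ u → trans (sum-cong-≋ (λ v → solve 3 (λ p a b → p :* (a :- b) := p :* a :- p :* b) refl (π u v) (φ u) (φ v)))
           (sum-sub (λ v → π u v * φ u) (λ v → π u v * φ v))) ⟩
    sum (λ u → sum (λ v → π u v * φ u) - sum (λ v → π u v * φ v))
      ≈⟨ sum-sub (λ u → sum (λ v → π u v * φ u)) (λ u → sum (λ v → π u v * φ v)) ⟩
    sum (λ u → sum (λ v → π u v * φ u)) - sum (λ u → sum (λ v → π u v * φ v))
      ≈⟨ +-cong
           (sum-cong-≋ (λ u → trans (sym (*-distribʳ-sum (φ u) (π u))) (*-congʳ (rows u))))
           (-‿cong (trans (∑-comm (λ u v → π u v * φ v))
             (sum-cong-≋ (λ v → trans (sym (*-distribʳ-sum (φ v) (λ u → π u v))) (*-congʳ (cols v)))))) ⟩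
    sum (λ u → μ u * φ u) - sum (λ v → ν v * φ v) ∎

  -- The Lipschitz bound makes the dual value a lower bound for every coupling, and the given one
  -- attains it. Tightness is weighted by `π u v`, so nothing is demanded of pairs between which no
  -- mass moves.
  kantorovich : ∀ {d μ ν} (φ : Vertex → ℝ) {W} → IsWasserstein₁ d μ ν W →
    (∀ u v → φ u ≤ φ v + d u v) →
    (∃ λ π → IsCoupling μ ν π × (∀ u v → π u v * d u v ≤ π u v * (φ u - φ v))) →
    W ≈ sum (λ u → μ u * φ u) - sum (λ v → ν v * φ v)
  kantorovich {d} {μ} {ν} φ {W} (lower , greatest) lip (π , isπ , tight) = ≤-antisym
    (≤-trans (lower _ (π , isπ , refl))
      (≤-respʳ (coupling-dual isπ φ) (sum-mono λ u → sum-mono (tight u))))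
    (greatest _ λ { cost (ρ , isρ , eq) → ≤-respʳ eq (≤-respˡ (coupling-dual isρ φ)
      (sum-mono λ u → sum-mono λ v → *-mono-nonneg (proj₁ isρ u v)
        (≤-by (0≤b-a (lip u v)) (solve 3 (λ a b l → a :- b :+ (b :+ l :- a) := l) refl (φ u) (φ v) (d u v))))) })

  -- One point `z`, at half the smaller radius below `a`, lies both where `f` is constant and where
  -- `f` is within ϵ of `L`.
  leftLimit-const : ∀ (f : ℝ → ℝ) {a L G} → (∃ λ δ → 0# < δ × (∀ α → a - δ < α → α < a → f α ≈ G)) →
                    LeftLimit f a L → L ≈ G
  leftLimit-const f {a} {L} {G} (δ₁ , 0<δ₁ , const) lim = ≤-antisym
    (≤-+ϵ λ ϵ 0<ϵ → proj₁ (near ϵ 0<ϵ)) (≤-+ϵ λ ϵ 0<ϵ → proj₂ (near ϵ 0<ϵ))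
    where
    near : ∀ ϵ → 0# < ϵ → L ≤ G + ϵ × G ≤ L + ϵ
    near ϵ 0<ϵ with lim ϵ 0<ϵ
    ... | δ₂ , 0<δ₂ , close with min₂ δ₁ δ₂
    ...   | m , m≤₁ , m≤₂ , pos = ≤-respʳ (+-congʳ fz≈G) (abs≤⇒≥ fz~L) , ≤-respˡ fz≈G (abs≤⇒≤ fz~L)
      where
      0<h = half-pos (pos 0<δ₁ 0<δ₂)
      h = half m
      z = a - h
      z<a : z < a
      z<a = <-by 0<h (solve 2 (λ a h → a :- h :+ h := a) refl a h)
      above : ∀ {δ} → m ≤ δ → a - δ < z
      above {δ} m≤δ = <-by (+-pos 0<h (0≤b-a m≤δ)) (begin-equality
        a - δ + (h + (δ - m))        ≈⟨ +-congˡ (+-congˡ (+-congˡ (-‿cong (half+half m)))) ⟨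
        a - δ + (h + (δ - (h + h)))  ≈⟨ solve 3 (λ a d h → a :- d :+ (h :+ (d :- (h :+ h))) := a :- h) refl a δ h ⟩
        a - h                        ∎)
      fz~L : abs (f z - L) ≤ ϵ
      fz~L = close z (above m≤₂) z<a
      fz≈G : f z ≈ G
      fz≈G = const z (above m≤₁) z<a

  module _ {w : Metric} (w>0 : IsPositive w) (e : Edge) where
    private
      x y : Vertex
      x = proj₁ (ends e)
      y = proj₂ (ends e)
      m₀ : Vertex → Vertex → ℝ
      m₀ = measure w 0#
      δ : Vertex → Vertex → ℝ
      δ a b = if does (b ≟ a) then 1# else 0#
      x∈e : Incident x e
      x∈e = inj₁ ≡.refl
      y∈e : Incident y e
      y∈e = inj₂ ≡.refl
      t : Vertex → Edge → ℝ
      t = θ w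

    sum-δ : ∀ a → sum (δ a) ≈ 1#
    sum-δ a = sum-if-≟ (λ _ → 1#) a

    δ-nonneg : ∀ a b → 0# ≤ δ a b
    δ-nonneg a b = if-elim (0# ≤_) (b ≟ a) (λ _ → proj₁ 0<1) (λ _ → ≤-refl)

    sum-* : ∀ {n} c (f : Fin n → ℝ) {s} → sum f ≈ s → sum (λ i → c * f i) ≈ c * s
    sum-* c f eq = trans (sym (*-distribˡ-sum c f)) (*-congˡ eq)

    -- The part η m₀ x is sent to y, the part η m₀ y comes from x, and the rest
    -- goes from x to y; here η = 1 - α ≤ 1/2.
    plan : ℝ → Vertex → Vertex → ℝ
    plan η u v = (η * m₀ x u) * δ y v + (η * δ x u) * m₀ y v + ((1# - (η + η)) * δ x u) * δ y v

    -- Arbitrary vectors of total mass 1 let the same computation serve the row sums of `plan` and,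
    -- with the factors exchanged, its column sums.
    sum-plan : ∀ η {n} (a b c : ℝ) (f g h : Fin n → ℝ) → sum f ≈ 1# → sum g ≈ 1# → sum h ≈ 1# →
      sum (λ v → (η * a) * f v + (η * b) * g v + ((1# - (η + η)) * c) * h v) ≈
      η * a + η * b + (1# - (η + η)) * c
    sum-plan η a b c f g h sf sg sh = begin-equality
      sum (λ v → (η * a) * f v + (η * b) * g v + ((1# - (η + η)) * c) * h v)
        ≈⟨ trans (∑-distrib-+ (λ v → (η * a) * f v + (η * b) * g v) (λ v → ((1# - (η + η)) * c) * h v))
             (+-congʳ (∑-distrib-+ (λ v → (η * a) * f v) (λ v → (η * b) * g v))) ⟩
      sum (λ v → (η * a) * f v) + sum (λ v → (η * b) * g v) + sum (λ v → ((1# - (η + η)) * c) * h v)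
        ≈⟨ +-cong (+-cong (sum-* (η * a) f sf) (sum-* (η * b) g sg)) (sum-* ((1# - (η + η)) * c) h sh) ⟩
      (η * a) * 1# + (η * b) * 1# + ((1# - (η + η)) * c) * 1#
        ≈⟨ +-cong (+-cong (*-identityʳ _) (*-identityʳ _)) (*-identityʳ _) ⟩
      η * a + η * b + (1# - (η + η)) * c ∎

    module _ (α : ℝ) (½≤α : 1# ≤ α + α) (α≤1 : α ≤ 1#) where
      private
        η : ℝ
        η = 1# - α
        0≤η : 0# ≤ η
        0≤η = 0≤b-a α≤1
        -- The bound α ≥ 1/2 enters here: the mass that remains to be sent from `x` to `y` must not
        -- be negative.
        0≤1-2η : 0# ≤ 1# - (η + η)
        0≤1-2η = ≤-respʳ (solve 1 (λ a → a :+ a :- con ℤ.1ℤ := con ℤ.1ℤ :- ((con ℤ.1ℤ :- a) :+ (con ℤ.1ℤ :- a))) refl α) (0≤b-a ½≤α)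

      isCoupling : IsCoupling (measure w α x) (measure w α y) (plan η)
      isCoupling =
        (λ u v → +-nonneg (+-nonneg
          (*-nonneg (*-nonneg 0≤η (measure₀-nonneg w>0 x u)) (δ-nonneg y v))
          (*-nonneg (*-nonneg 0≤η (δ-nonneg x u)) (measure₀-nonneg w>0 y v)))
          (*-nonneg (*-nonneg 0≤1-2η (δ-nonneg x u)) (δ-nonneg y v))) ,
        (λ u → trans
          (sum-plan η (m₀ x u) (δ x u) (δ x u) (δ y) (m₀ y) (δ y) (sum-δ y) (measure-total w>0 {y} {e} y∈e 0#) (sum-δ y))
          (trans (solve 3 (λ a m d → (con ℤ.1ℤ :- a) :* m :+ (con ℤ.1ℤ :- a) :* d :+ (con ℤ.1ℤ :- ((con ℤ.1ℤ :- a) :+ (con ℤ.1ℤ :- a))) :* d := a :* d :+ (con ℤ.1ℤ :- a) :* m) refl α (m₀ x u) (δ x u))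
            (sym (measure-split w>0 α x u)))) ,
        (λ v → trans
          (sum-cong-≋ (λ u → solve 6 (λ a mx dy dx my f → (a :* mx) :* dy :+ (a :* dx) :* my :+ (f :* dx) :* dy :=
              (a :* dy) :* mx :+ (a :* my) :* dx :+ (f :* dy) :* dx) refl η (m₀ x u) (δ y v) (δ x u) (m₀ y v) (1# - (η + η))))
          (trans (sum-plan η (δ y v) (m₀ y v) (δ y v) (m₀ x) (δ x) (δ x) (measure-total w>0 {x} {e} x∈e 0#) (sum-δ x) (sum-δ x))
          (trans (solve 3 (λ a m d → (con ℤ.1ℤ :- a) :* d :+ (con ℤ.1ℤ :- a) :* m :+ (con ℤ.1ℤ :- ((con ℤ.1ℤ :- a) :+ (con ℤ.1ℤ :- a))) :* d := a :* d :+ (con ℤ.1ℤ :- a) :* m) refl α (m₀ y v) (δ y v))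
            (sym (measure-split w>0 α y v)))))

      module _ {d : Vertex → Vertex → ℝ} (isDist : IsPathMetric w d) where
        open PathMetric w>0 isDist
        open Potential e using (φ; φ-lipschitz; φx; φy; φ-near-x; φ-near-y; tight-to-y; tight-from-x; tight-xy)

        vanish : ∀ {c a b : ℝ} → c ≈ 0# → c * a ≤ c * b
        vanish c≈0 = ≤-reflexive (trans (*-congʳ c≈0) (trans (zeroˡ _) (sym (trans (*-congʳ c≈0) (zeroˡ _)))))

        -- Each of the three parts of the plan is thus compared with `φ` only where it carries mass.
        tight-if : ∀ {P : Set} {c a b : ℝ} → 0# ≤ c → (P → a ≤ b) → (¬ P → c ≈ 0#) → c * a ≤ c * b
        tight-if {P} 0≤c f g with em {P}
        ... | yes p = *-mono-nonneg 0≤c (f p)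
        ... | no ¬p = vanish (g ¬p)

        annihʳ : ∀ {a b} → b ≈ 0# → a * b ≈ 0#
        annihʳ b≈0 = trans (*-congˡ b≈0) (zeroʳ _)

        annihˡ : ∀ {a b} → a ≈ 0# → a * b ≈ 0#
        annihˡ a≈0 = trans (*-congʳ a≈0) (zeroˡ _)

        plan-tight : ∀ u v → plan η u v * d u v ≤ plan η u v * (φ u - φ v)
        plan-tight u v = ≤-respˡ (sym (distrib₃ _ _ _ _)) (≤-respʳ (sym (distrib₃ _ _ _ _))
          (+-mono-≤ (+-mono-≤ to-y from-x) x-to-y))
          where
          distrib₃ : ∀ a b c z → (a + b + c) * z ≈ a * z + b * z + c * z
          distrib₃ = solve 4 (λ a b c z → (a :+ b :+ c) :* z := a :* z :+ b :* z :+ c :* z) refl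
          to-y : ((η * m₀ x u) * δ y v) * d u v ≤ ((η * m₀ x u) * δ y v) * (φ u - φ v)
          to-y = tight-if {Adjacent x u × v ≡ y} (*-nonneg (*-nonneg 0≤η (measure₀-nonneg w>0 x u)) (δ-nonneg y v))
            (λ { ((f , j) , ≡.refl) → tight-to-y {f} j })
            off
            where
            off : ¬ (Adjacent x u × v ≡ y) → (η * m₀ x u) * δ y v ≈ 0#
            off ¬p with v ≟ y
            ... | yes v≡y = annihˡ (annihʳ (measure₀-off w>0 (λ adj → ¬p (adj , v≡y))))
            ... | no  _   = zeroʳ _
          from-x : ((η * δ x u) * m₀ y v) * d u v ≤ ((η * δ x u) * m₀ y v) * (φ u - φ v)
          from-x = tight-if {Adjacent y v × u ≡ x} (*-nonneg (*-nonneg 0≤η (δ-nonneg x u)) (measure₀-nonneg w>0 y v))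
            (λ { ((f , j) , ≡.refl) → tight-from-x {f} j })
            off
            where
            off : ¬ (Adjacent y v × u ≡ x) → (η * δ x u) * m₀ y v ≈ 0#
            off ¬p with u ≟ x
            ... | yes u≡x = annihʳ (measure₀-off w>0 (λ adj → ¬p (adj , u≡x)))
            ... | no  _   = annihˡ (zeroʳ _)
          x-to-y : (((1# - (η + η)) * δ x u) * δ y v) * d u v ≤ (((1# - (η + η)) * δ x u) * δ y v) * (φ u - φ v)
          x-to-y = tight-if {u ≡ x × v ≡ y} (*-nonneg (*-nonneg 0≤1-2η (δ-nonneg x u)) (δ-nonneg y v))
            (λ { (≡.refl , ≡.refl) → tight-xy })
            off
            where
            off : ¬ (u ≡ x × v ≡ y) → ((1# - (η + η)) * δ x u) * δ y v ≈ 0#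
            off ¬p with u ≟ x | v ≟ y
            ... | yes p | yes q = contradiction (p , q) ¬p
            ... | yes _ | no _  = zeroʳ _
            ... | no _  | _     = annihˡ (zeroʳ _)

        -- With `r` for the inverse of `D w x`, a neighbour other than `y` contributes
        -- `w e * t x f + r`, and `y` contributes 0. Writing this 0 as the common expression
        -- corrected by `- (r + r)` makes the sum uniform; the correction is the 2 subtracted from
        -- the degree.
        end-integral-x : Σ⋆ x (λ f → t x f * φ (other x f)) ≈
                         w e + (fromℕ (degree x) - fromℕ 2) * D w x ⁻¹
        end-integral-x = begin-equality
          Σ⋆ x (λ f → t x f * φ (other x f))
            ≈⟨ Σ⋆-cong x term ⟩
          Σ⋆ x (λ f → w e * t x f + (r + (if does (f ≟ e) then - (r + r) else 0#)))
            ≈⟨ Σ⋆-+ x (λ f → w e * t x f) (λ f → r + jump f) ⟩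
          Σ⋆ x (λ f → w e * t x f) + Σ⋆ x (λ f → r + jump f)
            ≈⟨ +-cong (Σ⋆-*ˡ x (w e) (t x)) (Σ⋆-+ x (λ _ → r) jump) ⟩
          w e * Σ⋆ x (t x) + (Σ⋆ x (λ _ → r) + Σ⋆ x jump)
            ≈⟨ +-cong (*-congˡ (Σθ w>0 {x} {e} x∈e)) (+-cong (Σ⋆-const x r) (Σ⋆-single x∈e (λ _ → - (r + r)))) ⟩
          w e * 1# + (fromℕ (degree x) * r - (r + r))
            ≈⟨ solve 3 (λ w n r → w :* con ℤ.1ℤ :+ (n :* r :- (r :+ r)) := w :+ (n :- (con ℤ.1ℤ :+ con ℤ.1ℤ)) :* r) refl (w e) (fromℕ (degree x)) r ⟩
          w e + (fromℕ (degree x) - (1# + 1#)) * r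
            ≈⟨ +-congˡ (*-congʳ (+-congˡ (-‿cong fromℕ2))) ⟨
          w e + (fromℕ (degree x) - fromℕ 2) * D w x ⁻¹ ∎
          where
          r = D w x ⁻¹
          jump : Edge → ℝ
          jump f = if does (f ≟ e) then - (r + r) else 0#
          term : ∀ f → Incident x f → t x f * φ (other x f) ≈ w e * t x f + (r + jump f)
          term f i with f ≟ e
          ... | yes ≡.refl = begin-equality
            t x e * φ (other x e)  ≡⟨ ≡.cong (λ z → t x e * φ z) (≡.sym (joins⇔other {x} {e} (joins-ends e))) ⟩
            t x e * φ y            ≈⟨ annihʳ φy ⟩
            0#                     ≈⟨ solve 1 (λ r → con ℤ.0ℤ := r :+ (r :- (r :+ r))) refl r ⟩
            r + (r - (r + r))      ≈⟨ +-congʳ (trans (*-comm _ _) (θ*w w>0 x e)) ⟨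
            w e * t x e + (r - (r + r)) ∎
          ... | no f≢e = begin-equality
            t x f * φ (other x f)       ≈⟨ *-congˡ (φ-near-x {f} f≢e (joins-other {x} {f} i)) ⟩
            t x f * (w e + w f)         ≈⟨ solve 3 (λ t a b → t :* (a :+ b) := a :* t :+ (t :* b :+ con ℤ.0ℤ)) refl (t x f) (w e) (w f) ⟩
            w e * t x f + (t x f * w f + 0#) ≈⟨ +-congˡ (+-congʳ (θ*w w>0 x f)) ⟩
            w e * t x f + (r + 0#)      ∎
          
        end-integral-y : Σ⋆ y (λ f → t y f * φ (other y f)) ≈ (fromℕ 2 - fromℕ (degree y)) * D w y ⁻¹
        end-integral-y = begin-equality
          Σ⋆ y (λ f → t y f * φ (other y f))        ≈⟨ Σ⋆-cong y term ⟩
          Σ⋆ y (λ f → - r + jump f)                 ≈⟨ Σ⋆-+ y (λ _ → - r) jump ⟩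
          Σ⋆ y (λ _ → - r) + Σ⋆ y jump              ≈⟨ +-cong (Σ⋆-const y (- r)) (Σ⋆-single y∈e (λ _ → r + r)) ⟩
          fromℕ (degree y) * - r + (r + r)          ≈⟨ solve 2 (λ n r → n :* :- r :+ (r :+ r) := (con ℤ.1ℤ :+ con ℤ.1ℤ :- n) :* r) refl (fromℕ (degree y)) r ⟩
          (1# + 1# - fromℕ (degree y)) * r          ≈⟨ *-congʳ (+-congʳ fromℕ2) ⟨
          (fromℕ 2 - fromℕ (degree y)) * D w y ⁻¹   ∎
          where
          r = D w y ⁻¹
          jump : Edge → ℝ
          -- The end `x` lies at `φ`-value `+ w e`, every other neighbour of `y` at minus the weight
          -- of its edge; the correction turns `- r` into `r`.
          jump f = if does (f ≟ e) then r + r else 0#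
          term : ∀ f → Incident y f → t y f * φ (other y f) ≈ - r + jump f
          term f i with f ≟ e
          ... | yes ≡.refl = begin-equality
            t y e * φ (other y e)  ≡⟨ ≡.cong (λ z → t y e * φ z) (≡.sym (joins⇔other {y} {e} (joins-swap {e} (joins-ends e)))) ⟩
            t y e * φ x            ≈⟨ *-congˡ φx ⟩
            t y e * w e            ≈⟨ θ*w w>0 y e ⟩
            r                      ≈⟨ solve 1 (λ r → r := :- r :+ (r :+ r)) refl r ⟩
            - r + (r + r)          ∎
          ... | no f≢e = begin-equality
            t y f * φ (other y f)  ≈⟨ *-congˡ (φ-near-y {f} f≢e (joins-other {y} {f} i)) ⟩
            t y f * - w f          ≈⟨ solve 2 (λ a b → a :* :- b := :- (a :* b) :+ con ℤ.0ℤ) refl (t y f) (w f) ⟩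
            - (t y f * w f) + 0#   ≈⟨ +-congʳ (-‿cong (θ*w w>0 y f)) ⟩
            - r + 0#               ∎

        W₁-formula : ∀ {W} → IsWasserstein₁ d (measure w α x) (measure w α y) W →
          W ≈ w e - (1# - α) * ((fromℕ 2 - fromℕ (degree x)) * D w x ⁻¹ + (fromℕ 2 - fromℕ (degree y)) * D w y ⁻¹)
        W₁-formula {W} isW = begin-equality
          W ≈⟨ kantorovich φ isW φ-lipschitz (plan η , isCoupling , plan-tight) ⟩
          ∫ w>0 x α φ - ∫ w>0 y α φ
            ≈⟨ +-cong (trans (∫-formula w>0 x α φ) (+-cong (*-congˡ φx) (*-congˡ end-integral-x)))
                 (-‿cong (trans (∫-formula w>0 y α φ) (+-cong (*-congˡ φy) (*-congˡ end-integral-y)))) ⟩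
          (α * w e + (1# - α) * (w e + (fromℕ (degree x) - fromℕ 2) * D w x ⁻¹)) -
          (α * 0# + (1# - α) * ((fromℕ 2 - fromℕ (degree y)) * D w y ⁻¹))
            ≈⟨ solve 7 (λ a w k n r m s →
                 (a :* w :+ (con ℤ.1ℤ :- a) :* (w :+ (n :- k) :* r)) :- (a :* con ℤ.0ℤ :+ (con ℤ.1ℤ :- a) :* ((k :- m) :* s))
                 := w :- (con ℤ.1ℤ :- a) :* ((k :- n) :* r :+ (k :- m) :* s)) refl
                 α (w e) (fromℕ 2) (fromℕ (degree x)) (D w x ⁻¹) (fromℕ (degree y)) (D w y ⁻¹) ⟩
          w e - (1# - α) * ((fromℕ 2 - fromℕ (degree x)) * D w x ⁻¹ + (fromℕ 2 - fromℕ (degree y)) * D w y ⁻¹) ∎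

    -- `W₁-formula` is affine in α with value `w e` at 1, so the quotient in the definition of
    -- curvature is constant for α > 1/2 and the limit is that constant.
    curvature-formula : ∀ {k} → IsCurvature w e k →
      k * w e ≈ (fromℕ 2 - fromℕ (degree x)) * D w x ⁻¹ + (fromℕ 2 - fromℕ (degree y)) * D w y ⁻¹
    curvature-formula {k} isK = sym (/-elim (w>0 e) (sym (leftLimit-const
        (λ α → (1# - IsCurvature.W₁ isK α / w e) / (1# - α)) (half 1# , half-pos 0<1 , λ α lo hi → value α lo hi) (IsCurvature.curvature isK))))
      where
      G = (fromℕ 2 - fromℕ (degree x)) * D w x ⁻¹ + (fromℕ 2 - fromℕ (degree y)) * D w y ⁻¹
      value : ∀ α → 1# - half 1# < α → α < 1# → (1# - IsCurvature.W₁ isK α / w e) / (1# - α) ≈ G / w e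
      value α lo hi = /-intro (0<b-a hi) (begin-equality
        1# - W / w e                             ≈⟨ +-congˡ (-‿cong (*-congʳ W≈)) ⟩
        1# - (w e - (1# - α) * G) * w e ⁻¹       ≈⟨ solve 4 (λ w a g i → con ℤ.1ℤ :- (w :- (con ℤ.1ℤ :- a) :* g) :* i := (con ℤ.1ℤ :- w :* i) :+ (g :* i) :* (con ℤ.1ℤ :- a)) refl (w e) α G (w e ⁻¹) ⟩
        (1# - w e * w e ⁻¹) + G / w e * (1# - α) ≈⟨ +-congʳ (trans (+-congˡ (-‿cong (inverseʳ (w e) (pos⇒≉0 (w>0 e))))) (-‿inverseʳ 1#)) ⟩
        0# + G / w e * (1# - α)                  ≈⟨ +-identityˡ _ ⟩
        G / w e * (1# - α)                       ∎)
        where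
        W = IsCurvature.W₁ isK α
        ½≤α : half 1# ≤ α
        ½≤α = ≤-respˡ (begin-equality
            1# - half 1#                       ≈⟨ +-congʳ (half+half 1#) ⟨
            half 1# + half 1# - half 1#        ≈⟨ solve 1 (λ h → h :+ h :- h := h) refl (half 1#) ⟩
            half 1#                            ∎) (proj₁ lo)
        1≤2α : 1# ≤ α + α
        1≤2α = ≤-respˡ (half+half 1#) (+-mono-≤ ½≤α ½≤α)
        W≈ : W ≈ w e - (1# - α) * G
        W≈ = W₁-formula α 1≤2α (proj₁ hi) (IsCurvature.isDist isK)
               (IsCurvature.isW₁ isK α (≤-trans (proj₁ (half-pos 0<1)) ½≤α) hi)

-- Subsets, the set function β and sums of curvatures.

∈-tabulate⁺ : ∀ {n} {P : Fin n → Set} (P? : ∀ i → Dec (P i)) {i} → P i → i ∈ tabulate (λ j → does (P? j))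
∈-tabulate⁺ P? {i} p = lookup⇒[]= i _ (≡.trans (lookup∘tabulate _ i) (dec-true (P? i) p))

∈-tabulate⁻ : ∀ {n} {P : Fin n → Set} (P? : ∀ i → Dec (P i)) {i} → i ∈ tabulate (λ j → does (P? j)) → P i
∈-tabulate⁻ P? {i} i∈ with P? i | ≡.trans (≡.sym (lookup∘tabulate (λ j → does (P? j)) i)) ([]=⇒lookup i∈)
... | yes p | _ = p
... | no _  | ()

∣p∣>0 : ∀ {n} {A : Subset n} {x} → x ∈ A → 0 ℕ.< ∣ A ∣
∣p∣>0 {A = A} x∈A = ℕ.≤-<-trans z≤n (x∈p⇒∣p-x∣<∣p∣ x∈A)

∣p∣≡1⇒unique : ∀ {n} {A : Subset n} {x y} → ∣ A ∣ ≡ 1 → x ∈ A → y ∈ A → y ≡ x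
∣p∣≡1⇒unique {A = A} {x} {y} ∣A∣≡1 x∈A y∈A with y ≟ x
... | yes y≡x = y≡x
... | no  y≢x = contradiction (∣p∣>0 (x∈p∧x≢y⇒x∈p-y y∈A y≢x))
  (ℕ.≤⇒≯ (ℕ.≤-pred (≡.subst (∣ A ∖ x ∣ ℕ.<_) ∣A∣≡1 (x∈p⇒∣p-x∣<∣p∣ x∈A))))

module SetFunctions (em : ExcludedMiddle 0ℓ) (R : CompleteOrderedField) (T : Graph) (isTree : IsTree T)
                    (e₀ : Graph.Edge T) where
  open RicciFlow em R T hiding (sum)
  open OrderedField em R
  open RingSolver R using (solve; _:+_; _:*_; _:-_; :-_; _:=_; con)
  open ≤-Reasoning
  open Walks T
  open NeighbourMeasure em R T isTree
  open CurvatureFormula em R T isTree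

  incident⇒∈star : ∀ {x e} → Incident x e → e ∈ star x
  incident⇒∈star {x} = ∈-tabulate⁺ (incident? x)

  ∈star⇒incident : ∀ {x e} → e ∈ star x → Incident x e
  ∈star⇒incident {x} = ∈-tabulate⁻ (incident? x)

  edge-at : ∀ x → ∃ λ e → Incident x e
  edge-at = incident-edge isTree e₀

  coeff : Vertex → ℝ
  coeff x = fromℕ 2 - fromℕ (degree x)

  fromℕ-nonneg : ∀ n → 0# ≤ fromℕ n
  fromℕ-nonneg ℕ.zero  = ≤-refl
  fromℕ-nonneg (suc n) = +-nonneg (proj₁ 0<1) (fromℕ-nonneg n)

  -- The coefficient `2 - d` is positive only at a leaf, and the star of a leaf is a single edge,
  -- hence contained in a given set or disjoint from it. Every comparison with β rests on this
  -- alternative.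
  data VertexKind (x : Vertex) : Set where
    leaf : ∀ e → Incident x e → (∀ f → Incident x f → f ≡ e) → VertexKind x
    inner : coeff x ≤ 0# → VertexKind x

  vertexKind : ∀ x → VertexKind x
  vertexKind x with degree x in eq
  -- Degree 0 is excluded by connectedness and the existence of the edge `e₀`.
  ... | 0 = contradiction (∣p∣>0 (incident⇒∈star {x} (proj₂ (edge-at x)))) (ℕ.≤⇒≯ (ℕ.≤-reflexive eq))
  ... | 1 = leaf (proj₁ (edge-at x)) (proj₂ (edge-at x))
              (λ f i → ∣p∣≡1⇒unique eq (incident⇒∈star {x} (proj₂ (edge-at x))) (incident⇒∈star {x} i))
  ... | suc (suc k) = inner (begin
    fromℕ 2 - fromℕ (degree x)       ≡⟨ ≡.cong (λ n → fromℕ 2 - fromℕ n) eq ⟩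
    fromℕ 2 - fromℕ (suc (suc k))    ≈⟨ solve 2 (λ a n → (a :+ (a :+ con ℤ.0ℤ)) :- (a :+ (a :+ n)) := :- n) refl 1# (fromℕ k) ⟩
    - fromℕ k                        ≤⟨ -‿anti-≤ (fromℕ-nonneg k) ⟩
    - 0#                             ≈⟨ solve 0 (:- con ℤ.0ℤ := con ℤ.0ℤ) refl ⟩
    0#                               ∎)

  term : Vertex → Subset size → ℝ
  term x A = if does (star x ⊆? A) then coeff x else 0#

  full : ∀ x {A} → star x ⊆ A → term x A ≈ coeff x
  full x {A} = if-yes (star x ⊆? A)

  partial : ∀ x {A} → ¬ star x ⊆ A → term x A ≈ 0#
  partial x {A} = if-no (star x ⊆? A)

  -- The two sides can differ only at a vertex whose star lies in the union but in neither set. It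
  -- then cannot be a leaf, so the extra term on the left is at most 0.
  β-submodular : ∀ X Y → β (X ∪ Y) + β (X ∩ Y) ≤ β X + β Y
  β-submodular X Y = begin
    β (X ∪ Y) + β (X ∩ Y)                             ≈⟨ ∑-distrib-+ (λ x → term x (X ∪ Y)) (λ x → term x (X ∩ Y)) ⟨
    sum (λ x → term x (X ∪ Y) + term x (X ∩ Y))       ≤⟨ sum-mono per-vertex ⟩
    sum (λ x → term x X + term x Y)                   ≈⟨ ∑-distrib-+ (λ x → term x X) (λ x → term x Y) ⟩
    β X + β Y                                         ∎
    where
    per-vertex : ∀ x → term x (X ∪ Y) + term x (X ∩ Y) ≤ term x X + term x Y
    per-vertex x with em {star x ⊆ X} | em {star x ⊆ Y}
    ... | yes p | yes q = ≤-reflexive (+-cong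
      (trans (full x (p⊆p∪q Y ∘ p)) (sym (full x p)))
      (trans (full x (λ i → x∈p∩q⁺ (p i , q i))) (sym (full x q))))
    ... | yes p | no ¬q = ≤-reflexive (+-cong
      (trans (full x (p⊆p∪q Y ∘ p)) (sym (full x p)))
      (trans (partial x (λ r → ¬q (p∩q⊆q X Y ∘ r))) (sym (partial x ¬q))))
    ... | no ¬p | yes q = ≤-reflexive (trans (+-comm _ _) (+-cong
      (trans (partial x (λ r → ¬p (p∩q⊆p X Y ∘ r))) (sym (partial x ¬p)))
      (trans (full x (q⊆p∪q X Y ∘ q)) (sym (full x q)))))
    ... | no ¬p | no ¬q = +-mono-≤ union
      (≤-reflexive (trans (partial x (λ r → ¬p (p∩q⊆p X Y ∘ r))) (sym (partial x ¬q))))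
      where
      union : term x (X ∪ Y) ≤ term x X
      union with em {star x ⊆ X ∪ Y} | vertexKind x
      ... | no ¬r | _         = ≤-reflexive (trans (partial x ¬r) (sym (partial x ¬p)))
      ... | yes r | inner c≤0 = ≤-respˡ (sym (full x r)) (≤-respʳ (sym (partial x ¬p)) c≤0)
      ... | yes r | leaf e i only with x∈p∪q⁻ X Y (r (incident⇒∈star {x} i))
      ...   | inj₁ e∈X = contradiction (λ {f} f∈ → ≡.subst (_∈ X) (≡.sym (only f (∈star⇒incident {x} f∈))) e∈X) ¬p
      ...   | inj₂ e∈Y = contradiction (λ {f} f∈ → ≡.subst (_∈ Y) (≡.sym (only f (∈star⇒incident {x} f∈))) e∈Y) ¬q

  -- The inequality is strict, so a lower set never separates edges with equal entries; only a
  -- strict gap forces the ratio of two weights to 0.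
  IsLower : (Edge → ℝ) → Subset size → Set
  IsLower c A = ∀ e f → e ∈ A → f ∉ A → c e < c f

  β-⊥ : β ⊥ ≈ 0#
  β-⊥ = sum-0 λ x → partial x λ star⊆⊥ → ∉⊥ (star⊆⊥ (incident⇒∈star {x} (proj₂ (edge-at x))))

  share : Metric → Vertex → Subset size → ℝ
  share w x A = Σ⋆ x (λ e → if does (e ∈? A) then θ w x e else 0#)

  module _ {w : Metric} (w>0 : IsPositive w) where
    share-full : ∀ x {A} → star x ⊆ A → share w x A ≈ 1#
    share-full x {A} star⊆A = trans
      (Σ⋆-cong x (λ e i → if-yes (e ∈? A) (star⊆A (incident⇒∈star {x} i))))
      (Σθ w>0 {x} (proj₂ (edge-at x)))

    share-nonneg : ∀ x A → 0# ≤ share w x A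
    share-nonneg x A = sum-nonneg λ e → if-elim (0# ≤_) (incident? x e)
      (λ i → if-elim (0# ≤_) (e ∈? A) (λ _ → θ-nonneg w>0 {x} {e} i) (λ _ → ≤-refl)) (λ _ → ≤-refl)

    -- By `θ*w` the curvature formula divided by `w e` splits `κ e` between the two ends of `e`; the
    -- double sum is then ordered by vertices instead of edges.
    curvature≈shares : ∀ {κ} → (∀ e → IsCurvature w e (κ e)) → ∀ A →
                       total-over κ A ≈ sum (λ x → coeff x * share w x A)
    curvature≈shares {κ} isK A = begin-equality
      sum (λ e → if does (e ∈? A) then κ e else 0#)
        ≈⟨ sum-cong-≋ (λ e → trans (if-cong (does (e ∈? A)) (per-edge e) refl) (if-sum (does (e ∈? A)) (h e))) ⟩
      sum (λ e → sum (λ x → if does (e ∈? A) then h e x else 0#))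
        ≈⟨ ∑-comm (λ e x → if does (e ∈? A) then h e x else 0#) ⟩
      sum (λ x → sum (λ e → if does (e ∈? A) then h e x else 0#))
        ≈⟨ sum-cong-≋ (λ x → trans (sum-cong-≋ (λ e → if-swap (does (e ∈? A)) (does (incident? x e)) (coeff x) (θ w x e)))
             (Σ⋆-*ˡ x (coeff x) (λ e → if does (e ∈? A) then θ w x e else 0#))) ⟩
      sum (λ x → coeff x * share w x A) ∎
      where
      h : Edge → Vertex → ℝ
      h e x = if does (incident? x e) then coeff x * θ w x e else 0#
      if-swap : ∀ (a b : Bool) c t → (if a then (if b then c * t else 0#) else 0#) ≈
                (if b then c * (if a then t else 0#) else 0#)
      if-swap true  true  c t = refl
      if-swap true  false c t = refl
      if-swap false true  c t = sym (zeroʳ c)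
      if-swap false false c t = refl
      per-edge : ∀ e → κ e ≈ sum (h e)
      per-edge e = *-cancelʳ-≈ (w>0 e) (begin-equality
        κ e * w e
          ≈⟨ curvature-formula w>0 e (isK e) ⟩
        coeff x * D w x ⁻¹ + coeff y * D w y ⁻¹
          ≈⟨ +-cong (*-congˡ (θ*w w>0 x e)) (*-congˡ (θ*w w>0 y e)) ⟨
        coeff x * (θ w x e * w e) + coeff y * (θ w y e * w e)
          ≈⟨ solve 5 (λ a b c d w → a :* (b :* w) :+ c :* (d :* w) := (a :* b :+ c :* d) :* w) refl _ _ _ _ _ ⟩
        (coeff x * θ w x e + coeff y * θ w y e) * w e
          ≈⟨ *-congʳ (+-cong (if-yes (incident? x e) (inj₁ ≡.refl)) (if-yes (incident? y e) (inj₂ ≡.refl))) ⟨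
        (h e x + h e y) * w e
          ≈⟨ *-congʳ (sum-pair x y x≢y (λ z z≢x z≢y → if-no (incident? z e) λ { (inj₁ p) → z≢x p ; (inj₂ p) → z≢y p })) ⟨
        sum (h e) * w e ∎)
        where
        x = proj₁ (ends e)
        y = proj₂ (ends e)
        x≢y : x ≢ y
        x≢y x≡y = loopless e x (inj₁ (≡.cong (x ,_) (≡.sym x≡y)))

    -- A vertex whose star lies in `A` has share 1 and gives equality. Any other vertex counts 0 in
    -- β: if it is a leaf its share is 0, otherwise its nonnegative share is multiplied by a
    -- coefficient at most 0.
    curvature≤β : ∀ {κ} → (∀ e → IsCurvature w e (κ e)) → ∀ A → total-over κ A ≤ β A
    curvature≤β isK A = ≤-respˡ (sym (curvature≈shares isK A)) (sum-mono per-vertex)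
      where
      per-vertex : ∀ x → coeff x * share w x A ≤ term x A
      per-vertex x with em {star x ⊆ A} | vertexKind x
      ... | yes p | _ = ≤-reflexive (trans (*-congˡ (share-full x p)) (trans (*-identityʳ _) (sym (full x p))))
      ... | no ¬p | inner c≤0 = ≤-respʳ (trans (zeroˡ _) (sym (partial x ¬p))) (*-mono-nonnegʳ (share-nonneg x A) c≤0)
      ... | no ¬p | leaf e i only = ≤-reflexive (trans (trans (*-congˡ share≈0) (zeroʳ _)) (sym (partial x ¬p)))
        where
        share≈0 : share w x A ≈ 0#
        share≈0 = sum-0 λ f → if-≈ (incident? x f)
          (λ j → if-no (f ∈? A) λ f∈A → ¬p λ {g} g∈ →
            ≡.subst (_∈ A) (≡.trans (only f j) (≡.sym (only g (∈star⇒incident {x} g∈)))) f∈A)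
          (λ _ → refl)

    curvature⊤ : ∀ {κ} → (∀ e → IsCurvature w e (κ e)) → total-over κ ⊤ ≈ β ⊤
    curvature⊤ isK = trans (curvature≈shares isK ⊤) (sum-cong-≋ λ x →
      trans (*-congˡ (share-full x (⊆-max (star x)))) (trans (*-identityʳ _) (sym (full x (⊆-max (star x))))))

-- Decay of quotients from derivative bounds, and limits at infinity.

module Analysis (em : ExcludedMiddle 0ℓ) (R : CompleteOrderedField) (T : Graph) where
  open RicciFlow em R T hiding (sum)
  open OrderedField em R
  open RingSolver R using (solve; _:+_; _:*_; _:-_; :-_; _:=_; con)
  open ≤-Reasoning

  open Algebra.Solver.CommutativeMonoid *-commutativeMonoid using (_⊕_; _⊜_) renaming (solve to *-solve)

  -- Steps of Q near every point combine to a step across the whole interval,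
  -- because the supremum of the reachable points is reachable and can only be b.
  chain : ∀ (Q : ℝ → ℝ → Set) {a b} → a ≤ b →
    (∀ {x y z} → Q x y → Q y z → Q x z) →
    (∀ t → a ≤ t → t ≤ b → ∃ λ δ → 0# < δ ×
      (∀ s → t ≤ s → s < t + δ → Q t s) × (∀ s → a ≤ s → s ≤ t → t - δ < s → Q s t)) →
    Q a b
  chain Q {a} {b} a≤b Q-trans local = conclude
    where
    Reachable : ℝ → Set
    Reachable x = a ≤ x × x ≤ b × Q a x

    shift-< : ∀ {t δ} → 0# < δ → t < t + δ
    shift-< 0<δ = <-by 0<δ refl

    a-reachable : Reachable a
    a-reachable with local a ≤-refl a≤b
    ... | δ , 0<δ , right , _ = ≤-refl , a≤b , right a ≤-refl (shift-< 0<δ)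

    finish : ∀ m → IsSupremum Reachable m → Q a b
    finish m (below-m , least-m) with local m (below-m a a-reachable) (least-m b λ x r → proj₁ (proj₂ r))
    ... | δ , 0<δ , right , left = beyond
      where
      approached : ∃ λ x → Reachable x × m - δ < x
      approached with em {∃ λ x → Reachable x × m - δ < x}
      ... | yes found = found
      ... | no none = contradiction (least-m (m - δ) bounded)
        (<⇒≱ (<-by 0<δ (solve 2 (λ m d → m :- d :+ d := m) refl m δ)))
        where
        bounded : IsUpperBound Reachable (m - δ)
        bounded x r with ≤-or-> x (m - δ)
        ... | inj₁ le = le
        ... | inj₂ gt = contradiction (x , r , gt) none

      Qam : Q a m
      Qam with approached
      ... | x , r@(a≤x , _ , Qax) , near = Q-trans Qax (left x a≤x (below-m x r) near)

      beyond : Q a b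
      beyond with ≤-or-> (m + δ) b
      ... | inj₂ b<m+δ = Q-trans Qam (right b (least-m b λ x r → proj₁ (proj₂ r)) b<m+δ)
      ... | inj₁ m+δ≤b = contradiction (below-m (m + h) stepped) (<⇒≱ (shift-< 0<h))
        where
        h = half δ
        0<h : 0# < h
        0<h = half-pos 0<δ
        h<δ : m + h < m + δ
        h<δ = <-by 0<h (trans (+-assoc _ _ _) (+-congˡ (half+half δ)))
        stepped : Reachable (m + h)
        stepped = ≤-trans (below-m a a-reachable) (proj₁ (shift-< 0<h)) , ≤-trans (proj₁ h<δ) m+δ≤b ,
          Q-trans Qam (right (m + h) (proj₁ (shift-< 0<h)) h<δ)

    conclude : Q a b
    conclude with complete Reachable (a , a-reachable) (b , λ x r → proj₁ (proj₂ r))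
    ... | m , isSup = finish m isSup

  -- The radius `f t / (abs v + ϵ)` keeps the whole increment of `f` below `f t`. The resulting
  -- bound by twice `f t` controls the second-order term in `shrinks-near`.
  derivative-near : ∀ {f t v ϵ} → HasDerivative f t v → 0# < ϵ → 0# < f t →
    ∃ λ δ → 0# < δ × (∀ s → 0# ≤ s → abs (s - t) < δ →
      abs ((f s - f t) - v * (s - t)) ≤ ϵ * abs (s - t) × f s ≤ f t + f t)
  derivative-near {f} {t} {v} {ϵ} der 0<ϵ 0<a with der ϵ 0<ϵ
  ... | δ₁ , 0<δ₁ , approx with min₂ δ₁ (f t / (abs v + ϵ))
  ...   | δ , δ≤₁ , δ≤₂ , pos = δ , pos 0<δ₁ (*-pos 0<a (⁻¹-pos 0<M)) , near
    where
    M = abs v + ϵ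
    0<M : 0# < M
    0<M = <-respʳ (+-comm _ _) (+-pos 0<ϵ (abs-nonneg v))
    near : ∀ s → 0# ≤ s → abs (s - t) < δ →
      abs ((f s - f t) - v * (s - t)) ≤ ϵ * abs (s - t) × f s ≤ f t + f t
    near s 0≤s k<δ = close , (begin
      f s                              ≤⟨ ≤-respˡ (solve 2 (λ a b → a :- b :+ b := a) refl (f s) (f t)) (+-monoˡ-≤ (f t) (abs≤⇒≤ close)) ⟩
      v * k + ϵ * abs k + f t          ≤⟨ +-monoˡ-≤ (f t) (+-monoˡ-≤ (ϵ * abs k) (*≤abs* v (x≤abs k) (-x≤abs k))) ⟩
      abs v * abs k + ϵ * abs k + f t  ≈⟨ +-congʳ (distribʳ (abs k) (abs v) ϵ) ⟨
      M * abs k + f t                  ≤⟨ +-monoˡ-≤ (f t) Mk≤ ⟩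
      f t + f t                        ∎)
      where
      k = s - t
      close = approx s 0≤s (<-≤-trans k<δ δ≤₁)
      Mk≤ : M * abs k ≤ f t
      Mk≤ = ≤-respʳ (trans (*-comm _ _) (/-*-cancel 0<M))
        (*-mono-nonneg (proj₁ 0<M) (≤-trans (proj₁ k<δ) δ≤₂))

  module Decay (f g : ℝ → ℝ) (η : ℝ) (0<η : 0# < η) where

    -- From s to t the quotient f / g shrinks at least by the factor 1 + η (t - s).
    Shrinks : ℝ → ℝ → Set
    Shrinks s t = (0# ≤ s × s ≤ t) × 0# < f s × 0# < g s × 0# < f t × 0# < g t ×
      f t * g s * (1# + η * (t - s)) ≤ f s * g t

    -- The two inequalities are multiplied and `f y * g y` is cancelled. The factors combine because
    -- (1 + u)(1 + v) ≥ 1 + u + v for nonnegative u and v.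
    shrinks-trans : ∀ {x y z} → Shrinks x y → Shrinks y z → Shrinks x z
    shrinks-trans {x} {y} {z} ((0≤x , x≤y) , fx , gx , fy , gy , p) ((_ , y≤z) , _ , _ , fz , gz , q) =
      (0≤x , ≤-trans x≤y y≤z) , fx , gx , fz , gz , *-cancelʳ-≤ (*-pos fy gy) (begin
        f z * g x * (1# + η * (z - x)) * (f y * g y)
          ≤⟨ *-mono-nonnegʳ (proj₁ (*-pos fy gy)) (*-mono-nonneg (proj₁ (*-pos fz gx)) factors) ⟩
        f z * g x * (A * B) * (f y * g y)
          ≈⟨ *-solve 6 (λ a b c d e f → ((a ⊕ b) ⊕ (c ⊕ d)) ⊕ (e ⊕ f) ⊜ ((a ⊕ f) ⊕ d) ⊕ ((e ⊕ b) ⊕ c)) refl (f z) (g x) A B (f y) (g y) ⟩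
        (f z * g y * B) * (f y * g x * A)
          ≤⟨ *-mono-nonnegʳ (*-nonneg (proj₁ (*-pos fy gx)) 0≤A) q ⟩
        (f y * g z) * (f y * g x * A)
          ≤⟨ *-mono-nonneg (proj₁ (*-pos fy gz)) p ⟩
        (f y * g z) * (f x * g y)
          ≈⟨ solve 4 (λ a b c d → (a :* b) :* (c :* d) := c :* b :* (a :* d)) refl (f y) (g z) (f x) (g y) ⟩
        f x * g z * (f y * g y) ∎)
      where
      A = 1# + η * (y - x)
      B = 1# + η * (z - y)
      0≤y-x = *-nonneg (proj₁ 0<η) (0≤b-a x≤y)
      0≤z-y = *-nonneg (proj₁ 0<η) (0≤b-a y≤z)
      0≤A : 0# ≤ A
      0≤A = +-nonneg (proj₁ 0<1) 0≤y-x
      factors : 1# + η * (z - x) ≤ A * B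
      factors = ≤-by (*-nonneg 0≤y-x 0≤z-y) (begin-equality
        1# + η * (z - x) + u * v        ≈⟨ +-congʳ (+-congˡ (solve 4 (λ h x y z → h :* (z :- x) := h :* (y :- x) :+ h :* (z :- y)) refl η x y z)) ⟩
        1# + (u + v) + u * v            ≈⟨ solve 2 (λ p q → con ℤ.1ℤ :+ (p :+ q) :+ p :* q := (con ℤ.1ℤ :+ p) :* (con ℤ.1ℤ :+ q)) refl u v ⟩
        A * B                           ∎)
        where
        u = η * (y - x)
        v = η * (z - y)

    four : ℝ → ℝ
    four x = (x + x) + (x + x)

    -- The last hypothesis says that log g - log f has derivative at least 4η at `t`. Of the four
    -- units `c * k`, two pay for the linearisation errors of `f` and `g`, and two for the term with
    -- the factor `η * k`, where `f s` or `g s` is at most doubled.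
    shrinks-near : ∀ {t vf vg} → 0# ≤ t → (∀ s → 0# ≤ s → 0# < f s) → (∀ s → 0# ≤ s → 0# < g s) →
      HasDerivative f t vf → HasDerivative g t vg →
      four (η * (f t * g t)) ≤ f t * vg - g t * vf →
      ∃ λ δ → 0# < δ × (∀ s → t ≤ s → s < t + δ → Shrinks t s) ×
        (∀ s → 0# ≤ s → s ≤ t → t - δ < s → Shrinks s t)
    shrinks-near {t} {vf} {vg} 0≤t f>0 g>0 f′ g′ gap =
      combine (derivative-near f′ (*-pos 0<η 0<a) 0<a) (derivative-near g′ (*-pos 0<η 0<b) 0<b)
      where
      a = f t
      b = g t
      W = a * vg - b * vf
      0<a : 0# < a
      0<a = f>0 t 0≤t
      0<b : 0# < b
      0<b = g>0 t 0≤t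
      c = η * (a * b)
      E F : ℝ → ℝ
      E s = (f s - a) - vf * (s - t)
      F s = (g s - b) - vg * (s - t)

      error : ∀ s k → abs (E s) ≤ (η * a) * k → abs (F s) ≤ (η * b) * k →
              E s * b - a * F s ≤ c * k + c * k × - (E s * b - a * F s) ≤ c * k + c * k
      error s k e≤ f≤ =
        ≤-respʳ (solve 4 (λ h a b k → (h :* a) :* k :* b :+ a :* ((h :* b) :* k) := h :* (a :* b) :* k :+ h :* (a :* b) :* k) refl η a b k)
          (≤-respˡ (solve 4 (λ e b a f → e :* b :+ a :* :- f := e :* b :- a :* f) refl (E s) b a (F s))
            (+-mono-≤ (*-mono-nonnegʳ (proj₁ 0<b) (≤-trans (x≤abs _) e≤)) (*-mono-nonneg (proj₁ 0<a) (≤-trans (-x≤abs _) f≤)))) ,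
        ≤-respʳ (solve 4 (λ h a b k → (h :* a) :* k :* b :+ a :* ((h :* b) :* k) := h :* (a :* b) :* k :+ h :* (a :* b) :* k) refl η a b k)
          (≤-respˡ (solve 4 (λ e b a f → :- e :* b :+ a :* f := :- (e :* b :- a :* f)) refl (E s) b a (F s))
            (+-mono-≤ (*-mono-nonnegʳ (proj₁ 0<b) (≤-trans (-x≤abs _) e≤)) (*-mono-nonneg (proj₁ 0<a) (≤-trans (x≤abs _) f≤))))

      linearised : ∀ s → E s * b - a * F s + (a * g s - W * (s - t)) ≈ f s * b
      linearised s = begin-equality
        E s * b - a * F s + (a * g s - W * k)
          ≈⟨ +-congˡ (+-congˡ (-‿cong (solve 5 (λ a b u v k → (a :* v :- b :* u) :* k := a :* (v :* k) :- b :* (u :* k)) refl a b vf vg k))) ⟩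
        E s * b - a * F s + (a * g s - (a * (vg * k) - b * (vf * k)))
          ≈⟨ solve 6 (λ a b p q f g → (f :- a :- p) :* b :- a :* (g :- b :- q) :+ (a :* g :- (a :* q :- b :* p)) := f :* b)
               refl a b (vf * k) (vg * k) (f s) (g s) ⟩
        f s * b ∎
        where
        k = s - t

      balance : ∀ {k y z} → y ≈ c * k + c * k → c * k + c * k + y + (z - four c * k) ≈ z
      balance {k} {y} {z} eq = trans (+-congʳ (+-congˡ eq))
        (solve 3 (λ c k z → c :* k :+ c :* k :+ (c :* k :+ c :* k) :+ (z :- ((c :+ c) :+ (c :+ c)) :* k) := z) refl c k z)

      Near : (ℝ → ℝ) → ℝ → Set
      Near h v = ∃ λ δ → 0# < δ × (∀ s → 0# ≤ s → abs (s - t) < δ →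
        abs ((h s - h t) - v * (s - t)) ≤ (η * h t) * abs (s - t) × h s ≤ h t + h t)

      combine : Near f vf → Near g vg → ∃ λ δ → 0# < δ × (∀ s → t ≤ s → s < t + δ → Shrinks t s) ×
        (∀ s → 0# ≤ s → s ≤ t → t - δ < s → Shrinks s t)
      combine (δf , 0<δf , near-f) (δg , 0<δg , near-g) with min₂ δf δg
      ... | δ , δ≤f , δ≤g , pos = δ , pos 0<δf 0<δg , right , left
        where
        right : ∀ s → t ≤ s → s < t + δ → Shrinks t s
        right s t≤s s<t+δ = (0≤t , t≤s) , 0<a , 0<b , f>0 s 0≤s , g>0 s 0≤s , (begin
          f s * b * (1# + η * k)
            ≈⟨ solve 4 (λ f b h k → f :* b :* (con ℤ.1ℤ :+ h :* k) := f :* b :+ h :* k :* b :* f) refl (f s) b η k ⟩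
          f s * b + η * k * b * f s
            ≈⟨ +-congʳ (linearised s) ⟨
          E s * b - a * F s + (a * g s - W * k) + η * k * b * f s
            ≈⟨ solve 3 (λ x y z → x :+ y :+ z := x :+ z :+ y) refl (E s * b - a * F s) (a * g s - W * k) (η * k * b * f s) ⟩
          E s * b - a * F s + η * k * b * f s + (a * g s - W * k)
            ≤⟨ +-mono-≤ (+-mono-≤ (proj₁ (error s k fst-f fst-g)) (*-mono-nonneg (*-nonneg (*-nonneg (proj₁ 0<η) 0≤k) (proj₁ 0<b)) (proj₂ nf)))
                 (+-monoʳ-≤ (a * g s) (-‿anti-≤ (*-mono-nonnegʳ 0≤k gap))) ⟩
          c * k + c * k + η * k * b * (a + a) + (a * g s - four c * k)
            ≈⟨ balance (solve 4 (λ h a b k → h :* k :* b :* (a :+ a) := h :* (a :* b) :* k :+ h :* (a :* b) :* k) refl η a b k) ⟩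
          a * g s ∎)
          where
          k = s - t
          0≤s = ≤-trans 0≤t t≤s
          0≤k = 0≤b-a t≤s
          k<δ : k < δ
          k<δ = <-by (0<b-a s<t+δ) (solve 3 (λ s t d → s :- t :+ (t :+ d :- s) := d) refl s t δ)
          ∣k∣<δ : abs k < δ
          ∣k∣<δ = ≤-<-trans (abs-of-nonneg 0≤k) k<δ
          nf = near-f s 0≤s (<-≤-trans ∣k∣<δ δ≤f)
          ng = near-g s 0≤s (<-≤-trans ∣k∣<δ δ≤g)
          fst-f = ≤-trans (proj₁ nf) (*-mono-nonneg (proj₁ (*-pos 0<η 0<a)) (abs-of-nonneg 0≤k))
          fst-g = ≤-trans (proj₁ ng) (*-mono-nonneg (proj₁ (*-pos 0<η 0<b)) (abs-of-nonneg 0≤k))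

        -- The same budget backwards in time: `linearised` is solved for `a * g s`, and the error
        -- enters with the opposite sign.
        left : ∀ s → 0# ≤ s → s ≤ t → t - δ < s → Shrinks s t
        left s 0≤s s≤t t-δ<s = (0≤s , s≤t) , f>0 s 0≤s , g>0 s 0≤s , 0<a , 0<b , (begin
          a * g s * (1# + η * k)
            ≈⟨ solve 4 (λ a g h k → a :* g :* (con ℤ.1ℤ :+ h :* k) := a :* g :+ h :* k :* a :* g) refl a (g s) η k ⟩
          a * g s + η * k * a * g s
            ≈⟨ +-congʳ (begin-equality
                 - X + (f s * b - W * k)                      ≈⟨ +-congˡ (+-congʳ (linearised s)) ⟨
                 - X + (X + (a * g s - W * (s - t)) - W * k)  ≈⟨ solve 5 (λ x y w s t → :- x :+ (x :+ (y :- w :* (s :- t)) :- w :* (t :- s)) := y) refl X (a * g s) W s t ⟩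
                 a * g s                                      ∎) ⟨
          - X + (f s * b - W * k) + η * k * a * g s
            ≈⟨ solve 3 (λ x y z → x :+ y :+ z := x :+ z :+ y) refl (- X) (f s * b - W * k) (η * k * a * g s) ⟩
          - (E s * b - a * F s) + η * k * a * g s + (f s * b - W * k)
            ≤⟨ +-mono-≤ (+-mono-≤ (proj₂ (error s k fst-f fst-g)) (*-mono-nonneg (*-nonneg (*-nonneg (proj₁ 0<η) 0≤k) (proj₁ 0<a)) (proj₂ ng)))
                 (+-monoʳ-≤ (f s * b) (-‿anti-≤ (*-mono-nonnegʳ 0≤k gap))) ⟩
          c * k + c * k + η * k * a * (b + b) + (f s * b - four c * k)
            ≈⟨ balance (solve 4 (λ h a b k → h :* k :* a :* (b :+ b) := h :* (a :* b) :* k :+ h :* (a :* b) :* k) refl η a b k) ⟩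
          f s * b ∎)
          where
          k = t - s
          X = E s * b - a * F s
          0≤k = 0≤b-a s≤t
          k<δ : k < δ
          k<δ = <-by (0<b-a t-δ<s) (solve 3 (λ s t d → t :- s :+ (s :- (t :- d)) := d) refl s t δ)
          ∣s-t∣≤k : abs (s - t) ≤ k
          ∣s-t∣≤k = abs≤ (≤-trans (≤-by 0≤k (solve 2 (λ s t → s :- t :+ (t :- s) := con ℤ.0ℤ) refl s t)) 0≤k)
            (≤-reflexive (solve 2 (λ s t → :- (s :- t) := t :- s) refl s t))
          nf = near-f s 0≤s (<-≤-trans (≤-<-trans ∣s-t∣≤k k<δ) δ≤f)
          ng = near-g s 0≤s (<-≤-trans (≤-<-trans ∣s-t∣≤k k<δ) δ≤g)
          fst-f = ≤-trans (proj₁ nf) (*-mono-nonneg (proj₁ (*-pos 0<η 0<a)) ∣s-t∣≤k)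
          fst-g = ≤-trans (proj₁ ng) (*-mono-nonneg (proj₁ (*-pos 0<η 0<b)) ∣s-t∣≤k)

    -- Over the whole interval from `t₀` the quotient shrinks by 1 + η(t - t₀), which is unbounded.
    -- The waiting time `M` is the time after which η(t - t₀) alone brings the initial quotient
    -- below ϵ.
    quotient-vanishes : ∀ t₀ → 0# ≤ t₀ → (∀ s → 0# ≤ s → 0# < f s) → (∀ s → 0# ≤ s → 0# < g s) →
      (vf vg : ℝ → ℝ) →
      (∀ t → 0# ≤ t → HasDerivative f t (vf t)) → (∀ t → 0# ≤ t → HasDerivative g t (vg t)) →
      (∀ t → t₀ ≤ t → four (η * (f t * g t)) ≤ f t * vg t - g t * vf t) →
      ∀ ϵ → 0# < ϵ → ∃ λ t₁ → 0# ≤ t₁ × (∀ t → t₁ ≤ t → f t ≤ ϵ * g t)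
    quotient-vanishes t₀ 0≤t₀ f>0 g>0 vf vg f′ g′ gap ϵ 0<ϵ = t₀ + M , +-nonneg 0≤t₀ 0≤M , bound
      where
      b = g t₀
      0<b = g>0 t₀ 0≤t₀
      0<N : 0# < ϵ * b * η
      0<N = *-pos (*-pos 0<ϵ 0<b) 0<η
      M = f t₀ / (ϵ * b * η)
      0≤M : 0# ≤ M
      0≤M = proj₁ (*-pos (f>0 t₀ 0≤t₀) (⁻¹-pos 0<N))
      bound : ∀ t → t₀ + M ≤ t → f t ≤ ϵ * g t
      bound t t₁≤t = *-cancelʳ-≤ (*-pos 0<b 0<L) (begin
        f t * (b * (1# + η * k))      ≈⟨ *-assoc _ _ _ ⟨
        f t * b * (1# + η * k)        ≤⟨ proj₂ (proj₂ (proj₂ (proj₂ (proj₂ shrunk)))) ⟩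
        f t₀ * g t                    ≈⟨ *-congʳ (/-*-cancel 0<N) ⟨
        M * (ϵ * b * η) * g t         ≤⟨ *-mono-nonnegʳ (proj₁ 0<gt) (*-mono-nonnegʳ (proj₁ 0<N) M≤k) ⟩
        k * (ϵ * b * η) * g t         ≤⟨ ≤-by (proj₁ (*-pos (*-pos 0<ϵ 0<b) 0<gt)) (solve 5 (λ k e b h g →
                                           k :* (e :* b :* h) :* g :+ e :* b :* g := e :* g :* (b :* (con ℤ.1ℤ :+ h :* k))) refl k ϵ b η (g t)) ⟩
        ϵ * g t * (b * (1# + η * k))  ∎)
        where
        k = t - t₀
        M≤k : M ≤ k
        M≤k = ≤-by (0≤b-a t₁≤t) (solve 3 (λ m t s → m :+ (t :- (s :+ m)) := t :- s) refl M t t₀)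
        t₀≤t : t₀ ≤ t
        t₀≤t = ≤-trans (≤-by 0≤M refl) t₁≤t
        0<gt = g>0 t (≤-trans 0≤t₀ t₀≤t)
        0<L : 0# < 1# + η * k
        0<L = +-pos 0<1 (*-nonneg (proj₁ 0<η) (0≤b-a t₀≤t))
        shrunk : Shrinks t₀ t
        shrunk = chain Shrinks t₀≤t shrinks-trans local
          where
          local : ∀ u → t₀ ≤ u → u ≤ t → ∃ λ δ → 0# < δ ×
            (∀ s → u ≤ s → s < u + δ → Shrinks u s) × (∀ s → t₀ ≤ s → s ≤ u → u - δ < s → Shrinks s u)
          local u t₀≤u _ = from-zero (shrinks-near 0≤u f>0 g>0 (f′ u 0≤u) (g′ u 0≤u) (gap u t₀≤u))
            where
            0≤u : 0# ≤ u
            0≤u = ≤-trans 0≤t₀ t₀≤u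
            from-zero : (∃ λ δ → 0# < δ × (∀ s → u ≤ s → s < u + δ → Shrinks u s) ×
                          (∀ s → 0# ≤ s → s ≤ u → u - δ < s → Shrinks s u)) → _
            from-zero (δ , 0<δ , right , left) = δ , 0<δ , right , λ s t₀≤s → left s (≤-trans 0≤t₀ t₀≤s)

  lim-+ : ∀ {f g L M} → LimitAtInfinity f L → LimitAtInfinity g M →
          LimitAtInfinity (λ t → f t + g t) (L + M)
  lim-+ {f} {g} {L} {M} limf limg ϵ 0<ϵ =
    combine (limf (half ϵ) (half-pos 0<ϵ)) (limg (half ϵ) (half-pos 0<ϵ))
    where
    add : ∀ {a b c d} → a ≤ c + half ϵ → b ≤ d + half ϵ → a + b ≤ c + d + ϵ
    add {a} {b} {c} {d} p q = begin
      a + b                             ≤⟨ +-mono-≤ p q ⟩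
      (c + half ϵ) + (d + half ϵ)       ≈⟨ solve 3 (λ c d h → (c :+ h) :+ (d :+ h) := c :+ d :+ (h :+ h)) refl c d (half ϵ) ⟩
      c + d + (half ϵ + half ϵ)         ≈⟨ +-congˡ (half+half ϵ) ⟩
      c + d + ϵ                         ∎
    combine : (∃ λ t₀ → ∀ t → t₀ ≤ t → abs (f t - L) ≤ half ϵ) →
              (∃ λ t₀ → ∀ t → t₀ ≤ t → abs (g t - M) ≤ half ϵ) →
              ∃ λ t₀ → ∀ t → t₀ ≤ t → abs (f t + g t - (L + M)) ≤ ϵ
    combine (t₁ , near₁) (t₂ , near₂) with max₂ t₁ t₂
    ... | t₀ , t₁≤ , t₂≤ = t₀ , λ t t₀≤t →
      let p = near₁ t (≤-trans t₁≤ t₀≤t) ; q = near₂ t (≤-trans t₂≤ t₀≤t) in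
      ≤⇒abs≤ (add (abs≤⇒≤ p) (abs≤⇒≤ q)) (add (abs≤⇒≥ p) (abs≤⇒≥ q))

  lim-eventually : ∀ {f g L} t₀ → (∀ t → t₀ ≤ t → g t ≈ f t) → LimitAtInfinity f L → LimitAtInfinity g L
  lim-eventually t₀ eq lim ϵ 0<ϵ with lim ϵ 0<ϵ
  ... | t₁ , near with max₂ t₀ t₁
  ...   | t₂ , t₀≤ , t₁≤ = t₂ , λ t t₂≤t →
    let e = eq t (≤-trans t₀≤ t₂≤t) ; p = near t (≤-trans t₁≤ t₂≤t) in
    ≤⇒abs≤ (≤-respˡ (sym e) (abs≤⇒≤ p)) (≤-respʳ (+-congʳ (sym e)) (abs≤⇒≥ p))

  lim-const : ∀ {c L} → c ≈ L → LimitAtInfinity (λ _ → c) L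
  lim-const {c} c≈L ϵ 0<ϵ = 0# , λ _ _ → ≤⇒abs≤ (≤-by (proj₁ 0<ϵ) (+-congʳ c≈L)) (≤-by (proj₁ 0<ϵ) (+-congʳ (sym c≈L)))

  lim-sum : ∀ {n} (f : Fin n → ℝ → ℝ) (L : Fin n → ℝ) → (∀ i → LimitAtInfinity (f i) (L i)) →
            LimitAtInfinity (λ t → sum (λ i → f i t)) (sum L)
  lim-sum {ℕ.zero} f L lim = lim-const refl
  lim-sum {suc n}  f L lim = lim-+ {f zero} {λ t → sum (λ i → f (suc i) t)} (lim zero)
    (lim-sum (λ i → f (suc i)) (λ i → L (suc i)) (λ i → lim (suc i)))

  lim-cong : ∀ {f L M} → L ≈ M → LimitAtInfinity f L → LimitAtInfinity f M
  lim-cong {f} {L} {M} L≈M lim ϵ 0<ϵ = transport (lim ϵ 0<ϵ)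
    where
    transport : (∃ λ t₀ → ∀ t → t₀ ≤ t → abs (f t - L) ≤ ϵ) → ∃ λ t₀ → ∀ t → t₀ ≤ t → abs (f t - M) ≤ ϵ
    transport (t₀ , near) = t₀ , λ t t₀≤t → ≤⇒abs≤ (≤-respʳ (+-congʳ L≈M) (abs≤⇒≤ (near t t₀≤t)))
      (≤-respˡ L≈M (abs≤⇒≥ (near t t₀≤t)))

  lim-if : ∀ {P : Set} (d : Dec P) {f L} → (P → LimitAtInfinity f L) →
           LimitAtInfinity (λ t → if does d then f t else 0#) (if does d then L else 0#)
  lim-if (yes p) lim = lim p
  lim-if (no _)  lim = lim-const refl

  lim-*ˡ-0 : ∀ {f} c → LimitAtInfinity f 0# → LimitAtInfinity (λ t → c * f t) 0#
  lim-*ˡ-0 {f} c lim ϵ 0<ϵ = proj₁ small , λ t t₀≤t →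
    let p = proj₂ small t t₀≤t in
    abs≤ (scaled (≤-trans (x≤abs _) p) (≤-trans (-x≤abs _) p)
           (solve 2 (λ c z → c :* (z :- con ℤ.0ℤ) := c :* z :- con ℤ.0ℤ) refl c (f t)))
         (scaled (≤-trans (-x≤abs _) p) (≤-trans (≤-reflexive (solve 1 (λ z → :- :- z := z) refl _)) (≤-trans (x≤abs _) p))
           (solve 2 (λ c z → c :* :- (z :- con ℤ.0ℤ) := :- (c :* z :- con ℤ.0ℤ)) refl c (f t)))
    where
    -- The added 1 keeps the divisor positive when `c` is 0.
    M = abs c + 1#
    0<M : 0# < M
    0<M = <-respʳ (+-comm _ _) (+-pos 0<1 (abs-nonneg c))
    0<e : 0# < ϵ / M
    0<e = *-pos 0<ϵ (⁻¹-pos 0<M)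
    small = lim (ϵ / M) 0<e
    scaled : ∀ {z y} → z ≤ ϵ / M → - z ≤ ϵ / M → c * z ≈ y → y ≤ ϵ
    scaled {z} {y} p q eq = begin
      y                    ≈⟨ eq ⟨
      c * z                ≤⟨ *≤abs* c p q ⟩
      abs c * (ϵ / M)      ≤⟨ ≤-by (proj₁ 0<e) (solve 2 (λ c e → c :* e :+ e := e :* (c :+ con ℤ.1ℤ)) refl (abs c) (ϵ / M)) ⟩
      ϵ / M * M            ≈⟨ /-*-cancel 0<M ⟩
      ϵ                    ∎

  lim-≤ : ∀ {f L b} t₀ → (∀ t → t₀ ≤ t → f t ≤ b) → LimitAtInfinity f L → L ≤ b
  lim-≤ {b = b} t₀ f≤b lim = ≤-+ϵ λ ϵ 0<ϵ → step ϵ (lim ϵ 0<ϵ)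
    where
    step : ∀ ϵ → _ → _ ≤ b + ϵ
    step ϵ (t₁ , near) with max₂ t₀ t₁
    ... | t , t₀≤t , t₁≤t = ≤-trans (abs≤⇒≥ (near t t₁≤t)) (+-monoˡ-≤ ϵ (f≤b t t₀≤t))

  lim-unique : ∀ {f L M} → LimitAtInfinity f L → LimitAtInfinity f M → L ≈ M
  lim-unique {f} limL limM = ≤-antisym (half-unique limL limM) (half-unique limM limL)
    where
    half-unique : ∀ {L M} → LimitAtInfinity f L → LimitAtInfinity f M → L ≤ M
    half-unique {L} {M} limL limM = ≤-+ϵ λ ϵ 0<ϵ → ≤-respʳ (trans (+-assoc M _ _) (+-congˡ (half+half ϵ)))
      (step (half ϵ) (limM (half ϵ) (half-pos 0<ϵ)) (half-pos 0<ϵ))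
      where
      step : ∀ h → (∃ λ t₀ → ∀ t → t₀ ≤ t → abs (f t - M) ≤ h) → 0# < h → L ≤ M + h + h
      step h (t₀ , near) 0<h = ≤-respˡ refl (lim-≤ t₀ (λ t t₀≤t → ≤-trans (abs≤⇒≤ (near t t₀≤t)) (≤-by (proj₁ 0<h) refl)) limL)

-- The limiting curvature: membership in the base and tight lower sets.

module FlowLimit (em : ExcludedMiddle 0ℓ) (R : CompleteOrderedField) (T : Graph) (isTree : IsTree T)
                 (e₀ : Graph.Edge T) where
  open RicciFlow em R T hiding (sum)
  open OrderedField em R
  open RingSolver R using (solve; _:+_; _:*_; _:-_; :-_; _:=_; con)
  open ≤-Reasoning
  open Walks T
  open NeighbourMeasure em R T isTree
  open SetFunctions em R T isTree e₀
  open Analysis em R T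

  -- The common features of the two flows: only the relative growth of two
  -- edges matters, and it is the same for both.
  record RelativeFlow (w : ℝ → Metric) (κ : ℝ → Edge → ℝ) : Set where
    field
      positive    : ∀ t → 0# ≤ t → IsPositive (w t)
      isCurvature : ∀ t → 0# ≤ t → ∀ e → IsCurvature (w t) e (κ t e)
      velocity    : ℝ → Edge → ℝ
      derivative  : ∀ e t → 0# ≤ t → HasDerivative (λ s → w s e) t (velocity t e)
      relative    : ∀ t e f → w t f * velocity t e - w t e * velocity t f ≈
                              (w t e * w t f) * (κ t f - κ t e)

  relativeFlow : ∀ {w κ} → UnnormalizedFlow w κ ⊎ NormalizedFlow w κ → RelativeFlow w κ
  relativeFlow {w} {κ} (inj₁ flow) = record
    { positive = IsFlow.positive flow ; isCurvature = IsFlow.isCurvature flow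
    ; velocity = λ t e → - (κ t e * w t e)
    ; derivative = λ e t 0≤t → IsFlow.evolution flow t 0≤t e
    ; relative = λ t e f → solve 4 (λ a b k l → b :* :- (k :* a) :- a :* :- (l :* b) := (a :* b) :* (l :- k))
        refl (w t e) (w t f) (κ t e) (κ t f) }
  -- The normalising term is the same for all edges and cancels in `relative`.
  relativeFlow {w} {κ} (inj₂ (flow , _)) = record
    { positive = IsFlow.positive flow ; isCurvature = IsFlow.isCurvature flow
    ; velocity = λ t e → - (w t e * (κ t e - sum (λ f → w t f * κ t f)))
    ; derivative = λ e t 0≤t → IsFlow.evolution flow t 0≤t e
    ; relative = λ t e f → solve 5 (λ a b k l m → b :* :- (a :* (k :- m)) :- a :* :- (b :* (l :- m)) := (a :* b) :* (l :- k))
        refl (w t e) (w t f) (κ t e) (κ t f) (sum (λ f → w t f * κ t f)) }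

  module Limits {w κ} (flow : RelativeFlow w κ) {c : Edge → ℝ}
                (κ→c : ∀ e → LimitAtInfinity (λ t → κ t e) (c e)) where
    open RelativeFlow flow

    ratio-vanishes : ∀ {e f} → c e < c f → ∀ ϵ → 0# < ϵ →
                     ∃ λ t₁ → 0# ≤ t₁ × (∀ t → t₁ ≤ t → w t f ≤ ϵ * w t e)
    ratio-vanishes {e} {f} ce<cf ϵ 0<ϵ = conclude (κ→c e h 0<h) (κ→c f h 0<h)
      where
      -- With `h` = d/4 as tolerance for both curvatures, their difference is eventually at least d
      -- - 2h = d/2. This is four times `η` = d/8, as `Decay` requires.
      d = c f - c e
      h = half (half d)
      η = half h
      0<h : 0# < h
      0<h = half-pos (half-pos (0<b-a ce<cf))
      0<η : 0# < η
      0<η = half-pos 0<h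
      open Decay (λ t → w t f) (λ t → w t e) η 0<η
      gap : ∀ t → abs (κ t e - c e) ≤ h → abs (κ t f - c f) ≤ h → four η ≤ κ t f - κ t e
      gap t close-e close-f = begin
        four η                    ≈⟨ trans (+-cong (half+half h) (half+half h)) (solve 1 (λ h → h :+ h := (h :+ h) :+ (h :+ h) :- h :- h) refl h) ⟩
        (h + h) + (h + h) - h - h ≈⟨ +-congʳ (+-congʳ (trans (+-cong (half+half (half d)) (half+half (half d))) (half+half d))) ⟩
        d - h - h                 ≤⟨ ≤-by (+-nonneg (0≤b-a (abs≤⇒≤ close-e)) (0≤b-a (abs≤⇒≥ close-f)))
                                       (solve 5 (λ ce cf ke kf h → cf :- ce :- h :- h :+ ((ce :+ h :- ke) :+ (kf :+ h :- cf)) := kf :- ke)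
                                         refl (c e) (c f) (κ t e) (κ t f) h) ⟩
        κ t f - κ t e             ∎
      conclude : (∃ λ t₀ → ∀ t → t₀ ≤ t → abs (κ t e - c e) ≤ h) →
                 (∃ λ t₀ → ∀ t → t₀ ≤ t → abs (κ t f - c f) ≤ h) →
                 ∃ λ t₁ → 0# ≤ t₁ × (∀ t → t₁ ≤ t → w t f ≤ ϵ * w t e)
      conclude (t₁ , close-e) (t₂ , close-f) with max₂ t₁ t₂
      ... | t₃ , t₁≤ , t₂≤ with max₂ 0# t₃
      ...   | t₀ , 0≤t₀ , t₃≤ = quotient-vanishes t₀ 0≤t₀
        (λ s 0≤s → positive s 0≤s f) (λ s 0≤s → positive s 0≤s e)
        (λ t → velocity t f) (λ t → velocity t e) (derivative f) (derivative e)
        (λ t t₀≤t → begin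
          four (η * (w t f * w t e))             ≈⟨ solve 3 (λ h a b → (h :* (a :* b) :+ h :* (a :* b)) :+ (h :* (a :* b) :+ h :* (a :* b)) := (b :* a) :* ((h :+ h) :+ (h :+ h))) refl η (w t f) (w t e) ⟩
          (w t e * w t f) * four η               ≤⟨ *-mono-nonneg (proj₁ (*-pos (positive t (≤-trans 0≤t₀ t₀≤t) e) (positive t (≤-trans 0≤t₀ t₀≤t) f)))
                                                      (gap t (close-e t (≤-trans t₁≤ (≤-trans t₃≤ t₀≤t))) (close-f t (≤-trans t₂≤ (≤-trans t₃≤ t₀≤t)))) ⟩
          (w t e * w t f) * (κ t f - κ t e)      ≈⟨ relative t e f ⟨
          w t f * velocity t e - w t e * velocity t f ∎)
        ϵ 0<ϵ

    -- Since `D` is at least the inverse weight of `f`, the share of `e` is at most w_f / w_e.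
    θ-vanishes : ∀ {x e f} → Incident x e → Incident x f → c e < c f →
                 LimitAtInfinity (λ t → θ (w t) x e) 0#
    θ-vanishes {x} {e} {f} i j ce<cf ϵ 0<ϵ = conclude (ratio-vanishes ce<cf ϵ 0<ϵ)
      where
      conclude : (∃ λ t₁ → 0# ≤ t₁ × (∀ t → t₁ ≤ t → w t f ≤ ϵ * w t e)) →
                 ∃ λ t₀ → ∀ t → t₀ ≤ t → abs (θ (w t) x e - 0#) ≤ ϵ
      conclude (t₁ , 0≤t₁ , small) = t₁ , λ t t₁≤t →
        let w>0 = positive t (≤-trans 0≤t₁ t₁≤t)
            0<we = w>0 e
            0<wf = w>0 f
        in ≤⇒abs≤
          (≤-respʳ (sym (+-identityˡ ϵ)) (/-≤ (D-pos w>0 {x} {e} i) (≤-trans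
            (*-cancelʳ-≤ (*-pos 0<we 0<wf) (begin
              w t e ⁻¹ * (w t e * w t f)       ≈⟨ trans (sym (*-assoc _ _ _)) (trans (*-congʳ (inverseˡ 0<we)) (*-identityˡ _)) ⟩
              w t f                            ≤⟨ small t t₁≤t ⟩
              ϵ * w t e                        ≈⟨ *-congˡ (trans (*-congˡ (inverseˡ 0<wf)) (*-identityʳ _)) ⟨
              ϵ * (w t e * (w t f ⁻¹ * w t f)) ≈⟨ solve 4 (λ x a i b → x :* (a :* (i :* b)) := x :* i :* (a :* b)) refl ϵ (w t e) (w t f ⁻¹) (w t f) ⟩
              ϵ * w t f ⁻¹ * (w t e * w t f)   ∎))
            (*-mono-nonneg (proj₁ 0<ϵ) (weight≤D w>0 {x} {f} j)))))
          (+-nonneg (θ-nonneg w>0 {x} {e} i) (proj₁ 0<ϵ))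

    total-limit : ∀ A → LimitAtInfinity (λ t → total-over (κ t) A) (total-over c A)
    total-limit A = lim-sum (λ e t → if does (e ∈? A) then κ t e else 0#) (λ e → if does (e ∈? A) then c e else 0#)
      (λ e → lim-if (e ∈? A) {λ t → κ t e} (λ _ → κ→c e))

    limit-in-base : InBase c
    limit-in-base =
      (λ A → lim-≤ 0# (λ t 0≤t → curvature≤β (positive t 0≤t) (isCurvature t 0≤t) A) (total-limit A)) ,
      lim-unique (total-limit ⊤)
        (lim-eventually 0# (λ t 0≤t → curvature⊤ (positive t 0≤t) (isCurvature t 0≤t)) (lim-const refl))

    -- Some edge at `x` lies outside `A`. Its entry exceeds those of all edges of `A` at `x`, so
    -- this single edge drives all their shares to 0.
    share-vanishes : ∀ {A} → IsLower c A → ∀ x → ¬ star x ⊆ A → LimitAtInfinity (λ t → share (w t) x A) 0#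
    share-vanishes {A} lower x ¬⊆ = lim-cong (sum-0 {size} {λ _ → 0#} (λ _ → refl)) (lim-sum
        (λ e t → if does (incident? x e) then (if does (e ∈? A) then θ (w t) x e else 0#) else 0#) (λ _ → 0#)
        (λ e → lim-cong (if-const (does (incident? x e)))
          (lim-if (incident? x e) {λ t → if does (e ∈? A) then θ (w t) x e else 0#} (λ i →
            lim-cong (if-const (does (e ∈? A))) (lim-if (e ∈? A) {λ t → θ (w t) x e} (λ e∈A → vanish i e∈A))))))
      where
      escape : ∃ λ f → Incident x f × f ∉ A
      escape with em {∃ λ f → Incident x f × f ∉ A}
      ... | yes found = found
      ... | no none = contradiction (λ {f} f∈ → decide f (∈star⇒incident {x} f∈)) ¬⊆
        where
        decide : ∀ f → Incident x f → f ∈ A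
        decide f i with f ∈? A
        ... | yes f∈A = f∈A
        ... | no f∉A = contradiction (f , i , f∉A) none
      vanish : ∀ {e} → Incident x e → e ∈ A → LimitAtInfinity (λ t → θ (w t) x e) 0#
      vanish {e} i e∈A = θ-vanishes {x} {e} {proj₁ escape} i (proj₁ (proj₂ escape)) (lower e (proj₁ escape) e∈A (proj₂ (proj₂ escape)))

    -- The limit of κ(A) is computed twice: edge by edge it is c(A), and vertex by vertex the shares
    -- tend to 1 or 0 according to whether β counts the vertex.
    lower⇒tight : ∀ {A} → IsLower c A → β A ≈ total-over c A
    lower⇒tight {A} lower = lim-unique
      (lim-eventually 0# (λ t 0≤t → curvature≈shares (positive t 0≤t) (isCurvature t 0≤t) A)
        (lim-sum (λ x t → coeff x * share (w t) x A) (λ x → term x A) per-vertex))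
      (total-limit A)
      where
      per-vertex : ∀ x → LimitAtInfinity (λ t → coeff x * share (w t) x A) (term x A)
      per-vertex x with em {star x ⊆ A}
      ... | yes ⊆A = lim-eventually 0#
        (λ t 0≤t → trans (*-congˡ (share-full (positive t 0≤t) x ⊆A)) (*-identityʳ _)) (lim-const (sym (full x ⊆A)))
      ... | no ¬⊆A = lim-cong (sym (partial x ¬⊆A)) (lim-*ˡ-0 (coeff x) (share-vanishes lower x ¬⊆A))

-- Consequences for the recursion, the energy and the density.

module Optimum (em : ExcludedMiddle 0ℓ) (R : CompleteOrderedField) (T : Graph) (isTree : IsTree T)
               (e₀ : Graph.Edge T) where
  open RicciFlow em R T hiding (sum)
  open OrderedField em R
  open RingSolver R using (solve; _:+_; _:*_; _:-_; :-_; _:=_; con)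
  open ≤-Reasoning
  open NeighbourMeasure em R T isTree using (fromℕ2)
  open SetFunctions em R T isTree e₀

  ∈-subset⁺ : ∀ {P : Edge → Set} {e} → P e → e ∈ subset P
  ∈-subset⁺ {P} = ∈-tabulate⁺ (λ e → em {P e})

  ∈-subset⁻ : ∀ {P : Edge → Set} {e} → e ∈ subset P → P e
  ∈-subset⁻ {P} = ∈-tabulate⁻ (λ e → em {P e})

  argmin : ∀ {n} (P : Fin n → Set) (f : Fin n → ℝ) → ∃ P → ∃ λ i → P i × (∀ j → P j → f i ≤ f j)
  argmin {suc n} P f (k , Pk) with em {∃ λ i → P (suc i)}
  ... | no none = zero , head k Pk , λ { zero _ → ≤-refl ; (suc j) Pj → contradiction (j , Pj) none }
    where
    head : ∀ k → P k → P zero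
    head zero    p = p
    head (suc i) p = contradiction (i , p) none
  ... | yes some with argmin (P ∘ suc) (f ∘ suc) some | em {P zero}
  ...   | i , Pi , i≤ | no ¬P0 = suc i , Pi , λ { zero p → contradiction p ¬P0 ; (suc j) p → i≤ j p }
  ...   | i , Pi , i≤ | yes P0 with total (f zero) (f (suc i))
  ...     | inj₁ le = zero , P0 , λ { zero _ → ≤-refl ; (suc j) p → ≤-trans le (i≤ j p) }
  ...     | inj₂ ge = suc i , Pi , λ { zero _ → ge ; (suc j) p → i≤ j p }

  ∣∣≈sum : ∀ {n} (A : Subset n) → fromℕ ∣ A ∣ ≈ sum (λ i → if does (i ∈? A) then 1# else 0#)
  ∣∣≈sum []            = refl
  ∣∣≈sum (inside  ∷ A) = +-congˡ (∣∣≈sum A)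
  ∣∣≈sum (outside ∷ A) = trans (∣∣≈sum A) (sym (+-identityˡ _))

  total-const : ∀ a A → total-over (λ _ → a) A ≈ a * fromℕ ∣ A ∣
  total-const a A = sym (trans (*-congˡ (∣∣≈sum A)) (trans (*-distribˡ-sum a (λ e → if does (e ∈? A) then 1# else 0#))
    (sum-cong-≋ λ e → trans (if-*ˡ (does (e ∈? A)) a 1#) (if-cong (does (e ∈? A)) (*-identityʳ a) refl))))

  total-+ : ∀ y z A → total-over (λ e → y e + z e) A ≈ total-over y A + total-over z A
  total-+ y z A = trans (sum-cong-≋ (λ e → if-+ (does (e ∈? A)) (y e) (z e)))
    (∑-distrib-+ (λ e → if does (e ∈? A) then y e else 0#) (λ e → if does (e ∈? A) then z e else 0#))

  total-mono : ∀ {y z} A → (∀ e → e ∈ A → y e ≤ z e) → total-over y A ≤ total-over z A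
  total-mono {y} {z} A y≤z = sum-mono λ e → per-edge (e ∈? A) (y≤z e)
    where
    per-edge : ∀ {P : Set} (d : Dec P) {a b} → (P → a ≤ b) → (if does d then a else 0#) ≤ (if does d then b else 0#)
    per-edge (yes p) h = h p
    per-edge (no _)  h = ≤-refl

  total-cong : ∀ {y z} A → (∀ e → e ∈ A → y e ≈ z e) → total-over y A ≈ total-over z A
  total-cong A y≈z = sum-cong-≋ λ e → if-congᵈ (e ∈? A) (y≈z e)

  total-⊤ : ∀ z → total-over z ⊤ ≈ sum z
  total-⊤ z = sum-cong-≋ {size} {λ e → if does (e ∈? ⊤) then z e else 0#} {z} λ e → if-yes (e ∈? ⊤) ∈⊤

  total-modular : ∀ z X Y → total-over z (X ∪ Y) + total-over z (X ∩ Y) ≈ total-over z X + total-over z Y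
  total-modular z X Y = begin-equality
    total-over z (X ∪ Y) + total-over z (X ∩ Y)   ≈⟨ ∑-distrib-+ (t (X ∪ Y)) (t (X ∩ Y)) ⟨
    sum (λ e → t (X ∪ Y) e + t (X ∩ Y) e)         ≈⟨ sum-cong-≋ per-edge ⟩
    sum (λ e → t X e + t Y e)                     ≈⟨ ∑-distrib-+ (t X) (t Y) ⟩
    total-over z X + total-over z Y               ∎
    where
    t : Subset size → Edge → ℝ
    t A e = if does (e ∈? A) then z e else 0#
    on : ∀ {A e} → e ∈ A → t A e ≈ z e
    on {A} {e} = if-yes (e ∈? A)
    off : ∀ {A e} → e ∉ A → t A e ≈ 0#
    off {A} {e} = if-no (e ∈? A)
    per-edge : ∀ e → t (X ∪ Y) e + t (X ∩ Y) e ≈ t X e + t Y e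
    per-edge e = by (e ∈? X) (e ∈? Y)
      where
      by : Dec (e ∈ X) → Dec (e ∈ Y) → t (X ∪ Y) e + t (X ∩ Y) e ≈ t X e + t Y e
      by (yes p) (yes q) = +-cong (trans (on (p⊆p∪q Y p)) (sym (on p))) (trans (on (x∈p∩q⁺ (p , q))) (sym (on q)))
      by (yes p) (no ¬q) = +-cong (trans (on (p⊆p∪q Y p)) (sym (on p))) (trans (off (¬q ∘ p∩q⊆q X Y)) (sym (off ¬q)))
      by (no ¬p) (yes q) = trans (+-comm _ _) (+-cong (trans (off (¬p ∘ p∩q⊆p X Y)) (sym (off ¬p))) (trans (on (q⊆p∪q X Y q)) (sym (on q))))
      by (no ¬p) (no ¬q) = +-cong (trans (off λ r → neither (x∈p∪q⁻ X Y r)) (sym (off ¬p))) (trans (off (¬q ∘ p∩q⊆q X Y)) (sym (off ¬q)))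
        where
        neither : ¬ (e ∈ X ⊎ e ∈ Y)
        neither (inj₁ p) = ¬p p
        neither (inj₂ q) = ¬q q

  card-modular : ∀ X Y → fromℕ ∣ X ∪ Y ∣ + fromℕ ∣ X ∩ Y ∣ ≈ fromℕ ∣ X ∣ + fromℕ ∣ Y ∣
  card-modular X Y = trans (+-cong (∣∣≈sum (X ∪ Y)) (∣∣≈sum (X ∩ Y)))
    (trans (total-modular (λ _ → 1#) X Y) (sym (+-cong (∣∣≈sum X) (∣∣≈sum Y))))

  fromℕ-< : ∀ {m n} → m ℕ.< n → 0# < fromℕ n - fromℕ m
  fromℕ-< {ℕ.zero} {suc n} _ = <-respʳ (solve 1 (λ x → x := x :- con ℤ.0ℤ) refl (fromℕ (suc n))) (+-pos 0<1 (fromℕ-nonneg n))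
  fromℕ-< {suc m} {suc n} (s≤s m<n) = <-respʳ (solve 3 (λ o m n → n :- m := (o :+ n) :- (o :+ m)) refl 1# (fromℕ m) (fromℕ n)) (fromℕ-< m<n)

  card-gap : ∀ {S A : Subset size} → S ⊂ A → 0# < fromℕ (∣ A ∣) - fromℕ (∣ S ∣)
  card-gap S⊂A = fromℕ-< (p⊂q⇒∣p∣<∣q∣ S⊂A)

  card-pos : ∀ {A : Subset size} → Nonempty A → 0# < fromℕ ∣ A ∣
  card-pos {A} (e , e∈A) = <-respʳ (solve 1 (λ x → x :- con ℤ.0ℤ := x) refl (fromℕ ∣ A ∣)) (fromℕ-< (∣p∣>0 e∈A))

  module Tight {c : Edge → ℝ} (c∈B : InBase c) (tight : ∀ {A} → IsLower c A → β A ≈ total-over c A) where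

    sublevel-lower : ∀ a → IsLower c (subset (λ e → c e ≤ a))
    sublevel-lower a e f e∈ f∉ = ≤-<-trans (∈-subset⁻ e∈) (≰⇒> (f∉ ∘ ∈-subset⁺))

    ⊥-lower : IsLower c ⊥
    ⊥-lower e f e∈⊥ = contradiction e∈⊥ ∉⊥

    excess : ℝ → Subset size → Edge → ℝ
    excess a A e = if does (e ∈? A) then c e - a else 0#

    total-excess : ∀ a A → sum (excess a A) ≈ total-over c A - a * fromℕ ∣ A ∣
    total-excess a A = trans (total-+ c (λ _ → - a) A)
      (+-congˡ (trans (total-const (- a) A) (solve 2 (λ a n → :- a :* n := :- (a :* n)) refl a (fromℕ ∣ A ∣))))

    -- If S is a lower set of c and a the least entry outside S, then passing
    -- from S to A increases β by at least c(A) - c(S) ≥ a(|A| - |S|).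
    module Step {S : Subset size} (lower : IsLower c S) {a : ℝ} (a≤ : ∀ e → e ∉ S → a ≤ c e)
                (attained : ∃ λ e → e ∉ S × c e ≈ a) where

      L : Subset size
      L = subset (λ e → c e ≤ a)

      S⊆L : S ⊆ L
      S⊆L {e} e∈S = ∈-subset⁺ (≤-trans (proj₁ (lower e (proj₁ attained) e∈S (proj₁ (proj₂ attained)))) (≤-reflexive (proj₂ (proj₂ attained))))

      S⊂L : S ⊂ L
      S⊂L = S⊆L , proj₁ attained , ∈-subset⁺ (≤-reflexive (proj₂ (proj₂ attained))) , proj₁ (proj₂ attained)

      excess-diff : ∀ {A} → S ⊆ A → ∀ e → 0# ≤ excess a A e - excess a S e
      excess-diff {A} S⊆A e = by (e ∈? S) (e ∈? A)
        where
        by : Dec (e ∈ S) → Dec (e ∈ A) → 0# ≤ excess a A e - excess a S e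
        by (yes p) _       = 0≤b-a (≤-reflexive (trans (if-yes (e ∈? S) p) (sym (if-yes (e ∈? A) (S⊆A p)))))
        by (no ¬p) (yes q) = 0≤b-a (≤-respˡ (sym (if-no (e ∈? S) ¬p)) (≤-respʳ (sym (if-yes (e ∈? A) q)) (0≤b-a (a≤ e ¬p))))
        by (no ¬p) (no ¬q) = 0≤b-a (≤-reflexive (trans (if-no (e ∈? S) ¬p) (sym (if-no (e ∈? A) ¬q))))

      excess-diff-L : ∀ e → excess a L e ≈ excess a S e
      excess-diff-L e = by (e ∈? S) (e ∈? L)
        where
        by : Dec (e ∈ S) → Dec (e ∈ L) → excess a L e ≈ excess a S e
        by (yes p) _       = trans (if-yes (e ∈? L) (S⊆L p)) (sym (if-yes (e ∈? S) p))
        by (no ¬p) (yes q) = trans (if-yes (e ∈? L) q) (trans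
          (trans (+-congʳ (≤-antisym (∈-subset⁻ q) (a≤ e ¬p))) (-‿inverseʳ a)) (sym (if-no (e ∈? S) ¬p)))
        by (no ¬p) (no ¬q) = trans (if-no (e ∈? L) ¬q) (sym (if-no (e ∈? S) ¬p))

      -- The left side is c(A) - c(S). Membership in the base bounds c(A) by β(A), while c(S) equals
      -- β(S) because `S` is lower. For `A` containing `S` the sum is the total of c - a over the
      -- new edges.
      βgap : ∀ A → sum (λ e → excess a A e - excess a S e) + a * (fromℕ (∣ A ∣) - fromℕ (∣ S ∣)) ≤ β A - β S
      βgap A = begin
        sum (λ e → excess a A e - excess a S e) + a * (n - m)
          ≈⟨ +-congʳ (trans (sum-sub (excess a A) (excess a S)) (+-cong (total-excess a A) (-‿cong (total-excess a S)))) ⟩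
        (total-over c A - a * n) - (total-over c S - a * m) + a * (n - m)
          ≈⟨ solve 5 (λ x y a n m → (x :- a :* n) :- (y :- a :* m) :+ a :* (n :- m) := x :- y) refl (total-over c A) (total-over c S) a n m ⟩
        total-over c A - total-over c S
          ≤⟨ +-mono-≤ (proj₁ c∈B A) (≤-reflexive (-‿cong (sym (tight lower)))) ⟩
        β A - β S ∎
        where
        n = fromℕ ∣ A ∣
        m = fromℕ ∣ S ∣

      slope≥ : ∀ A → S ⊂ A → a ≤ slope S A
      slope≥ A S⊂A = ≤-/ (card-gap S⊂A) (≤-trans
        (≤-by (sum-nonneg (excess-diff (proj₁ S⊂A))) (+-comm _ _)) (βgap A))

      slope-L : slope S L ≈ a
      slope-L = /-intro (card-gap S⊂L) (begin-equality
        β L - β S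
          ≈⟨ +-cong (tight (sublevel-lower a)) (-‿cong (tight lower)) ⟩
        total-over c L - total-over c S
          ≈⟨ solve 5 (λ x y a n m → (x :- a :* n) :- (y :- a :* m) :+ a :* (n :- m) := x :- y) refl (total-over c L) (total-over c S) a n m ⟨
        (total-over c L - a * n) - (total-over c S - a * m) + a * (n - m)
          ≈⟨ +-congʳ (+-cong (total-excess a L) (-‿cong (total-excess a S))) ⟨
        sum (excess a L) - sum (excess a S) + a * (n - m)
          ≈⟨ +-congʳ (trans (+-congʳ (sum-cong-≋ excess-diff-L)) (-‿inverseʳ _)) ⟩
        0# + a * (n - m)
          ≈⟨ +-identityˡ _ ⟩
        a * (n - m) ∎)
        where
        n = fromℕ ∣ L ∣
        m = fromℕ ∣ S ∣

      minimum : IsMinimum (S ⊂_) (slope S) a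
      minimum = (L , S⊂L , slope-L) , slope≥

      -- A minimiser has no room in `βgap` for a positive excess, so each of its edges outside `S`
      -- has entry exactly `a` and lies in `L`.
      largest : IsLargestMinimizer (S ⊂_) (slope S) L
      largest = (S⊂L , λ A S⊂A → ≤-respˡ (sym slope-L) (slope≥ A S⊂A)) , contains
        where
        contains : ∀ B → IsMinimizer (S ⊂_) (slope S) B → B ⊆ L
        contains B (S⊂B , min) {e} e∈B = by (e ∈? S)
          where
          steep : β B - β S ≤ a * (fromℕ (∣ B ∣) - fromℕ (∣ S ∣))
          steep = ≤-respˡ (/-*-cancel (card-gap S⊂B))
            (*-mono-nonnegʳ (proj₁ (card-gap S⊂B)) (≤-respʳ slope-L (min L S⊂L)))
          no-excess : sum (λ e → excess a B e - excess a S e) ≤ 0#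
          no-excess = ≤-by (0≤b-a (≤-trans (βgap B) steep))
            (solve 2 (λ s x → s :+ (x :- (s :+ x)) := con ℤ.0ℤ) refl _ _)
          by : Dec (e ∈ S) → e ∈ L
          by (yes e∈S) = S⊆L e∈S
          by (no e∉S)  = ∈-subset⁺ (≤-reflexive (begin-equality
            c e                              ≈⟨ solve 2 (λ c a → c := c :- a :- con ℤ.0ℤ :+ a) refl (c e) a ⟩
            c e - a - 0# + a                 ≈⟨ +-congʳ (+-cong (if-yes (e ∈? B) e∈B) (-‿cong (if-no (e ∈? S) e∉S))) ⟨
            excess a B e - excess a S e + a  ≈⟨ +-congʳ (sum≤0⇒≈0 (excess-diff (proj₁ S⊂B)) no-excess e) ⟩
            0# + a                           ≈⟨ +-identityˡ a ⟩
            a                                ∎))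

    minimum-unique : ∀ {X : Set} {P : X → Set} {f : X → ℝ} {u v} → IsMinimum P f u → IsMinimum P f v → u ≈ v
    minimum-unique ((x , Px , fx≈u) , u≤) ((y , Py , fy≈v) , v≤) =
      ≤-antisym (≤-respʳ fy≈v (u≤ y Py)) (≤-respʳ fx≈u (v≤ x Px))

    largest-unique : ∀ {P f A B} → IsLargestMinimizer P f A → IsLargestMinimizer P f B → A ≡ B
    largest-unique (minA , A-largest) (minB , B-largest) = ⊆-antisym (B-largest _ minA) (A-largest _ minB)

    -- A proper superset of `S` exists, hence a least entry outside `S`. `Step` at that entry
    -- produces a minimum and a largest minimiser, and both are unique.
    recursion-step : ∀ {S S′ a′} → IsLower c S → IsMinimum (S ⊂_) (slope S) a′ →
      IsLargestMinimizer (S ⊂_) (slope S) S′ →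
      IsLower c S′ × (∀ e → e ∉ S → e ∈ S′ → c e ≈ a′)
    recursion-step {S} {S′} {a′} lower min@((B , (_ , f , _ , f∉S) , _) , _) largest′ =
      go (argmin (_∉ S) c (f , f∉S))
      where
      go : (∃ λ i → i ∉ S × (∀ j → j ∉ S → c i ≤ c j)) →
           IsLower c S′ × (∀ e → e ∉ S → e ∈ S′ → c e ≈ a′)
      go (i , i∉S , i≤) = ≡.subst (IsLower c) L≡S′ (sublevel-lower (c i)) , λ e e∉S e∈S′ →
        trans (≤-antisym (∈-subset⁻ (≡.subst (e ∈_) (≡.sym L≡S′) e∈S′)) (i≤ e e∉S)) (minimum-unique minimum min)
        where
        open Step lower i≤ (i , i∉S , refl)
        L≡S′ : L ≡ S′
        L≡S′ = largest-unique largest largest′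

    -- Starting from the empty set, lowerness passes along any run of the recursion, so
    -- `recursion-step` applies at every stage.
    recursion-determines : ∀ (s : ℕ) (α′ : Fin s → ℝ) (A′ : Fin (suc s) → Subset size) →
      A′ zero ≡ ⊥ → SatisfiesRecursion α′ A′ →
      ∀ j e → e ∉ A′ (inject₁ j) → e ∈ A′ (suc j) → c e ≈ α′ j
    recursion-determines s α′ A′ A₀≡⊥ rec j = proj₂ (recursion-step (lower (inject₁ j)) (proj₁ (rec j)) (proj₂ (rec j)))
      where
      lower : ∀ i → IsLower c (A′ i)
      lower = <-weakInduction (IsLower c ∘ A′) (≡.subst (IsLower c) (≡.sym A₀≡⊥) ⊥-lower)
        (λ i low → proj₁ (recursion-step low (proj₁ (rec i)) (proj₂ (rec i))))

    module _ {r : ℕ} {α : Fin r → ℝ} (entries : AreDistinctEntries c α) where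

      α-mono : ∀ {i j} → i Fin.≤ j → α i ≤ α j
      α-mono {i} {j} i≤j with Fin.<-cmp i j
      ... | tri< i<j _ _    = proj₁ (proj₁ entries i j i<j)
      ... | tri≈ _ ≡.refl _ = ≤-refl
      ... | tri> _ _ j<i    = contradiction i≤j (ℕ.<⇒≱ j<i)

      levelSet-lower : ∀ j → IsLower c (levelSet c α j)
      levelSet-lower zero    = ⊥-lower
      levelSet-lower (suc j) = sublevel-lower (α j)

    module LevelSets {r : ℕ} {α : Fin (suc r) → ℝ} (entries : AreDistinctEntries c α) where

      α₀≤ : ∀ e → α zero ≤ c e
      α₀≤ e with proj₂ (proj₂ entries) e
      ... | k , ce≈ = ≤-respʳ (sym ce≈) (α-mono entries {zero} {k} z≤n)

      ≤-last : ∀ e → c e ≤ α (last r)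
      ≤-last e with proj₂ (proj₂ entries) e
      ... | k , ce≈ = ≤-respˡ (sym ce≈) (α-mono entries (Fin.≤fromℕ k))

      no-entry-between : ∀ (i : Fin r) e → c e ≤ α (inject₁ i) ⊎ α (suc i) ≤ c e
      no-entry-between i e with proj₂ (proj₂ entries) e
      ... | k , ce≈ with suc (Fin.toℕ i) ℕ.≤? Fin.toℕ k
      ...   | yes i<k = inj₂ (≤-respʳ (sym ce≈) (α-mono entries i<k))
      ...   | no  i≮k = inj₁ (≤-respˡ (sym ce≈) (α-mono entries
        (ℕ.≤-trans (ℕ.≤-pred (ℕ.≰⇒> i≮k)) (ℕ.≤-reflexive (≡.sym (Fin.toℕ-inject₁ i))))))

      levelSet-last : levelSet c α (last (suc r)) ≡ ⊤
      levelSet-last = ⊆-antisym (⊆-max _) (λ {e} _ → ∈-subset⁺ (≤-last e))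

      levelSets-recursion : SatisfiesRecursion α (levelSet c α)
      levelSets-recursion zero = Step.minimum ⊥-lower outside-min attained , Step.largest ⊥-lower outside-min attained
        where
        outside-min : ∀ e → e ∉ ⊥ → α zero ≤ c e
        outside-min e _ = α₀≤ e
        attained : ∃ λ e → e ∉ ⊥ × c e ≈ α zero
        attained = proj₁ (proj₁ (proj₂ entries) zero) , ∉⊥ , proj₂ (proj₁ (proj₂ entries) zero)
      levelSets-recursion (suc i) = Step.minimum (sublevel-lower _) outside-min attained , Step.largest (sublevel-lower _) outside-min attained
        where
        outside-min : ∀ e → e ∉ subset (λ e → c e ≤ α (inject₁ i)) → α (suc i) ≤ c e
        outside-min e e∉ with no-entry-between i e
        ... | inj₁ le = contradiction (∈-subset⁺ le) e∉
        ... | inj₂ ge = ge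
        attained : ∃ λ e → e ∉ subset (λ e → c e ≤ α (inject₁ i)) × c e ≈ α (suc i)
        attained with proj₁ (proj₂ entries) (suc i)
        ... | e , ce≈ = e , (λ e∈ → <⇒≱ (proj₁ entries (inject₁ i) (suc i) (ℕ.≤-reflexive (≡.cong suc (Fin.toℕ-inject₁ i))))
                                  (≤-respˡ ce≈ (∈-subset⁻ e∈))) , ce≈

      -- Abel summation over the level sets.
      c-optimal : ∀ {z} → InBase z → 0# ≤ sum (λ e → c e * (z e - c e))
      c-optimal {z} z∈B = ≤-respʳ top-value (partial-nonneg (last r))
        where
        y : Edge → ℝ
        y e = z e - c e
        y-total : ∀ A → total-over y A ≈ total-over z A - total-over c A
        y-total A = trans (total-+ z (λ e → - c e) A) (+-congˡ (trans
          (sum-cong-≋ (λ e → neg-if (does (e ∈? A)) (c e))) (sum-neg (λ e → if does (e ∈? A) then c e else 0#))))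
          where
          neg-if : ∀ (b : Bool) x → (if b then - x else 0#) ≈ - (if b then x else 0#)
          neg-if true  x = refl
          neg-if false x = solve 0 (con ℤ.0ℤ := :- con ℤ.0ℤ) refl
        y-level : ∀ a → total-over y (subset (λ e → c e ≤ a)) ≤ 0#
        y-level a = ≤-respˡ (sym (y-total _)) (≤-trans
          (+-monoˡ-≤ _ (≤-trans (proj₁ z∈B _) (≤-reflexive (tight (sublevel-lower a))))) (≤-reflexive (-‿inverseʳ _)))
        y-sum : sum y ≈ 0#
        y-sum = trans (sym (total-⊤ y)) (trans (y-total ⊤)
          (trans (+-cong (trans (proj₂ z∈B) (sym (proj₂ c∈B))) refl) (-‿inverseʳ _)))
        -- Truncating at level `a` and subtracting `a` makes the induction start at 0. Passing from
        -- a level a to the next level b adds (a - b) y(A), with A the sublevel set of a: a product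
        -- of two numbers that are at most 0.
        summand : ℝ → Edge → ℝ
        summand a e = if does (em {c e ≤ a}) then (c e - a) * y e else 0#
        partial-nonneg : ∀ i → 0# ≤ sum (summand (α i))
        partial-nonneg = <-weakInduction (λ i → 0# ≤ sum (summand (α i)))
          (≤-reflexive (sym (sum-0 λ e → if-≈ em
            (λ le → trans (*-congʳ (trans (+-congʳ (≤-antisym le (α₀≤ e))) (-‿inverseʳ _))) (zeroˡ _)) (λ _ → refl))))
          step
          where
          step : ∀ i → 0# ≤ sum (summand (α (inject₁ i))) → 0# ≤ sum (summand (α (suc i)))
          step i 0≤ = ≤-respʳ (sym split) (+-nonneg 0≤
            (≤-respʳ (solve 3 (λ a b t → (b :- a) :* :- t := (a :- b) :* t) refl a b _)
              (*-nonneg (0≤b-a a≤b) (0≤-x (y-level a)))))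
            where
            a = α (inject₁ i)
            b = α (suc i)
            a≤b : a ≤ b
            a≤b = α-mono entries (ℕ.≤-trans (ℕ.≤-reflexive (Fin.toℕ-inject₁ i)) (ℕ.n≤1+n _))
            A = subset (λ e → c e ≤ a)
            per-edge : ∀ e → summand b e ≈ summand a e + (if does (e ∈? A) then (a - b) * y e else 0#)
            per-edge e = by (no-entry-between i e)
              where
              by : c e ≤ a ⊎ b ≤ c e → _
              by (inj₁ ce≤a) = begin-equality
                summand b e                             ≈⟨ if-yes em (≤-trans ce≤a a≤b) ⟩
                (c e - b) * y e                         ≈⟨ solve 4 (λ c a b y → (c :- b) :* y := (c :- a) :* y :+ (a :- b) :* y) refl (c e) a b (y e) ⟩
                (c e - a) * y e + (a - b) * y e         ≈⟨ +-cong (if-yes em ce≤a) (if-yes (e ∈? A) (∈-subset⁺ ce≤a)) ⟨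
                summand a e + (if does (e ∈? A) then (a - b) * y e else 0#) ∎
              by (inj₂ b≤ce) = trans (if-≈ em
                (λ ce≤b → trans (*-congʳ (trans (+-congʳ (≤-antisym ce≤b b≤ce)) (-‿inverseʳ b))) (zeroˡ _)) (λ _ → refl))
                (sym (trans (+-cong (if-no em ce≰a) (if-no (e ∈? A) (ce≰a ∘ ∈-subset⁻))) (+-identityˡ 0#)))
                where
                ce≰a : ¬ c e ≤ a
                ce≰a ce≤a = <⇒≱ (proj₁ entries (inject₁ i) (suc i) (ℕ.≤-reflexive (≡.cong suc (Fin.toℕ-inject₁ i)))) (≤-trans b≤ce ce≤a)
            split : sum (summand b) ≈ sum (summand a) + (a - b) * total-over y A
            split = trans (sum-cong-≋ per-edge) (trans
              (∑-distrib-+ (summand a) (λ e → if does (e ∈? A) then (a - b) * y e else 0#))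
              (+-congˡ (sym (trans (*-distribˡ-sum (a - b) (λ e → if does (e ∈? A) then y e else 0#))
                (sum-cong-≋ (λ e → if-*ˡ (does (e ∈? A)) (a - b) (y e)))))))
        -- At the top level nothing is truncated, and the subtracted constant disappears because `y`
        -- sums to 0.
        top-value : sum (summand (α (last r))) ≈ sum (λ e → c e * y e)
        top-value = begin-equality
          sum (summand m)                       ≈⟨ sum-cong-≋ (λ e → trans (if-yes em (≤-last e)) (solve 3 (λ c m y → (c :- m) :* y := c :* y :- m :* y) refl (c e) m (y e))) ⟩
          sum (λ e → c e * y e - m * y e)       ≈⟨ sum-sub (λ e → c e * y e) (λ e → m * y e) ⟩
          sum (λ e → c e * y e) - sum (λ e → m * y e) ≈⟨ +-congˡ (-‿cong (trans (sym (*-distribˡ-sum m y)) (trans (*-congˡ y-sum) (zeroʳ m)))) ⟩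
          sum (λ e → c e * y e) - 0#            ≈⟨ solve 1 (λ x → x :- con ℤ.0ℤ := x) refl _ ⟩
          sum (λ e → c e * y e)                 ∎
          where m = α (last r)

      squares : (Edge → ℝ) → ℝ
      squares z = sum (λ e → z e * z e)

      squares-expand : ∀ z → squares z ≈ squares c + (sum (λ e → c e * (z e - c e)) + sum (λ e → c e * (z e - c e))) +
                                         sum (λ e → (z e - c e) * (z e - c e))
      squares-expand z = begin-equality
        squares z ≈⟨ sum-cong-≋ (λ e → solve 2 (λ c z → z :* z := c :* c :+ (c :* (z :- c) :+ c :* (z :- c)) :+ (z :- c) :* (z :- c)) refl (c e) (z e)) ⟩
        sum (λ e → c e * c e + (x e + x e) + q e) ≈⟨ ∑-distrib-+ (λ e → c e * c e + (x e + x e)) q ⟩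
        sum (λ e → c e * c e + (x e + x e)) + sum q ≈⟨ +-congʳ (trans (∑-distrib-+ (λ e → c e * c e) (λ e → x e + x e)) (+-congˡ (∑-distrib-+ x x))) ⟩
        squares c + (sum x + sum x) + sum q ∎
        where
        x q : Edge → ℝ
        x e = c e * (z e - c e)
        q e = (z e - c e) * (z e - c e)

      -- The cross term of the expansion about `c` is nonnegative by `c-optimal`. The remaining
      -- squared distance forces any other minimiser to coincide with `c`.
      squares-gap : ∀ {z} → InBase z → squares c + sum (λ e → (z e - c e) * (z e - c e)) ≤ squares z
      squares-gap {z} z∈B = ≤-respʳ (sym (squares-expand z)) (+-monoˡ-≤ _ (≤-by (+-nonneg (c-optimal z∈B) (c-optimal z∈B)) refl))

      0<½ : 0# < 1# / fromℕ 2
      0<½ = *-pos 0<1 (⁻¹-pos (<-respʳ (sym fromℕ2) 0<2))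

      c-minimizes : IsMinimizer InBase energy c
      c-minimizes = c∈B , λ z z∈B → *-mono-nonneg (proj₁ 0<½)
        (≤-trans (≤-by (sum-nonneg (λ e → square-nonneg (z e - c e))) refl) (squares-gap z∈B))

      minimizer-unique : ∀ z → IsMinimizer InBase energy z → ∀ e → z e ≈ c e
      minimizer-unique z (z∈B , z-min) e = begin-equality
        z e               ≈⟨ solve 2 (λ z c → z := (z :- c) :+ c) refl (z e) (c e) ⟩
        (z e - c e) + c e ≈⟨ +-congʳ (square≈0 (sum≤0⇒≈0 (λ e → square-nonneg (z e - c e)) squares≤0 e)) ⟩
        0# + c e          ≈⟨ +-identityˡ _ ⟩
        c e               ∎
        where
        squares≤0 : sum (λ e → (z e - c e) * (z e - c e)) ≤ 0#
        squares≤0 = ≤-by (0≤b-a (≤-trans (squares-gap z∈B)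
            (*-cancelʳ-≤ 0<½ (≤-respˡ (*-comm _ _) (≤-respʳ (*-comm _ _) (z-min c c∈B))))))
          (solve 2 (λ s q → q :+ (s :- (s :+ q)) := con ℤ.0ℤ) refl (squares c) _)

    module LeastEntry {c* : ℝ} (c*-min : ∀ e → c* ≤ c e) (c*-attained : ∃ λ e → c e ≈ c*) where

      E* : Subset size
      E* = subset (λ e → c e ≈ c*)

      open Step ⊥-lower (λ e _ → c*-min e) (proj₁ c*-attained , ∉⊥ , proj₂ c*-attained)

      E*≡L : E* ≡ L
      E*≡L = ⊆-antisym (λ e∈ → ∈-subset⁺ (≤-reflexive (∈-subset⁻ e∈)))
        (λ {e} e∈ → ∈-subset⁺ (≤-antisym (∈-subset⁻ e∈) (c*-min e)))

      βE* : β E* ≈ c* * fromℕ ∣ E* ∣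
      βE* = trans (tight (≡.subst (IsLower c) (≡.sym E*≡L) (sublevel-lower c*)))
        (trans (total-cong E* (λ e → ∈-subset⁻)) (total-const c* E*))

      E*-nonempty : Nonempty E*
      E*-nonempty = proj₁ c*-attained , ∈-subset⁺ (proj₂ c*-attained)

      β≥ : ∀ A → c* * fromℕ ∣ A ∣ ≤ β A
      β≥ A = ≤-trans (≤-respˡ (total-const c* A) (total-mono A (λ e _ → c*-min e))) (proj₁ c∈B A)

      density-minimum : IsMinimum Nonempty density c*
      density-minimum = (E* , E*-nonempty , /-intro (card-pos E*-nonempty) βE*) ,
        λ A ne → ≤-/ (card-pos ne) (β≥ A)

      minimizer⇒tight : ∀ {X} → IsMinimizer Nonempty density X → β X ≈ c* * fromℕ ∣ X ∣
      minimizer⇒tight {X} (ne , min) = /-elim (card-pos ne) (≤-antisym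
        (≤-respʳ (proj₂ (proj₂ (proj₁ density-minimum))) (min E* E*-nonempty))
        (proj₂ density-minimum X ne))

      tight⇒minimizer : ∀ {X} → Nonempty X → β X ≈ c* * fromℕ ∣ X ∣ → IsMinimizer Nonempty density X
      tight⇒minimizer ne eq = ne , λ A neA → ≤-respˡ (sym (/-intro (card-pos ne) eq)) (proj₂ density-minimum A neA)

      -- As β vanishes on the empty set, the slope from the empty set is the density. So `X` is a
      -- minimiser for the first step of the recursion, whose largest minimiser is `E*`.
      tight⊆E* : ∀ {X} → Nonempty X → β X ≈ c* * fromℕ ∣ X ∣ → X ⊆ E*
      tight⊆E* {X} ne eq {e} e∈X = ≡.subst (e ∈_) (≡.sym E*≡L) (proj₂ largest X (⊥⊂X , slope-min) e∈X)
        where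
        ⊥⊂X : ⊥ ⊂ X
        ⊥⊂X = (λ e∈⊥ → contradiction e∈⊥ ∉⊥) , e , e∈X , ∉⊥
        ∣⊥∣≈0 : fromℕ ∣ ⊥ {n = size} ∣ ≈ 0#
        ∣⊥∣≈0 = reflexive (≡.cong fromℕ (∣⊥∣≡0 size))
        slope-X : slope ⊥ X ≈ c*
        slope-X = /-intro (card-gap ⊥⊂X) (trans (+-cong eq (-‿cong β-⊥)) (trans
          (solve 2 (λ c n → c :* n :- con ℤ.0ℤ := c :* (n :- con ℤ.0ℤ)) refl c* (fromℕ ∣ X ∣))
          (*-congˡ (+-congˡ (-‿cong (sym ∣⊥∣≈0))))))
        slope-min : ∀ A → ⊥ ⊂ A → slope ⊥ X ≤ slope ⊥ A
        slope-min A ⊥⊂A = ≤-respˡ (sym slope-X) (slope≥ A ⊥⊂A)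

      E*-largest : IsLargestMinimizer Nonempty density E*
      E*-largest = tight⇒minimizer E*-nonempty βE* , λ B min → tight⊆E* (proj₁ min) (minimizer⇒tight min)

      -- Submodularity bounds the sum of β over union and intersection by `c*` times the sum of
      -- their sizes, and `β≥` bounds each summand from below, so both bounds are equalities. Since
      -- `β≥` holds for the empty set too, the union needs no common edge.
      minimizers-closed : ∀ X Y → IsMinimizer Nonempty density X → IsMinimizer Nonempty density Y →
        IsMinimizer Nonempty density (X ∪ Y) ×
        (Nonempty (X ∩ Y) → IsMinimizer Nonempty density (X ∩ Y))
      minimizers-closed X Y minX@((e , e∈X) , _) minY =
        tight⇒minimizer (e , p⊆p∪q Y e∈X) (≤-antisym (cancel (β≥ (X ∩ Y)) combined) (β≥ (X ∪ Y))) ,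
        λ ne → tight⇒minimizer ne (≤-antisym (cancel (β≥ (X ∪ Y)) (≤-respˡ (+-comm _ _) (≤-respʳ (+-comm _ _) combined))) (β≥ (X ∩ Y)))
        where
        combined : β (X ∪ Y) + β (X ∩ Y) ≤ c* * fromℕ ∣ X ∪ Y ∣ + c* * fromℕ ∣ X ∩ Y ∣
        combined = begin
          β (X ∪ Y) + β (X ∩ Y)                           ≤⟨ β-submodular X Y ⟩
          β X + β Y                                       ≈⟨ +-cong (minimizer⇒tight minX) (minimizer⇒tight minY) ⟩
          c* * fromℕ ∣ X ∣ + c* * fromℕ ∣ Y ∣             ≈⟨ distribˡ c* _ _ ⟨
          c* * (fromℕ ∣ X ∣ + fromℕ ∣ Y ∣)                ≈⟨ *-congˡ (card-modular X Y) ⟨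
          c* * (fromℕ ∣ X ∪ Y ∣ + fromℕ ∣ X ∩ Y ∣)        ≈⟨ distribˡ c* _ _ ⟩
          c* * fromℕ ∣ X ∪ Y ∣ + c* * fromℕ ∣ X ∩ Y ∣     ∎
        cancel : ∀ {p q r s} → q ≤ s → p + s ≤ r + q → p ≤ r
        cancel {p} {q} {r} {s} q≤s le = ≤-by (+-nonneg (0≤b-a le) (0≤b-a q≤s))
          (solve 4 (λ p q r s → p :+ ((r :+ q :- (p :+ s)) :+ (s :- q)) := r) refl p q r s)

theorem1p3 :
  (em : ExcludedMiddle 0ℓ) (R : CompleteOrderedField)
  (T : Graph) → IsTree T → Graph.Edge T →
  let open RicciFlow em R T in
  (w : ℝ → Metric) (κ : ℝ → Edge → ℝ) →
  UnnormalizedFlow w κ ⊎ NormalizedFlow w κ →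
  (c : Edge → ℝ) → (∀ e → LimitAtInfinity (λ t → κ t e) (c e)) →
  (c* : ℝ) → IsMinimum U c c* →
  (r : ℕ) (α : Fin r → ℝ) → AreDistinctEntries c α →
  let E* = subset (λ e → c e ≈ c*)
      A  = levelSet c α
  in
  -- β is submodular
  (∀ X Y → β (X ∪ Y) + β (X ∩ Y) ≤ β X + β Y) ×
  -- c is the unique minimizer of the energy over B(β)
  IsMinimizer InBase energy c ×
  (∀ z → IsMinimizer InBase energy z → ∀ e → z e ≈ c e) ×
  -- the level sets
  A (last r) ≡ ⊤ ×
  (∀ j → β (A j) ≈ total-over c (A j)) ×
  SatisfiesRecursion α A ×
  -- every run of the recursion from the empty set to E yields c
  (∀ (s : ℕ) (α′ : Fin s → ℝ) (A′ : Fin (suc s) → Subset size) →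
    A′ zero ≡ ⊥ → A′ (last s) ≡ ⊤ → SatisfiesRecursion α′ A′ →
    ∀ j e → e ∉ A′ (inject₁ j) → e ∈ A′ (suc j) → c e ≈ α′ j) ×
  -- the minimal entry and its level set
  IsMinimum Nonempty density c* ×
  IsLargestMinimizer Nonempty density E* ×
  (∀ e → (e ∈ E*) ⇔ (∃ λ X → Nonempty X × (β X ≈ c* * fromℕ ∣ X ∣) × e ∈ X)) ×
  (β E* ≈ c* * fromℕ ∣ E* ∣) ×
  -- the minimizers of λ are closed under unions and nonempty intersections
  (∀ X Y → IsMinimizer Nonempty density X → IsMinimizer Nonempty density Y →
    IsMinimizer Nonempty density (X ∪ Y) ×
    (Nonempty (X ∩ Y) → IsMinimizer Nonempty density (X ∩ Y)))
-- An empty list of distinct entries is impossible, since the entry at `e₀` must occur in it.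
theorem1p3 em R T isTree e₀ w κ flow c κ→c c* c*-min ℕ.zero α entries
  with proj₁ (proj₂ (proj₂ entries) e₀)
... | ()
theorem1p3 em R T isTree e₀ w κ flow c κ→c c* (c*-attained , c*-least) (suc r) α entries =
  β-submodular ,
  c-minimizes ,
  minimizer-unique ,
  levelSet-last ,
  (λ j → lower⇒tight (levelSet-lower entries j)) ,
  levelSets-recursion ,
  (λ s α′ A′ A₀≡⊥ _ → recursion-determines s α′ A′ A₀≡⊥) ,
  density-minimum ,
  E*-largest ,
  (λ e → mk⇔
    (λ e∈E* → _ , E*-nonempty , βE* , e∈E*)
    (λ { (X , ne , eq , e∈X) → tight⊆E* ne eq e∈X })) ,
  βE* ,
  minimizers-closed
  where
  open RicciFlow em R T
  open SetFunctions em R T isTree e₀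
  open FlowLimit em R T isTree e₀
  open Optimum em R T isTree e₀
  open Limits (relativeFlow flow) κ→c
  least : ∀ e → c* ≤ c e
  least e = c*-least e _
  attained : ∃ λ e → c e ≈ c*
  attained = proj₁ c*-attained , proj₂ (proj₂ c*-attained)
  open Tight limit-in-base lower⇒tight
  open LevelSets entries
  open LeastEntry least attained
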